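{- Let $n\ge1$ and let $p_1,\dots,p_n>0$ and $q_1,\dots,q_n\ge0$ be integers. Then there exist polynomials $G_0(t,z),\dots,G_n(t,z)\in\mathbb Z[t,z]$ such that for every $\zeta\in\mathbb C$ the polynomials $G_0(t,\zeta),\dots,G_n(t,\zeta)\in\mathbb C[t]$ are not all zero, and for every integer $t\ge0$ $$\sum_{l=0}^nG_l(t,z)\,\mathcal L_n\big(p_1(t+l),q_1(t+l);\dots;p_n(t+l),q_n(t+l);z\big)=0$$ identically in $z$. Furthermore, if $n\ge2$ and $p_1\le p_2\le\cdots\le p_{m+1}$, $q_1\le q_2\le\cdots\le q_{m+1}$ for some $1\le m<n$, then for every integer $t\ge0$ $$\sum_{l=0}^nG_l(t,z)\,\mathbf T^m\Big(\mathcal L_n\big(p_1(t+l),q_1(t+l);\dots;p_n(t+l),q_n(t+l);z\big)\Big)=0.$$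
   Context: For an integer $k\ge0$, $D_k f(u)=\frac1{k!}\frac{d^k}{du^k}f(u)$. For integers $p_1,q_1,\dots,p_n,q_n\ge0$ the multiple Legendre polynomials are defined recursively by $\mathcal L_0(z)=1$ and $\mathcal L_n(p_1,q_1;\dots;p_n,q_n;z)=z^{q_n}(1-z)^{p_n}D_{p_n+q_n}\big(z^{p_n}(1-z)^{q_n}\mathcal L_{n-1}(p_1,q_1;\dots;p_{n-1},q_{n-1};z)\big)$, differentiation being in $z$. $\mathbf T:\mathbb C[z]\to\mathbb C[z]$ is the linear map $\mathbf T(P)(z)=\int_0^1\frac{P(z)-P(y)}{z-y}\,dy$, and $\mathbf T^m$ is its $m$-fold iterate. -}

module Defs where

open import Level using (0ℓ)
open import Data.Nat as ℕ using (ℕ; zero; suc; _!)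
open import Data.Nat.Properties using (_!≢0)
open import Data.Integer as ℤ using (ℤ; +_; -[1+_])
open import Data.Rational as ℚ using (ℚ; 0ℚ; 1ℚ)
open import Data.List using (List; []; _∷_; map; foldl; foldr; reverse; upTo)
open import Data.Product using (_×_; _,_)
open import Data.Empty using (⊥)
open import Algebra.Bundles using (CommutativeRing)
open import Function using (_∘_)
open import Relation.Binary.PropositionalEquality using (_≡_)
open import Data.List.Relation.Unary.All using (All)

-- Univariate polynomials over ℚ, as coefficient lists
-- (index i = coefficient of z^i; trailing zeros allowed).

Poly : Set
Poly = List ℚ

infixl 6 _+P_
infixl 7 _*P_

_+P_ : Poly → Poly → Poly
[]      +P q       = q
(a ∷ p) +P []      = a ∷ p
(a ∷ p) +P (b ∷ q) = (a ℚ.+ b) ∷ (p +P q)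

scaleP : ℚ → Poly → Poly
scaleP c = map (c ℚ.*_)

_*P_ : Poly → Poly → Poly
[]      *P q = []
(a ∷ p) *P q = scaleP a q +P (0ℚ ∷ (p *P q))

oneP : Poly
oneP = 1ℚ ∷ []

zP : Poly
zP = 0ℚ ∷ 1ℚ ∷ []

1-zP : Poly
1-zP = 1ℚ ∷ ℚ.- 1ℚ ∷ []

_^P_ : Poly → ℕ → Poly
p ^P zero  = oneP
p ^P suc k = p *P (p ^P k)

IsZeroP : Poly → Set
IsZeroP = All (_≡ 0ℚ)

sumP : List Poly → Poly
sumP = foldr _+P_ []

ℕtoℚ : ℕ → ℚ
ℕtoℚ n = + n ℚ./ 1

ℤtoℚ : ℤ → ℚ
ℤtoℚ a = a ℚ./ 1

deriv : Poly → Poly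
deriv []      = []
deriv (_ ∷ p) = go 1 p
  where
  go : ℕ → Poly → Poly
  go k []      = []
  go k (b ∷ r) = (ℕtoℚ k ℚ.* b) ∷ go (suc k) r

iterate : ℕ → (Poly → Poly) → Poly → Poly
iterate zero    f p = p
iterate (suc k) f p = f (iterate k f p)

D : ℕ → Poly → Poly
D k p = scaleP (ℚ._/_ (+ 1) (k !) {{k !≢0}}) (iterate k deriv p)

legendreStep : Poly → ℕ × ℕ → Poly
legendreStep L (p , q) =
  (zP ^P q) *P (1-zP ^P p) *P D (p ℕ.+ q) ((zP ^P p) *P (1-zP ^P q) *P L)

multiLegendre : List (ℕ × ℕ) → Poly
multiLegendre = foldl legendreStep oneP

-- The operator T(P)(z) = ∫₀¹ (P(z) - P(y)) / (z - y) dy on polynomials.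
-- Since (z^k - y^k)/(z - y) = Σ_{j<k} z^j y^{k-1-j} and ∫₀¹ y^i dy = 1/(i+1),
-- T(z^k) = Σ_{j<k} z^j / (k - j); T is extended linearly.

Tmono : ℕ → Poly
Tmono k = reverse (map (λ i → (+ 1) ℚ./ suc i) (upTo k))

T : Poly → Poly
T = go 0
  where
  go : ℕ → Poly → Poly
  go k []      = []
  go k (a ∷ p) = scaleP a (Tmono k) +P go (suc k) p

Tpow : ℕ → Poly → Poly
Tpow m = iterate m T

-- Bivariate integer polynomials G(t,z) ∈ ℤ[t,z]:
-- a list of rows, row i = coefficient list (in z) of t^i.

Poly2ℤ : Set
Poly2ℤ = List (List ℤ)

evalT : Poly2ℤ → ℕ → Poly
evalT []           t = []
evalT (row ∷ rows) t = map ℤtoℚ row +P scaleP (ℕtoℚ t) (evalT rows t)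

module _ (K : CommutativeRing 0ℓ 0ℓ) where
  open CommutativeRing K

  ℕcast : ℕ → Carrier
  ℕcast zero    = 0#
  ℕcast (suc n) = 1# + ℕcast n

  ℤcast : ℤ → Carrier
  ℤcast (+ n)      = ℕcast n
  ℤcast -[1+ n ]   = - ℕcast (suc n)

  CharZero : Set
  CharZero = ∀ n → ℕcast (suc n) ≈ 0# → ⊥

  evalℤK : List ℤ → Carrier → Carrier
  evalℤK []       ζ = 0#
  evalℤK (c ∷ cs) ζ = ℤcast c + ζ * evalℤK cs ζ

{-# OPTIONS --safe #-}

-- Send z^k to b_k(s) = (-1)^k C(s , k). Multiplication by z becomes h ↦ -Σ_{r<s} h(r), the operator T becomes -d/ds,
-- and f ↦ z^q (1-z)^p D_{p+q}(z^p (1-z)^q f) becomes multiplication by C(s+p , p+q), so that the multiple Legendre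
-- polynomial becomes the hypergeometric term h_t(s) = Π C(s + p_i t , (p_i + q_i) t). For every polynomial Q the
-- function f(s) = Π (s - q_i t) Q(s) h_t(s) satisfies z f(s+1) + (1-z) f(s) = f(0). Since f vanishes to order n at 0,
-- the right-hand side and its first n - 1 derivatives in s are zero, and since f(s) and f(s+1) are both h_t times
-- monic polynomials of degree n + deg Q, this expresses s^(n+k) h_t through lower powers over ℤ[t][z]. Up to a common
-- factor depending on t, the n + 1 functions h_{t+l} are therefore combinations of s^j h_t, j < n, over ℤ[t][z],
-- and fraction-free Euclidean elimination in z yields a relation between them whose coefficients G_l satisfy
-- Σ w_l G_l = δ(t) ≠ 0; hence they have no common zero ζ. The derivatives in s account for T^m with m < n.
module Submission where

open import Defs
open import Level using (0ℓ)
open import Algebra.Bundles using (CommutativeMonoid; CommutativeRing; Ring)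
open import Algebra.Module.Bundles using (LeftModule)
import Algebra.Properties.AbelianGroup as AbelianGroupProperties
import Algebra.Properties.CommutativeSemigroup as CommutativeSemigroupProperties
import Algebra.Properties.Ring as RingProperties
import Algebra.Properties.Semiring.Exp as Exponentiation
import Algebra.Solver.Ring as NormalisingSolver
open import Algebra.Solver.Ring.AlmostCommutativeRing using (fromCommutativeRing; _-Raw-AlmostCommutative⟶_)
open import Data.Empty using (⊥-elim)
open import Data.Fin using (Fin; zero; suc; toℕ; fromℕ<)
import Data.Fin.Properties as Finₚ
open import Data.Integer as ℤ using (ℤ; +_; -[1+_])
import Data.Integer.Properties as ℤₚ
open import Data.List using (List; []; _∷_; map; foldl; length; reverse; tabulate; upTo; _∷ʳ_)
import Data.List.Properties as Listₚ
open import Data.List.Relation.Unary.All using (All; []; _∷_)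
open import Data.Maybe using (Maybe; just; nothing)
open import Data.Nat as ℕ using (ℕ; zero; suc; _!; _≤_; _<_; _∸_; z≤n; s≤s)
open import Data.Nat.GeneralisedArithmetic using (fold)
import Data.Nat.Properties as ℕₚ
open import Data.Nat.Properties using (_!≢0)
open import Data.Product using (Σ; ∃; _×_; _,_; proj₁; proj₂)
open import Data.Rational as ℚ using (ℚ; 0ℚ; 1ℚ; toℚᵘ)
import Data.Rational.Properties as ℚₚ
open import Data.Rational.Unnormalised as ℚᵘ using (mkℚᵘ; *≡*)
import Data.Rational.Unnormalised.Properties as ℚᵘₚ
import Data.Sign as Sign
open import Data.Sum using (inj₁; inj₂)
open import Data.Vec as Vec using (Vec; []; _∷_)
import Data.Vec.Properties as Vecₚ
open import Data.Vec.Relation.Unary.All as VecAll using ([]; _∷_)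
open import Relation.Binary using (IsEquivalence; Setoid)
open import Relation.Binary.PropositionalEquality as ≡ using (_≡_; cong; cong₂; module ≡-Reasoning)
import Relation.Binary.Reasoning.Setoid as SetoidReasoning
open import Relation.Nullary using (Dec; yes; no; ¬_)

-- A relation given by minors could vanish identically at some ζ, and in a ring with zero divisors
-- common factors cannot be divided out. The relation is therefore built together with a certificate
-- `w` that survives specialisation: every elimination step is invertible up to a nonzero element of
-- ℤ[t] and carries the certificate along.
--
-- `T` does not commute with multiplication by z, since T(zP) = z T(P) + ∫₀¹ P, so the identities
-- for T^m do not follow by applying T^m to the first one. Instead, each coefficient of ε^i in the
-- expansion at s + ε is treated as a function of the integer s in its own right, on which z acts by
-- partial sums; this is multiplication by z performed after T^i. What remains to be known about
-- derivatives is only that f vanishes to order n at s = 0. All coefficients with i < n then obey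
-- the same relations over ℤ[t][z], so that one family G serves T^0, ..., T^(n-1) at once.

-- The ring homomorphism from ℤ to a commutative ring

module IntegerCast (K : CommutativeRing 0ℓ 0ℓ) where
  open CommutativeRing K
  open RingProperties ring
  open AbelianGroupProperties +-abelianGroup using (⁻¹-∙-comm)
  open SetoidReasoning setoid

  private
    nat = ℕcast K
    int = ℤcast K

  ℕcast-+ : ∀ m n → nat (m ℕ.+ n) ≈ nat m + nat n
  ℕcast-+ zero    n = sym (+-identityˡ _)
  ℕcast-+ (suc m) n = trans (+-congˡ (ℕcast-+ m n)) (sym (+-assoc _ _ _))

  ℕcast-* : ∀ m n → nat (m ℕ.* n) ≈ nat m * nat n
  ℕcast-* zero    n = sym (zeroˡ _)
  ℕcast-* (suc m) n = begin
    nat (n ℕ.+ m ℕ.* n)       ≈⟨ ℕcast-+ n (m ℕ.* n) ⟩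
    nat n + nat (m ℕ.* n)     ≈⟨ +-cong (sym (*-identityˡ _)) (ℕcast-* m n) ⟩
    1# * nat n + nat m * nat n ≈⟨ distribʳ _ _ _ ⟨
    (1# + nat m) * nat n       ∎

  ℤcast-⊖ : ∀ m n → int (m ℤ.⊖ n) ≈ nat m - nat n
  ℤcast-⊖ m zero = begin
    nat m      ≈⟨ +-identityʳ _ ⟨
    nat m + 0# ≈⟨ +-congˡ -0#≈0# ⟨
    nat m - 0# ∎
  ℤcast-⊖ zero (suc n) = sym (+-identityˡ _)
  ℤcast-⊖ (suc m) (suc n) = begin
    int (suc m ℤ.⊖ suc n)               ≡⟨ cong int (ℤₚ.[1+m]⊖[1+n]≡m⊖n m n) ⟩
    int (m ℤ.⊖ n)                       ≈⟨ ℤcast-⊖ m n ⟩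
    nat m - nat n                       ≈⟨ +-congʳ (+-identityˡ _) ⟨
    (0# + nat m) - nat n                ≈⟨ +-congʳ (+-congʳ (-‿inverseʳ 1#)) ⟨
    ((1# - 1#) + nat m) - nat n         ≈⟨ +-congʳ (+-assoc _ _ _) ⟩
    (1# + (- 1# + nat m)) - nat n       ≈⟨ +-congʳ (+-congˡ (+-comm _ _)) ⟩
    (1# + (nat m + - 1#)) - nat n       ≈⟨ +-congʳ (+-assoc _ _ _) ⟨
    ((1# + nat m) + - 1#) - nat n       ≈⟨ +-assoc _ _ _ ⟩
    (1# + nat m) + (- 1# + - nat n)     ≈⟨ +-congˡ (⁻¹-∙-comm _ _) ⟩
    (1# + nat m) - (1# + nat n)         ∎

  ℤcast-neg : ∀ a → int (ℤ.- a) ≈ - int a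
  ℤcast-neg (+ zero)  = sym -0#≈0#
  ℤcast-neg (+ suc n) = refl
  ℤcast-neg -[1+ n ]  = sym (-‿involutive _)

  ℤcast-+ : ∀ a b → int (a ℤ.+ b) ≈ int a + int b
  ℤcast-+ (+ m)    (+ n)    = ℕcast-+ m n
  ℤcast-+ (+ m)    -[1+ n ] = ℤcast-⊖ m (suc n)
  ℤcast-+ -[1+ m ] (+ n)    = trans (ℤcast-⊖ n (suc m)) (+-comm _ _)
  ℤcast-+ -[1+ m ] -[1+ n ] = begin
    - nat (suc (suc (m ℕ.+ n)))      ≡⟨ cong (λ k → - nat k) (ℕₚ.+-suc (suc m) n) ⟨
    - nat (suc m ℕ.+ suc n)          ≈⟨ -‿cong (ℕcast-+ (suc m) (suc n)) ⟩
    - (nat (suc m) + nat (suc n))    ≈⟨ ⁻¹-∙-comm _ _ ⟨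
    - nat (suc m) + - nat (suc n)    ∎

  ℤcast-* : ∀ a b → int (a ℤ.* b) ≈ int a * int b
  ℤcast-* (+ m)    (+ n)    = begin
    int (Sign.+ ℤ.◃ m ℕ.* n) ≡⟨ cong int (ℤₚ.+◃n≡+n (m ℕ.* n)) ⟩
    nat (m ℕ.* n)            ≈⟨ ℕcast-* m n ⟩
    nat m * nat n            ∎
  ℤcast-* (+ m)    -[1+ n ] = begin
    int (Sign.- ℤ.◃ m ℕ.* suc n) ≡⟨ cong int (ℤₚ.-◃n≡-n (m ℕ.* suc n)) ⟩
    int (ℤ.- + (m ℕ.* suc n))    ≈⟨ ℤcast-neg (+ (m ℕ.* suc n)) ⟩
    - nat (m ℕ.* suc n)          ≈⟨ -‿cong (ℕcast-* m (suc n)) ⟩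
    - (nat m * nat (suc n))      ≈⟨ -‿distribʳ-* _ _ ⟩
    nat m * - nat (suc n)        ∎
  ℤcast-* -[1+ m ] (+ n)    = begin
    int (Sign.- ℤ.◃ suc m ℕ.* n) ≡⟨ cong int (ℤₚ.-◃n≡-n (suc m ℕ.* n)) ⟩
    int (ℤ.- + (suc m ℕ.* n))    ≈⟨ ℤcast-neg (+ (suc m ℕ.* n)) ⟩
    - nat (suc m ℕ.* n)          ≈⟨ -‿cong (ℕcast-* (suc m) n) ⟩
    - (nat (suc m) * nat n)      ≈⟨ -‿distribˡ-* _ _ ⟩
    - nat (suc m) * nat n        ∎
  ℤcast-* -[1+ m ] -[1+ n ] = begin
    nat (suc m ℕ.* suc n)             ≈⟨ ℕcast-* (suc m) (suc n) ⟩
    nat (suc m) * nat (suc n)         ≈⟨ -‿involutive _ ⟨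
    - - (nat (suc m) * nat (suc n))   ≈⟨ -‿cong (-‿distribˡ-* _ _) ⟩
    - (- nat (suc m) * nat (suc n))   ≈⟨ -‿distribʳ-* _ _ ⟩
    - nat (suc m) * - nat (suc n)     ∎

  ℤcast-1 : int (+ 1) ≈ 1#
  ℤcast-1 = +-identityʳ _

  ℤ-morphism : CommutativeRing.rawRing ℤₚ.+-*-commutativeRing -Raw-AlmostCommutative⟶ fromCommutativeRing K
  ℤ-morphism = record
    { ⟦_⟧    = int
    ; +-homo = ℤcast-+
    ; *-homo = ℤcast-*
    ; -‿homo = ℤcast-neg
    ; 0-homo = refl
    ; 1-homo = ℤcast-1
    }

  -- In positive characteristic distinct integers may have equal casts, so only a partial test is
  -- available; the solver asks for no more.
  cast-≟ : ∀ a b → Maybe (int a ≈ int b)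
  cast-≟ a b with a ℤₚ.≟ b
  ... | yes eq = just (reflexive (cong int eq))
  ... | no _   = nothing

module RingSolver (K : CommutativeRing 0ℓ 0ℓ) where
  open IntegerCast K using (ℤ-morphism; cast-≟)
  open NormalisingSolver (CommutativeRing.rawRing ℤₚ.+-*-commutativeRing) (fromCommutativeRing K) ℤ-morphism cast-≟ public
    using (solve; con; _:=_; _:+_; _:*_; _:-_; :-_; Polynomial)

-- Coefficient lists as a commutative ring

module Polynomials (R : CommutativeRing 0ℓ 0ℓ) where
  open CommutativeRing R
  open RingProperties ring using (-0#≈0#)
  open RingSolver R

  coeff : List Carrier → ℕ → Carrier
  coeff []      i       = 0#
  coeff (a ∷ p) zero    = a
  coeff (a ∷ p) (suc i) = coeff p i

  infix 4 _≋_

  -- A record, so that both polynomials can be inferred from an equality.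
  record _≋_ (p q : List Carrier) : Set where
    constructor coeffwise
    field at : ∀ i → coeff p i ≈ coeff q i
  open _≋_ public

  infixl 6 _⊕_
  infixl 7 _⊗_

  _⊕_ : List Carrier → List Carrier → List Carrier
  []      ⊕ q       = q
  (a ∷ p) ⊕ []      = a ∷ p
  (a ∷ p) ⊕ (b ∷ q) = (a + b) ∷ (p ⊕ q)

  scale : Carrier → List Carrier → List Carrier
  scale c = map (c *_)

  _⊗_ : List Carrier → List Carrier → List Carrier
  []      ⊗ q = []
  (a ∷ p) ⊗ q = scale a q ⊕ (0# ∷ (p ⊗ q))

  ⊖_ : List Carrier → List Carrier
  ⊖_ = map (λ a → - a)

  const : Carrier → List Carrier
  const a = a ∷ []

  ≋-refl : ∀ {p} → p ≋ p
  ≋-refl = coeffwise λ _ → refl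

  ≋-sym : ∀ {p q} → p ≋ q → q ≋ p
  ≋-sym e = coeffwise λ i → sym (at e i)

  ≋-trans : ∀ {p q r} → p ≋ q → q ≋ r → p ≋ r
  ≋-trans e f = coeffwise λ i → trans (at e i) (at f i)

  ≋-isEquivalence : IsEquivalence _≋_
  ≋-isEquivalence = record { refl = ≋-refl ; sym = ≋-sym ; trans = ≋-trans }

  ∷-cong : ∀ {a b p q} → a ≈ b → p ≋ q → (a ∷ p) ≋ (b ∷ q)
  ∷-cong e f = coeffwise λ { zero → e ; (suc i) → at f i }

  head-≋ : ∀ {a b p q} → (a ∷ p) ≋ (b ∷ q) → a ≈ b
  head-≋ e = at e 0

  tail-≋ : ∀ {a b p q} → (a ∷ p) ≋ (b ∷ q) → p ≋ q
  tail-≋ e = coeffwise λ i → at e (suc i)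

  head-≋[] : ∀ {a p} → (a ∷ p) ≋ [] → a ≈ 0#
  head-≋[] e = at e 0

  tail-≋[] : ∀ {a p} → (a ∷ p) ≋ [] → p ≋ []
  tail-≋[] e = coeffwise λ i → at e (suc i)

  ∷-≋[] : ∀ {a p} → a ≈ 0# → p ≋ [] → (a ∷ p) ≋ []
  ∷-≋[] e f = coeffwise λ { zero → e ; (suc i) → at f i }

  coeff-⊕ : ∀ p q i → coeff (p ⊕ q) i ≈ coeff p i + coeff q i
  coeff-⊕ []      q       i       = sym (+-identityˡ _)
  coeff-⊕ (a ∷ p) []      i       = sym (+-identityʳ _)
  coeff-⊕ (a ∷ p) (b ∷ q) zero    = refl
  coeff-⊕ (a ∷ p) (b ∷ q) (suc i) = coeff-⊕ p q i

  coeff-scale : ∀ c p i → coeff (scale c p) i ≈ c * coeff p i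
  coeff-scale c []      i       = sym (zeroʳ c)
  coeff-scale c (a ∷ p) zero    = refl
  coeff-scale c (a ∷ p) (suc i) = coeff-scale c p i

  coeff-⊖ : ∀ p i → coeff (⊖ p) i ≈ - coeff p i
  coeff-⊖ []      i       = sym -0#≈0#
  coeff-⊖ (a ∷ p) zero    = refl
  coeff-⊖ (a ∷ p) (suc i) = coeff-⊖ p i

  ⊕-cong : ∀ {p p′ q q′} → p ≋ p′ → q ≋ q′ → p ⊕ q ≋ p′ ⊕ q′
  ⊕-cong {p} {p′} {q} {q′} e f = coeffwise λ i →
    trans (coeff-⊕ p q i) (trans (+-cong (at e i) (at f i)) (sym (coeff-⊕ p′ q′ i)))

  ⊕-assoc : ∀ p q r → (p ⊕ q) ⊕ r ≋ p ⊕ (q ⊕ r)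
  ⊕-assoc p q r = coeffwise λ i → begin
    coeff ((p ⊕ q) ⊕ r) i                 ≈⟨ coeff-⊕ (p ⊕ q) r i ⟩
    coeff (p ⊕ q) i + coeff r i           ≈⟨ +-congʳ (coeff-⊕ p q i) ⟩
    (coeff p i + coeff q i) + coeff r i   ≈⟨ +-assoc _ _ _ ⟩
    coeff p i + (coeff q i + coeff r i)   ≈⟨ +-congˡ (coeff-⊕ q r i) ⟨
    coeff p i + coeff (q ⊕ r) i           ≈⟨ coeff-⊕ p (q ⊕ r) i ⟨
    coeff (p ⊕ (q ⊕ r)) i                 ∎
    where open SetoidReasoning setoid

  ⊕-comm : ∀ p q → p ⊕ q ≋ q ⊕ p
  ⊕-comm p q = coeffwise λ i →
    trans (coeff-⊕ p q i) (trans (+-comm _ _) (sym (coeff-⊕ q p i)))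

  ⊕-identityʳ : ∀ p → p ⊕ [] ≋ p
  ⊕-identityʳ p = ⊕-comm p []

  ⊖-cong : ∀ {p q} → p ≋ q → ⊖ p ≋ ⊖ q
  ⊖-cong {p} {q} e = coeffwise λ i →
    trans (coeff-⊖ p i) (trans (-‿cong (at e i)) (sym (coeff-⊖ q i)))

  ⊖-inverseʳ : ∀ p → p ⊕ ⊖ p ≋ []
  ⊖-inverseʳ p = coeffwise λ i →
    trans (coeff-⊕ p (⊖ p) i) (trans (+-congˡ (coeff-⊖ p i)) (-‿inverseʳ _))

  scale-cong : ∀ {a b p q} → a ≈ b → p ≋ q → scale a p ≋ scale b q
  scale-cong {a} {b} {p} {q} e f = coeffwise λ i →
    trans (coeff-scale a p i) (trans (*-cong e (at f i)) (sym (coeff-scale b q i)))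

  scale-⊕ : ∀ a p q → scale a (p ⊕ q) ≋ scale a p ⊕ scale a q
  scale-⊕ a p q = coeffwise λ i → begin
    coeff (scale a (p ⊕ q)) i                   ≈⟨ coeff-scale a (p ⊕ q) i ⟩
    a * coeff (p ⊕ q) i                         ≈⟨ *-congˡ (coeff-⊕ p q i) ⟩
    a * (coeff p i + coeff q i)                 ≈⟨ distribˡ _ _ _ ⟩
    a * coeff p i + a * coeff q i               ≈⟨ +-cong (coeff-scale a p i) (coeff-scale a q i) ⟨
    coeff (scale a p) i + coeff (scale a q) i   ≈⟨ coeff-⊕ (scale a p) (scale a q) i ⟨
    coeff (scale a p ⊕ scale a q) i             ∎
    where open SetoidReasoning setoid

  scale-scale : ∀ a b p → scale a (scale b p) ≋ scale (a * b) p
  scale-scale a b p = coeffwise λ i → begin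
    coeff (scale a (scale b p)) i ≈⟨ coeff-scale a (scale b p) i ⟩
    a * coeff (scale b p) i       ≈⟨ *-congˡ (coeff-scale b p i) ⟩
    a * (b * coeff p i)           ≈⟨ *-assoc _ _ _ ⟨
    (a * b) * coeff p i           ≈⟨ coeff-scale (a * b) p i ⟨
    coeff (scale (a * b) p) i     ∎
    where open SetoidReasoning setoid

  scale-one : ∀ p → scale 1# p ≋ p
  scale-one p = coeffwise λ i → trans (coeff-scale 1# p i) (*-identityˡ _)

  scale-zero : ∀ p → scale 0# p ≋ []
  scale-zero p = coeffwise λ i → trans (coeff-scale 0# p i) (zeroˡ _)

  ⊕-interchange : ∀ p q r s → (p ⊕ q) ⊕ (r ⊕ s) ≋ (p ⊕ r) ⊕ (q ⊕ s)
  ⊕-interchange p q r s = coeffwise λ i → begin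
    coeff ((p ⊕ q) ⊕ (r ⊕ s)) i                             ≈⟨ coeff₄ p q r s i ⟩
    (coeff p i + coeff q i) + (coeff r i + coeff s i)       ≈⟨ solve 4 (λ a b c d → (a :+ b) :+ (c :+ d) := (a :+ c) :+ (b :+ d)) refl _ _ _ _ ⟩
    (coeff p i + coeff r i) + (coeff q i + coeff s i)       ≈⟨ coeff₄ p r q s i ⟨
    coeff ((p ⊕ r) ⊕ (q ⊕ s)) i                             ∎
    where
    open SetoidReasoning setoid
    coeff₄ : ∀ p q r s i → coeff ((p ⊕ q) ⊕ (r ⊕ s)) i ≈ (coeff p i + coeff q i) + (coeff r i + coeff s i)
    coeff₄ p q r s i = trans (coeff-⊕ (p ⊕ q) (r ⊕ s) i) (+-cong (coeff-⊕ p q i) (coeff-⊕ r s i))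

  shift-⊕ : ∀ p q → 0# ∷ (p ⊕ q) ≋ (0# ∷ p) ⊕ (0# ∷ q)
  shift-⊕ p q = ∷-cong (sym (+-identityˡ 0#)) ≋-refl

  scale-shift : ∀ a p → scale a (0# ∷ p) ≋ 0# ∷ scale a p
  scale-shift a p = ∷-cong (zeroʳ a) ≋-refl

  ≋-setoid : Setoid 0ℓ 0ℓ
  ≋-setoid = record { isEquivalence = ≋-isEquivalence }

  private
    module ≋-Reasoning = SetoidReasoning ≋-setoid

  ⊗-congˡ : ∀ p {q q′} → q ≋ q′ → p ⊗ q ≋ p ⊗ q′
  ⊗-congˡ []      e = ≋-refl
  ⊗-congˡ (a ∷ p) e = ⊕-cong (scale-cong refl e) (∷-cong refl (⊗-congˡ p e))

  ⊗-zeroʳ : ∀ p → p ⊗ [] ≋ []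
  ⊗-zeroʳ []      = ≋-refl
  ⊗-zeroʳ (a ∷ p) = ∷-≋[] refl (⊗-zeroʳ p)

  -- Multiplication recurses on its left factor; this is the matching recursion on the right one,
  -- from which commutativity follows.
  ⊗-∷ : ∀ p b q → p ⊗ (b ∷ q) ≋ scale b p ⊕ (0# ∷ (p ⊗ q))
  ⊗-∷ []      b q = ≋-sym (∷-≋[] refl ≋-refl)
  ⊗-∷ (a ∷ p) b q = ∷-cong (+-congʳ (*-comm a b)) (begin
    scale a q ⊕ (p ⊗ (b ∷ q))                   ≈⟨ ⊕-cong ≋-refl (⊗-∷ p b q) ⟩
    scale a q ⊕ (scale b p ⊕ (0# ∷ (p ⊗ q)))    ≈⟨ ⊕-assoc (scale a q) _ _ ⟨
    (scale a q ⊕ scale b p) ⊕ (0# ∷ (p ⊗ q))    ≈⟨ ⊕-cong (⊕-comm (scale a q) (scale b p)) ≋-refl ⟩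
    (scale b p ⊕ scale a q) ⊕ (0# ∷ (p ⊗ q))    ≈⟨ ⊕-assoc (scale b p) _ _ ⟩
    scale b p ⊕ (scale a q ⊕ (0# ∷ (p ⊗ q)))    ∎)
    where open ≋-Reasoning

  ⊗-comm : ∀ p q → p ⊗ q ≋ q ⊗ p
  ⊗-comm []      q = ≋-sym (⊗-zeroʳ q)
  ⊗-comm (a ∷ p) q = ≋-trans (⊕-cong ≋-refl (∷-cong refl (⊗-comm p q))) (≋-sym (⊗-∷ q a p))

  ⊗-cong : ∀ {p p′ q q′} → p ≋ p′ → q ≋ q′ → p ⊗ q ≋ p′ ⊗ q′
  ⊗-cong {p} {p′} {q} {q′} e f = begin
    p ⊗ q   ≈⟨ ⊗-congˡ p f ⟩
    p ⊗ q′  ≈⟨ ⊗-comm p q′ ⟩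
    q′ ⊗ p  ≈⟨ ⊗-congˡ q′ e ⟩
    q′ ⊗ p′ ≈⟨ ⊗-comm q′ p′ ⟩
    p′ ⊗ q′ ∎
    where open ≋-Reasoning

  ⊗-distribˡ : ∀ p q r → p ⊗ (q ⊕ r) ≋ (p ⊗ q) ⊕ (p ⊗ r)
  ⊗-distribˡ []      q r = ≋-refl
  ⊗-distribˡ (a ∷ p) q r = begin
    scale a (q ⊕ r) ⊕ (0# ∷ (p ⊗ (q ⊕ r)))
      ≈⟨ ⊕-cong (scale-⊕ a q r) (≋-trans (∷-cong refl (⊗-distribˡ p q r)) (shift-⊕ (p ⊗ q) (p ⊗ r))) ⟩
    (scale a q ⊕ scale a r) ⊕ ((0# ∷ (p ⊗ q)) ⊕ (0# ∷ (p ⊗ r)))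
      ≈⟨ ⊕-interchange (scale a q) (scale a r) _ _ ⟩
    (scale a q ⊕ (0# ∷ (p ⊗ q))) ⊕ (scale a r ⊕ (0# ∷ (p ⊗ r))) ∎
    where open ≋-Reasoning

  ⊗-distribʳ : ∀ p q r → (q ⊕ r) ⊗ p ≋ (q ⊗ p) ⊕ (r ⊗ p)
  ⊗-distribʳ p q r = begin
    (q ⊕ r) ⊗ p       ≈⟨ ⊗-comm (q ⊕ r) p ⟩
    p ⊗ (q ⊕ r)       ≈⟨ ⊗-distribˡ p q r ⟩
    p ⊗ q ⊕ p ⊗ r     ≈⟨ ⊕-cong (⊗-comm p q) (⊗-comm p r) ⟩
    q ⊗ p ⊕ r ⊗ p     ∎
    where open ≋-Reasoning

  scale-⊗ : ∀ a p q → scale a p ⊗ q ≋ scale a (p ⊗ q)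
  scale-⊗ a []      q = ≋-refl
  scale-⊗ a (b ∷ p) q = begin
    scale (a * b) q ⊕ (0# ∷ (scale a p ⊗ q))
      ≈⟨ ⊕-cong (≋-sym (scale-scale a b q)) (≋-trans (∷-cong refl (scale-⊗ a p q)) (≋-sym (scale-shift a (p ⊗ q)))) ⟩
    scale a (scale b q) ⊕ scale a (0# ∷ (p ⊗ q)) ≈⟨ scale-⊕ a (scale b q) _ ⟨
    scale a (scale b q ⊕ (0# ∷ (p ⊗ q)))         ∎
    where open ≋-Reasoning

  shift-⊗ : ∀ p q → (0# ∷ p) ⊗ q ≋ 0# ∷ (p ⊗ q)
  shift-⊗ p q = ⊕-cong (scale-zero q) ≋-refl

  ⊗-assoc : ∀ p q r → (p ⊗ q) ⊗ r ≋ p ⊗ (q ⊗ r)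
  ⊗-assoc []      q r = ≋-refl
  ⊗-assoc (a ∷ p) q r = begin
    (scale a q ⊕ (0# ∷ (p ⊗ q))) ⊗ r          ≈⟨ ⊗-distribʳ r (scale a q) _ ⟩
    scale a q ⊗ r ⊕ (0# ∷ (p ⊗ q)) ⊗ r        ≈⟨ ⊕-cong (scale-⊗ a q r) (shift-⊗ (p ⊗ q) r) ⟩
    scale a (q ⊗ r) ⊕ (0# ∷ ((p ⊗ q) ⊗ r))    ≈⟨ ⊕-cong ≋-refl (∷-cong refl (⊗-assoc p q r)) ⟩
    scale a (q ⊗ r) ⊕ (0# ∷ (p ⊗ (q ⊗ r)))    ∎
    where open ≋-Reasoning

  const-⊗ : ∀ a p → const a ⊗ p ≋ scale a p
  const-⊗ a p = ≋-trans (⊕-cong ≋-refl (∷-≋[] refl ≋-refl)) (⊕-identityʳ (scale a p))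

  ⊗-identityˡ : ∀ p → const 1# ⊗ p ≋ p
  ⊗-identityˡ p = ≋-trans (const-⊗ 1# p) (scale-one p)

  polynomialRing : CommutativeRing 0ℓ 0ℓ
  polynomialRing = record
    { Carrier = List Carrier
    ; _≈_ = _≋_
    ; _+_ = _⊕_
    ; _*_ = _⊗_
    ; -_  = ⊖_
    ; 0#  = []
    ; 1#  = const 1#
    ; isCommutativeRing = record
      { isRing = record
        { +-isAbelianGroup = record
          { isGroup = record
            { isMonoid = record
              { isSemigroup = record
                { isMagma = record { isEquivalence = ≋-isEquivalence ; ∙-cong = ⊕-cong }
                ; assoc = ⊕-assoc }
              ; identity = (λ p → ≋-refl) , ⊕-identityʳ }
            ; inverse = (λ p → ≋-trans (⊕-comm (⊖ p) p) (⊖-inverseʳ p)) , ⊖-inverseʳ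
            ; ⁻¹-cong = ⊖-cong }
          ; comm = ⊕-comm }
        ; *-cong = ⊗-cong
        ; *-assoc = ⊗-assoc
        ; *-identity = ⊗-identityˡ , λ p → ≋-trans (⊗-comm p (const 1#)) (⊗-identityˡ p)
        ; distrib = ⊗-distribˡ , ⊗-distribʳ
        }
      ; *-comm = ⊗-comm
      }
    }

-- Fraction-free elimination with a unimodularity certificate

module UnimodularRelations
  (R : CommutativeRing 0ℓ 0ℓ)
  (zero? : ∀ a → Dec (CommutativeRing._≈_ R a (CommutativeRing.0# R)))
  (*-nonzero : ∀ {a b} → ¬ CommutativeRing._≈_ R a (CommutativeRing.0# R) → ¬ CommutativeRing._≈_ R b (CommutativeRing.0# R) →
               ¬ CommutativeRing._≈_ R (CommutativeRing._*_ R a b) (CommutativeRing.0# R))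
  (1≉0 : ¬ CommutativeRing._≈_ R (CommutativeRing.1# R) (CommutativeRing.0# R))
  where

  private
    module R = CommutativeRing R
  open Polynomials R
  open CommutativeRing polynomialRing using (Carrier; _≈_; _+_; _*_; -_; 0#; 1#; refl; sym; trans; setoid; +-cong; +-congˡ; +-congʳ; *-cong; *-congˡ; *-congʳ; zeroʳ; zeroˡ; +-identityˡ; +-identityʳ; *-identityˡ)
  open RingSolver polynomialRing
  open SetoidReasoning setoid

  NonZero : R.Carrier → Set
  NonZero c = ¬ c R.≈ R.0#

  Vector : ℕ → Set
  Vector r = Fin r → Carrier

  combine : ∀ {k r} → Vec Carrier k → Vec (Vector r) k → Vector r
  combine []       []       j = 0#
  combine (g ∷ gs) (v ∷ vs) j = g * v j + combine gs vs j

  dot : ∀ {k} → Vec Carrier k → Vec Carrier k → Carrier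
  dot []       []       = 0#
  dot (w ∷ ws) (g ∷ gs) = w * g + dot ws gs

  scaleVec : ∀ {k} → Carrier → Vec Carrier k → Vec Carrier k
  scaleVec c = Vec.map (c *_)

  dot-scaleVec : ∀ {k} c (w g : Vec Carrier k) → dot (scaleVec c w) g ≈ c * dot w g
  dot-scaleVec c []      []      = sym (zeroʳ c)
  dot-scaleVec c (x ∷ w) (y ∷ g) = trans (+-congˡ (dot-scaleVec c w g))
    (solve 4 (λ c x y d → c :* x :* y :+ c :* d := c :* (x :* y :+ d)) refl c x y (dot w g))

  -- Relations between the vectors us are carried to relations between vs, and unimodularity up to a
  -- nonzero constant is preserved (over the fraction field of R: vs is obtained from us by an invertible matrix).
  record Reduces {k r} (vs us : Vec (Vector r) k) : Set where
    field
      relation  : Vec Carrier k → Vec Carrier k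
      combine-≈ : ∀ g j → combine (relation g) vs j ≈ combine g us j
      factor    : R.Carrier
      factor≉0  : NonZero factor
      cofactor  : Vec Carrier k → Vec Carrier k
      dot-≈     : ∀ w g → const factor * dot w g ≈ dot (cofactor w) (relation g)
  open Reduces

  Reduces-refl : ∀ {k r} {vs : Vec (Vector r) k} → Reduces vs vs
  Reduces-refl = record
    { relation = λ g → g ; combine-≈ = λ _ _ → refl ; factor = R.1# ; factor≉0 = 1≉0
    ; cofactor = λ w → w ; dot-≈ = λ w g → *-identityˡ _ }

  Reduces-trans : ∀ {k r} {vs us ts : Vec (Vector r) k} → Reduces vs us → Reduces us ts → Reduces vs ts
  Reduces-trans ρ τ = record
    { relation  = λ g → relation ρ (relation τ g)
    ; combine-≈ = λ g j → trans (combine-≈ ρ (relation τ g) j) (combine-≈ τ g j)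
    ; factor    = factor ρ R.* factor τ
    ; factor≉0  = *-nonzero (factor≉0 ρ) (factor≉0 τ)
    ; cofactor  = λ w → cofactor ρ (cofactor τ w)
    ; dot-≈     = λ w g → begin
        const (factor ρ R.* factor τ) * dot w g          ≈⟨ *-congʳ {dot w g} {const (factor ρ) * const (factor τ)} {const (factor ρ R.* factor τ)} (const-⊗ (factor ρ) (const (factor τ))) ⟨
        const (factor ρ) * const (factor τ) * dot w g    ≈⟨ CommutativeRing.*-assoc polynomialRing (const (factor ρ)) (const (factor τ)) (dot w g) ⟩
        const (factor ρ) * (const (factor τ) * dot w g)  ≈⟨ *-congˡ {x = const (factor ρ)} (dot-≈ τ w g) ⟩
        const (factor ρ) * dot (cofactor τ w) (relation τ g) ≈⟨ dot-≈ ρ _ _ ⟩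
        dot (cofactor ρ (cofactor τ w)) (relation ρ (relation τ g)) ∎
    }

  Reduces-∷ : ∀ {k r} {v : Vector r} {vs us : Vec (Vector r) k} → Reduces vs us → Reduces (v ∷ vs) (v ∷ us)
  Reduces-∷ {v = v} {vs} {us} ρ = record
    { relation  = λ { (x ∷ g) → x ∷ relation ρ g }
    ; combine-≈ = λ { (x ∷ g) j → +-congˡ (combine-≈ ρ g j) }
    ; factor    = factor ρ
    ; factor≉0  = factor≉0 ρ
    ; cofactor  = λ { (y ∷ w) → const (factor ρ) * y ∷ cofactor ρ w }
    ; dot-≈     = λ { (y ∷ w) (x ∷ g) → begin
        const (factor ρ) * (y * x + dot w g)
          ≈⟨ solve 4 (λ c y x d → c :* (y :* x :+ d) := c :* y :* x :+ c :* d) refl (const (factor ρ)) y x (dot w g) ⟩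
        const (factor ρ) * y * x + const (factor ρ) * dot w g
          ≈⟨ +-congˡ (dot-≈ ρ w g) ⟩
        const (factor ρ) * y * x + dot (cofactor ρ w) (relation ρ g) ∎ }
    }

  Reduces-swap : ∀ {k r} {u v : Vector r} {vs : Vec (Vector r) k} → Reduces (u ∷ v ∷ vs) (v ∷ u ∷ vs)
  Reduces-swap {u = u} {v} {vs} = record
    { relation  = λ { (x ∷ y ∷ g) → y ∷ x ∷ g }
    ; combine-≈ = λ { (x ∷ y ∷ g) j →
        solve 3 (λ a b c → b :+ (a :+ c) := a :+ (b :+ c)) refl (x * v j) (y * u j) (combine g vs j) }
    ; factor    = R.1#
    ; factor≉0  = 1≉0
    ; cofactor  = λ { (a ∷ b ∷ w) → b ∷ a ∷ w }
    ; dot-≈     = λ { (a ∷ b ∷ w) (x ∷ y ∷ g) → trans (*-identityˡ _)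
        (solve 3 (λ a b c → a :+ (b :+ c) := b :+ (a :+ c)) refl (a * x) (b * y) (dot w g)) }
    }

  -- The substitution has determinant `c`, so the inverse that acts on the certificate is free of
  -- fractions only after multiplication by `c`; this is the origin of `factor`.
  Reduces-eliminate : ∀ {k r} (c : R.Carrier) → NonZero c → (b : Carrier) {u v : Vector r} {vs : Vec (Vector r) k} →
                      Reduces (u ∷ v ∷ vs) (u ∷ (λ j → const c * v j + - (b * u j)) ∷ vs)
  Reduces-eliminate c c≉0 b {u} {v} {vs} = record
    { relation  = λ { (x ∷ y ∷ g) → x + - (y * b) ∷ y * const c ∷ g }
    ; combine-≈ = λ { (x ∷ y ∷ g) j →
        solve 7 (λ x y b c u v d → (x :+ :- (y :* b)) :* u :+ (y :* c :* v :+ d) := x :* u :+ (y :* (c :* v :+ :- (b :* u)) :+ d))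
          refl x y b (const c) (u j) (v j) (combine g vs j) }
    ; factor    = c
    ; factor≉0  = c≉0
    ; cofactor  = λ { (a ∷ a′ ∷ w) → const c * a ∷ a * b + a′ ∷ scaleVec (const c) w }
    ; dot-≈     = λ { (a ∷ a′ ∷ w) (x ∷ y ∷ g) → begin
        const c * (a * x + (a′ * y + dot w g))
          ≈⟨ solve 7 (λ a a′ b c x y d → c :* (a :* x :+ (a′ :* y :+ d)) :=
                c :* a :* (x :+ :- (y :* b)) :+ ((a :* b :+ a′) :* (y :* c) :+ c :* d))
               refl a a′ b (const c) x y (dot w g) ⟩
        const c * a * (x + - (y * b)) + ((a * b + a′) * (y * const c) + const c * dot w g)
          ≈⟨ +-congˡ {x = const c * a * (x + - (y * b))} (+-congˡ {x = (a * b + a′) * (y * const c)} (dot-scaleVec (const c) w g)) ⟨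
        const c * a * (x + - (y * b)) + ((a * b + a′) * (y * const c) + dot (scaleVec (const c) w) g) ∎ }
    }

  -- An upper bound instead of the degree: lists may end in zeros, and a bound needs no normal form.
  record DegreeBelow (p : Carrier) (d : ℕ) : Set where
    constructor degreeBelow
    field vanish : ∀ i → d ≤ i → coeff p i R.≈ R.0#
  open DegreeBelow

  degreeBelow-exists : ∀ p → ∃ (DegreeBelow p)
  degreeBelow-exists []      = 0 , degreeBelow λ i _ → R.refl
  degreeBelow-exists (a ∷ p) with degreeBelow-exists p
  ... | d , below = suc d , degreeBelow λ { (suc i) (s≤s d≤i) → vanish below i d≤i }

  degreeBelow-0 : ∀ {p} → DegreeBelow p 0 → p ≈ 0#
  degreeBelow-0 below = coeffwise λ i → vanish below i z≤n

  degreeBelow-pred : ∀ {p d} → DegreeBelow p (suc d) → coeff p d R.≈ R.0# → DegreeBelow p d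
  degreeBelow-pred {p} {d} below top = degreeBelow vanishes
    where
    vanishes : ∀ i → d ≤ i → coeff p i R.≈ R.0#
    vanishes i d≤i with ℕₚ.m≤n⇒m<n∨m≡n d≤i
    ... | inj₁ d<i    = vanish below i d<i
    ... | inj₂ ≡.refl = top

  monomial : R.Carrier → ℕ → Carrier
  monomial c zero    = const c
  monomial c (suc e) = R.0# ∷ monomial c e

  coeff-monomial-⊗ : ∀ c e p i → coeff (monomial c e * p) (e ℕ.+ i) R.≈ c R.* coeff p i
  coeff-monomial-⊗ c zero    p i = R.trans (at (const-⊗ c p) i) (coeff-scale c p i)
  coeff-monomial-⊗ c (suc e) p i = R.trans (at (shift-⊗ (monomial c e) p) (suc e ℕ.+ i)) (coeff-monomial-⊗ c e p i)

  coeff-eliminate : ∀ c b e p q i →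
    coeff (const c * p + - (monomial b e * q)) (e ℕ.+ i) R.≈ (c R.* coeff p (e ℕ.+ i)) R.- (b R.* coeff q i)
  coeff-eliminate c b e p q i =
    R.trans (coeff-⊕ (const c * p) _ (e ℕ.+ i))
      (R.+-cong (R.trans (at (const-⊗ c p) (e ℕ.+ i)) (coeff-scale c p (e ℕ.+ i)))
                (R.trans (coeff-⊖ (monomial b e * q) (e ℕ.+ i)) (R.-‿cong (coeff-monomial-⊗ b e q i))))

  -- Cross-multiplying by the two top coefficients cancels the top terms without division; writing
  -- the larger degree as `e + d` makes z^e the aligning monomial.
  eliminate-leading : ∀ {p q} e d → DegreeBelow p (suc (e ℕ.+ d)) → DegreeBelow q (suc d) →
    DegreeBelow (const (coeff q d) * p + - (monomial (coeff p (e ℕ.+ d)) e * q)) (e ℕ.+ d)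
  eliminate-leading {p} {q} e d belowp belowq = degreeBelow λ i e+d≤i →
    let i≡    = ℕₚ.m+[n∸m]≡n (ℕₚ.≤-trans (ℕₚ.m≤m+n e d) e+d≤i)
        d≤i∸e = ℕₚ.+-cancelˡ-≤ e _ _ (≡.subst (e ℕ.+ d ≤_) (≡.sym i≡) e+d≤i)
    in ≡.subst (λ i → coeff (const b * p + - (monomial a e * q)) i R.≈ R.0#) i≡
         (R.trans (coeff-eliminate b a e p q (i ∸ e)) (vanishes (i ∸ e) d≤i∸e))
    where
    a = coeff p (e ℕ.+ d)
    b = coeff q d
    vanishes : ∀ i → d ≤ i → (b R.* coeff p (e ℕ.+ i)) R.- (a R.* coeff q i) R.≈ R.0#
    vanishes i d≤i with ℕₚ.m≤n⇒m<n∨m≡n d≤i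
    ... | inj₂ ≡.refl = R.trans (R.+-congʳ (R.*-comm _ _)) (R.-‿inverseʳ _)
    ... | inj₁ d<i    = R.trans
      (R.+-cong (R.trans (R.*-congˡ (vanish belowp _ (≡.subst (_≤ e ℕ.+ i) (ℕₚ.+-suc e d) (ℕₚ.+-monoʳ-≤ e d<i)))) (R.zeroʳ _))
                (R.trans (R.-‿cong (R.trans (R.*-congˡ (vanish belowq _ d<i)) (R.zeroʳ _))) (RingProperties.-0#≈0# R.ring)))
      (R.+-identityˡ _)

  -- The Euclidean algorithm with pseudo-division on the zeroth coordinates. Every step lowers one
  -- of the two degree bounds by one: a vanishing top coefficient is dropped, and a top term is
  -- cancelled only when both top coefficients are nonzero, so that each multiplier is an admissible
  -- `factor`.
  euclid₂ : ∀ {k r} (fuel d e : ℕ) → d ℕ.+ e ≤ fuel → (u v : Vector (suc r)) (vs : Vec (Vector (suc r)) k) →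
    DegreeBelow (u zero) d → DegreeBelow (v zero) e →
    Σ (Vector (suc r)) λ u′ → Σ (Vector (suc r)) λ v′ → Reduces (u ∷ v ∷ vs) (u′ ∷ v′ ∷ vs) × v′ zero ≈ 0#
  euclid₂ fuel d zero _ u v vs belowu belowv = u , v , Reduces-refl , degreeBelow-0 belowv
  euclid₂ fuel zero (suc e) _ u v vs belowu belowv = v , u , Reduces-swap , degreeBelow-0 belowu
  euclid₂ (suc fuel) (suc d) (suc e) (s≤s d+e≤) u v vs belowu belowv
    with zero? (coeff (u zero) d) | zero? (coeff (v zero) e)
  ... | yes lu≈0 | _ = euclid₂ fuel d (suc e) d+e≤ u v vs (degreeBelow-pred belowu lu≈0) belowv
  ... | no _ | yes lv≈0 = euclid₂ fuel (suc d) e (≡.subst (_≤ fuel) (ℕₚ.+-suc d e) d+e≤) u v vs belowu (degreeBelow-pred belowv lv≈0)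
  ... | no lu≉0 | no lv≉0 with ℕₚ.≤-total d e
  ...   | inj₁ d≤e with u′ , v′ , ρ , v′≈0 ← euclid₂ fuel (suc d) e (≡.subst (_≤ fuel) (ℕₚ.+-suc d e) d+e≤) u
              (λ j → const (coeff (u zero) d) * v j + - (monomial (coeff (v zero) e) (e ∸ d) * u j)) vs belowu
              (≡.subst (λ n → DegreeBelow (const (coeff (u zero) d) * v zero + - (monomial (coeff (v zero) n) (e ∸ d) * u zero)) n)
                (ℕₚ.m∸n+n≡m d≤e) (eliminate-leading (e ∸ d) d (≡.subst (λ n → DegreeBelow (v zero) (suc n)) (≡.sym (ℕₚ.m∸n+n≡m d≤e)) belowv) belowu))
          = u′ , v′ , Reduces-trans (Reduces-eliminate _ lu≉0 (monomial (coeff (v zero) e) (e ∸ d))) ρ , v′≈0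
  ...   | inj₂ e≤d with u′ , v′ , ρ , v′≈0 ← euclid₂ fuel d (suc e) d+e≤
              (λ j → const (coeff (v zero) e) * u j + - (monomial (coeff (u zero) d) (d ∸ e) * v j)) v vs
              (≡.subst (λ n → DegreeBelow (const (coeff (v zero) e) * u zero + - (monomial (coeff (u zero) n) (d ∸ e) * v zero)) n)
                (ℕₚ.m∸n+n≡m e≤d) (eliminate-leading (d ∸ e) e (≡.subst (λ n → DegreeBelow (u zero) (suc n)) (≡.sym (ℕₚ.m∸n+n≡m e≤d)) belowu) belowv))
              belowv
          -- `Reduces-eliminate` changes the second vector, so the two are exchanged before and
          -- after it.
          = u′ , v′ , Reduces-trans Reduces-swap (Reduces-trans (Reduces-eliminate _ lv≉0 (monomial (coeff (u zero) d) (d ∸ e))) (Reduces-trans Reduces-swap ρ)) , v′≈0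

  euclid : ∀ {k r} (u : Vector (suc r)) (vs : Vec (Vector (suc r)) k) →
    Σ (Vector (suc r)) λ u′ → Σ (Vec (Vector (suc r)) k) λ vs′ →
      Reduces (u ∷ vs) (u′ ∷ vs′) × VecAll.All (λ v → v zero ≈ 0#) vs′
  euclid u [] = u , [] , Reduces-refl , []
  euclid u (v ∷ vs)
    with d , belowu ← degreeBelow-exists (u zero) | e , belowv ← degreeBelow-exists (v zero)
    with u₁ , v₁ , ρ₁ , v₁≈0 ← euclid₂ (d ℕ.+ e) d e ℕₚ.≤-refl u v vs belowu belowv
    with u₂ , vs₂ , ρ₂ , vs₂≈0 ← euclid u₁ vs
    = u₂ , v₁ ∷ vs₂
    -- The finished `v₁` is moved to the front, where `Reduces-∷` leaves it untouched while `u₁` is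
    -- reduced against `vs`.
    , Reduces-trans ρ₁ (Reduces-trans Reduces-swap (Reduces-trans (Reduces-∷ ρ₂) Reduces-swap))
    , v₁≈0 ∷ vs₂≈0

  combine-zero : ∀ {k r} (g : Vec Carrier k) {vs : Vec (Vector (suc r)) k} →
                 VecAll.All (λ v → v zero ≈ 0#) vs → combine g vs zero ≈ 0#
  combine-zero []      []        = refl
  combine-zero (x ∷ g) (e ∷ es) = trans (+-cong (trans (*-congˡ {x = x} e) (zeroʳ x)) (combine-zero g es)) (+-identityˡ 0#)

  combine-suc : ∀ {k r} (g : Vec Carrier k) (vs : Vec (Vector (suc r)) k) j →
                combine g vs (suc j) ≈ combine g (Vec.map (λ v i → v (suc i)) vs) j
  combine-suc []      []       j = refl
  combine-suc (x ∷ g) (v ∷ vs) j = +-congˡ (combine-suc g vs j)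

  -- Once `euclid` has concentrated the zeroth coordinate in one vector, that vector receives
  -- coefficient 0, and the remaining ones again outnumber the remaining coordinates by one. In rank
  -- 0 the relation 1 is its own certificate; pulling back through `Reduces` only multiplies δ by
  -- nonzero elements of `R`.
  unimodular-relation : ∀ r (vs : Vec (Vector r) (suc r)) →
    Σ (Vec Carrier (suc r)) λ g → Σ (Vec Carrier (suc r)) λ w → Σ R.Carrier λ δ →
      (∀ j → combine g vs j ≈ 0#) × NonZero δ × dot w g ≈ const δ
  unimodular-relation zero (v ∷ []) =
    1# ∷ [] , 1# ∷ [] , R.1# , (λ ()) , 1≉0 , trans (+-identityʳ _) (*-identityˡ 1#)
  unimodular-relation (suc r) (u ∷ vs)
    with u′ , vs′ , ρ , vs′≈0 ← euclid u vs
    with g , w , δ , relation≈0 , δ≉0 , dot≈δ ← unimodular-relation r (Vec.map (λ v i → v (suc i)) vs′)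
    = relation ρ (0# ∷ g) , cofactor ρ (0# ∷ w) , factor ρ R.* δ
    , (λ j → trans (combine-≈ ρ (0# ∷ g) j) (trans (+-identityˡ _) (vanishes j)))
    , *-nonzero (factor≉0 ρ) δ≉0
    , (begin
        dot (cofactor ρ (0# ∷ w)) (relation ρ (0# ∷ g)) ≈⟨ dot-≈ ρ (0# ∷ w) (0# ∷ g) ⟨
        const (factor ρ) * dot w g                        ≈⟨ *-congˡ {x = const (factor ρ)} dot≈δ ⟩
        const (factor ρ) * const δ                        ≈⟨ const-⊗ (factor ρ) (const δ) ⟩
        const (factor ρ R.* δ)                            ∎)
    where
    vanishes : ∀ j → combine g vs′ j ≈ 0#
    vanishes zero    = combine-zero g vs′≈0
    vanishes (suc j) = trans (combine-suc g vs′ j) (relation≈0 j)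

-- Zero test and absence of zero divisors for polynomials

module PolynomialDomain
  (R : CommutativeRing 0ℓ 0ℓ)
  (zero? : ∀ a → Dec (CommutativeRing._≈_ R a (CommutativeRing.0# R)))
  (*-nonzero : ∀ {a b} → ¬ CommutativeRing._≈_ R a (CommutativeRing.0# R) → ¬ CommutativeRing._≈_ R b (CommutativeRing.0# R) →
               ¬ CommutativeRing._≈_ R (CommutativeRing._*_ R a b) (CommutativeRing.0# R))
  where
  open CommutativeRing R
  open Polynomials R

  polynomial-zero? : ∀ p → Dec (p ≋ [])
  polynomial-zero? [] = yes ≋-refl
  polynomial-zero? (a ∷ p) with zero? a | polynomial-zero? p
  ... | yes a≈0 | yes p≋[] = yes (∷-≋[] a≈0 p≋[])
  ... | yes a≈0 | no p≉[]  = no λ e → p≉[] (tail-≋[] e)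
  ... | no a≉0  | _        = no λ e → a≉0 (head-≋[] e)

  -- The lowest nonvanishing coefficients are multiplied, as lists begin with the constant term:
  -- zero heads of `q` are stripped until its head is nonzero.
  ⊗-nonzeroˡ : ∀ {a} p q → ¬ a ≈ 0# → ¬ q ≋ [] → ¬ (a ∷ p) ⊗ q ≋ []
  ⊗-nonzeroˡ p [] a≉0 q≉[] _ = q≉[] ≋-refl
  ⊗-nonzeroˡ {a} p (b ∷ q) a≉0 q≉[] e with zero? b
  ... | yes b≈0 = ⊗-nonzeroˡ p q a≉0 (λ q≋[] → q≉[] (∷-≋[] b≈0 q≋[]))
          (tail-≋[] (≋-trans (≋-sym (≋-trans (⊗-∷ (a ∷ p) b q)
            (⊕-cong (≋-trans (scale-cong b≈0 ≋-refl) (scale-zero (a ∷ p))) ≋-refl))) e))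
  ... | no b≉0  = *-nonzero a≉0 b≉0 (trans (sym (+-identityʳ (a * b))) (head-≋[] e))

  ⊗-nonzero : ∀ {p q} → ¬ p ≋ [] → ¬ q ≋ [] → ¬ p ⊗ q ≋ []
  ⊗-nonzero {[]}    {q} p≉[] q≉[] _ = p≉[] ≋-refl
  ⊗-nonzero {a ∷ p} {q} p≉[] q≉[] e with zero? a
  ... | yes a≈0 = ⊗-nonzero {p} {q} (λ p≋[] → p≉[] (∷-≋[] a≈0 p≋[])) q≉[]
          (tail-≋[] (≋-trans (≋-sym (⊕-cong (≋-trans (scale-cong a≈0 ≋-refl) (scale-zero q)) ≋-refl)) e))
  ... | no a≉0  = ⊗-nonzeroˡ p q a≉0 q≉[] e

-- Modules over polynomial rings from commuting endomorphisms

Mod : CommutativeRing 0ℓ 0ℓ → Set₁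
Mod R = LeftModule (CommutativeRing.ring R) 0ℓ 0ℓ

record LinearMap {R : Ring 0ℓ 0ℓ} (M N : LeftModule R 0ℓ 0ℓ) : Set where
  private
    module M = LeftModule M
    module N = LeftModule N
  field
    apply      : M.Carrierᴹ → N.Carrierᴹ
    apply-cong : ∀ {x y} → x M.≈ᴹ y → apply x N.≈ᴹ apply y
    apply-+    : ∀ x y → apply (x M.+ᴹ y) N.≈ᴹ apply x N.+ᴹ apply y
    apply-*ₗ   : ∀ a x → apply (a M.*ₗ x) N.≈ᴹ a N.*ₗ apply x

  apply-0 : apply M.0ᴹ N.≈ᴹ N.0ᴹ
  apply-0 = N.≈ᴹ-trans (apply-cong (M.≈ᴹ-sym (M.*ₗ-zeroˡ M.0ᴹ))) (N.≈ᴹ-trans (apply-*ₗ _ M.0ᴹ) (N.*ₗ-zeroˡ _))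

-- An `R`-module with an endomorphism is a module over `R`[X]. Used twice, this makes an abelian
-- group with two commuting endomorphisms a module over polynomials in t and z, with no substitution
-- into polynomials to be defined.
module PolynomialModule (R : CommutativeRing 0ℓ 0ℓ) (M : Mod R) (X : LinearMap M M) where
  open CommutativeRing R using (Carrier; _≈_; _+_; _*_; 0#; 1#)
  open Polynomials R
  open LeftModule M
  open LinearMap X
  open CommutativeSemigroupProperties (CommutativeMonoid.commutativeSemigroup +ᴹ-commutativeMonoid) using (interchange)
  open SetoidReasoning ≈ᴹ-setoid

  act : List Carrier → Carrierᴹ → Carrierᴹ
  act []      x = 0ᴹ
  act (a ∷ p) x = a *ₗ x +ᴹ apply (act p x)

  act-≋[] : ∀ {p} x → p ≋ [] → act p x ≈ᴹ 0ᴹ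
  act-≋[] {[]}    x e = ≈ᴹ-refl
  act-≋[] {a ∷ p} x e = ≈ᴹ-trans
    (+ᴹ-cong (≈ᴹ-trans (*ₗ-cong (head-≋[] e) ≈ᴹ-refl) (*ₗ-zeroˡ x)) (≈ᴹ-trans (apply-cong (act-≋[] x (tail-≋[] e))) apply-0))
    (+ᴹ-identityˡ 0ᴹ)

  act-congˡ : ∀ {p q} x → p ≋ q → act p x ≈ᴹ act q x
  act-congˡ {[]}    {q}     x e = ≈ᴹ-sym (act-≋[] x (≋-sym e))
  act-congˡ {a ∷ p} {[]}    x e = act-≋[] x e
  act-congˡ {a ∷ p} {b ∷ q} x e = +ᴹ-cong (*ₗ-cong (head-≋ e) ≈ᴹ-refl) (apply-cong (act-congˡ x (tail-≋ e)))

  act-congʳ : ∀ p {x y} → x ≈ᴹ y → act p x ≈ᴹ act p y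
  act-congʳ []      e = ≈ᴹ-refl
  act-congʳ (a ∷ p) e = +ᴹ-cong (*ₗ-cong (CommutativeRing.refl R) e) (apply-cong (act-congʳ p e))

  act-zeroʳ : ∀ p → act p 0ᴹ ≈ᴹ 0ᴹ
  act-zeroʳ []      = ≈ᴹ-refl
  act-zeroʳ (a ∷ p) = ≈ᴹ-trans (+ᴹ-cong (*ₗ-zeroʳ a) (≈ᴹ-trans (apply-cong (act-zeroʳ p)) apply-0)) (+ᴹ-identityˡ 0ᴹ)

  act-⊕ : ∀ x p q → act (p ⊕ q) x ≈ᴹ act p x +ᴹ act q x
  act-⊕ x []      q       = ≈ᴹ-sym (+ᴹ-identityˡ _)
  act-⊕ x (a ∷ p) []      = ≈ᴹ-sym (+ᴹ-identityʳ _)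
  act-⊕ x (a ∷ p) (b ∷ q) = begin
    (a + b) *ₗ x +ᴹ apply (act (p ⊕ q) x)
      ≈⟨ +ᴹ-cong (*ₗ-distribʳ x a b) (≈ᴹ-trans (apply-cong (act-⊕ x p q)) (apply-+ _ _)) ⟩
    (a *ₗ x +ᴹ b *ₗ x) +ᴹ (apply (act p x) +ᴹ apply (act q x))
      ≈⟨ interchange _ _ _ _ ⟩
    (a *ₗ x +ᴹ apply (act p x)) +ᴹ (b *ₗ x +ᴹ apply (act q x)) ∎

  act-+ : ∀ p x y → act p (x +ᴹ y) ≈ᴹ act p x +ᴹ act p y
  act-+ []      x y = ≈ᴹ-sym (+ᴹ-identityˡ _)
  act-+ (a ∷ p) x y = begin
    a *ₗ (x +ᴹ y) +ᴹ apply (act p (x +ᴹ y))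
      ≈⟨ +ᴹ-cong (*ₗ-distribˡ a x y) (≈ᴹ-trans (apply-cong (act-+ p x y)) (apply-+ _ _)) ⟩
    (a *ₗ x +ᴹ a *ₗ y) +ᴹ (apply (act p x) +ᴹ apply (act p y))
      ≈⟨ interchange _ _ _ _ ⟩
    (a *ₗ x +ᴹ apply (act p x)) +ᴹ (a *ₗ y +ᴹ apply (act p y)) ∎

  act-scale : ∀ a p x → act (scale a p) x ≈ᴹ a *ₗ act p x
  act-scale a []      x = ≈ᴹ-sym (*ₗ-zeroʳ a)
  act-scale a (b ∷ p) x = begin
    (a * b) *ₗ x +ᴹ apply (act (scale a p) x)
      ≈⟨ +ᴹ-cong (*ₗ-assoc a b x) (≈ᴹ-trans (apply-cong (act-scale a p x)) (apply-*ₗ a _)) ⟩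
    a *ₗ (b *ₗ x) +ᴹ a *ₗ apply (act p x)
      ≈⟨ *ₗ-distribˡ a _ _ ⟨
    a *ₗ (b *ₗ x +ᴹ apply (act p x)) ∎

  act-shift : ∀ p x → act (0# ∷ p) x ≈ᴹ apply (act p x)
  act-shift p x = ≈ᴹ-trans (+ᴹ-cong (*ₗ-zeroˡ x) ≈ᴹ-refl) (+ᴹ-identityˡ _)

  act-const : ∀ a x → act (const a) x ≈ᴹ a *ₗ x
  act-const a x = ≈ᴹ-trans (+ᴹ-cong ≈ᴹ-refl apply-0) (+ᴹ-identityʳ _)

  act-⊗ : ∀ p q x → act (p ⊗ q) x ≈ᴹ act p (act q x)
  act-⊗ []      q x = ≈ᴹ-refl
  act-⊗ (a ∷ p) q x = begin
    act (scale a q ⊕ (0# ∷ (p ⊗ q))) x               ≈⟨ act-⊕ x (scale a q) _ ⟩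
    act (scale a q) x +ᴹ act (0# ∷ (p ⊗ q)) x        ≈⟨ +ᴹ-cong (act-scale a q x) (act-shift (p ⊗ q) x) ⟩
    a *ₗ act q x +ᴹ apply (act (p ⊗ q) x)            ≈⟨ +ᴹ-cong ≈ᴹ-refl (apply-cong (act-⊗ p q x)) ⟩
    a *ₗ act q x +ᴹ apply (act p (act q x))          ∎

  polynomialModule : Mod polynomialRing
  polynomialModule = record
    { Carrierᴹ = Carrierᴹ
    ; _≈ᴹ_ = _≈ᴹ_
    ; _+ᴹ_ = _+ᴹ_
    ; _*ₗ_ = act
    ; 0ᴹ   = 0ᴹ
    ; -ᴹ_  = -ᴹ_
    ; isLeftModule = record
      { isLeftSemimodule = record
        { +ᴹ-isCommutativeMonoid = +ᴹ-isCommutativeMonoid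
        ; isPreleftSemimodule = record
          { *ₗ-cong      = λ {p} {q} {x} {y} e f → ≈ᴹ-trans (act-congˡ x e) (act-congʳ q f)
          ; *ₗ-zeroˡ     = λ x → ≈ᴹ-refl
          ; *ₗ-distribʳ  = act-⊕
          ; *ₗ-identityˡ = λ x → ≈ᴹ-trans (act-const 1# x) (*ₗ-identityˡ x)
          ; *ₗ-assoc     = act-⊗
          ; *ₗ-zeroʳ     = act-zeroʳ
          ; *ₗ-distribˡ  = act-+
          }
        }
      ; -ᴹ‿cong = -ᴹ‿cong
      ; -ᴹ‿inverse = -ᴹ‿inverse
      }
    }

open PolynomialModule using (polynomialModule)

module _ (R : CommutativeRing 0ℓ 0ℓ) {M N : Mod R} (X : LinearMap M M) (Y : LinearMap N N) where
  private
    module M = LeftModule M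
    module N = LeftModule N
    module X = LinearMap X
    module Y = LinearMap Y

  -- A linear map that intertwines `X` and `Y` is linear over the polynomial ring. It supplies the
  -- second variable when the construction is iterated, and later the linearity of `rescale`.
  extendLinear : (φ : LinearMap M N) → (∀ x → LinearMap.apply φ (X.apply x) N.≈ᴹ Y.apply (LinearMap.apply φ x)) →
                 LinearMap (polynomialModule R M X) (polynomialModule R N Y)
  extendLinear φ commutes = record
    { apply = apply ; apply-cong = apply-cong ; apply-+ = apply-+ ; apply-*ₗ = apply-act }
    where
    open LinearMap φ
    apply-act : ∀ p x → apply (PolynomialModule.act R M X p x) N.≈ᴹ PolynomialModule.act R N Y p (apply x)
    apply-act []      x = apply-0
    apply-act (a ∷ p) x = N.≈ᴹ-trans (apply-+ _ _)
      (N.+ᴹ-cong (apply-*ₗ a x) (N.≈ᴹ-trans (commutes _) (Y.apply-cong (apply-act p x))))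

ℤring = ℤₚ.+-*-commutativeRing

module ℤ[t] = Polynomials ℤring

-- Both orders of adjoining t and z are kept: in `τZ-action` the outer list runs over powers of z
-- with entries in ℤ[t], as elimination requires; in `Zτ-action` it runs over powers of t with
-- entries in ℤ[z], as in `Poly2ℤ`.
module Swap (M : Mod ℤring) (τ Z : LinearMap M M)
  (commutes : ∀ x → LeftModule._≈ᴹ_ M (LinearMap.apply Z (LinearMap.apply τ x)) (LinearMap.apply τ (LinearMap.apply Z x))) where

  open LeftModule M
  private
    module τ = LinearMap τ
    module Z = LinearMap Z

  Mτ = polynomialModule ℤring M τ
  MZ = polynomialModule ℤring M Z

  Zτ : LinearMap Mτ Mτ
  Zτ = extendLinear ℤring τ τ Z commutes

  τZ : LinearMap MZ MZ
  τZ = extendLinear ℤring Z Z τ (λ x → ≈ᴹ-sym (commutes x))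

  MτZ = polynomialModule ℤ[t].polynomialRing Mτ Zτ
  MZτ = polynomialModule ℤ[t].polynomialRing MZ τZ

  module τZ-action = PolynomialModule ℤ[t].polynomialRing Mτ Zτ
  module Zτ-action = PolynomialModule ℤ[t].polynomialRing MZ τZ
  module τ-action  = PolynomialModule ℤring M τ
  module Z-action  = PolynomialModule ℤring M Z

-- Poly2ℤ lists its rows by powers of t, whereas the elimination takes place in ℤ[t][z].
swap : List (List ℤ) → List (List ℤ)
swap []      = []
swap (a ∷ b) = Polynomials._⊕_ ℤ[t].polynomialRing (map ℤ[t].const a) (map ((+ 0) ∷_) (swap b))

module _ (M : Mod ℤring) (τ Z : LinearMap M M)
  (commutes : ∀ x → LeftModule._≈ᴹ_ M (LinearMap.apply Z (LinearMap.apply τ x)) (LinearMap.apply τ (LinearMap.apply Z x))) where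
  open Swap M τ Z commutes
  open LeftModule M
  private
    module τ = LinearMap τ
    module Z = LinearMap Z
  open SetoidReasoning ≈ᴹ-setoid

  act-map-const : ∀ a x → Zτ-action.act (map ℤ[t].const a) x ≈ᴹ τ-action.act a x
  act-map-const []      x = ≈ᴹ-refl
  act-map-const (c ∷ a) x = +ᴹ-cong (Z-action.act-const c x) (τ.apply-cong (act-map-const a x))

  act-map-shift : ∀ g x → Zτ-action.act (map ((+ 0) ∷_) g) x ≈ᴹ Z.apply (Zτ-action.act g x)
  act-map-shift []      x = ≈ᴹ-sym Z.apply-0
  act-map-shift (r ∷ g) x = begin
    Z-action.act ((+ 0) ∷ r) x +ᴹ τ.apply (Zτ-action.act (map ((+ 0) ∷_) g) x)
      ≈⟨ +ᴹ-cong (Z-action.act-shift r x) (τ.apply-cong (act-map-shift g x)) ⟩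
    Z.apply (Z-action.act r x) +ᴹ τ.apply (Z.apply (Zτ-action.act g x))
      ≈⟨ +ᴹ-cong ≈ᴹ-refl (commutes _) ⟨
    Z.apply (Z-action.act r x) +ᴹ Z.apply (τ.apply (Zτ-action.act g x))
      ≈⟨ Z.apply-+ _ _ ⟨
    Z.apply (Z-action.act r x +ᴹ τ.apply (Zτ-action.act g x)) ∎

  act-swap : ∀ b x → Zτ-action.act (swap b) x ≈ᴹ τZ-action.act b x
  act-swap []      x = ≈ᴹ-refl
  act-swap (a ∷ b) x = begin
    Zτ-action.act (swap (a ∷ b)) x
      ≈⟨ Zτ-action.act-⊕ x (map ℤ[t].const a) _ ⟩
    Zτ-action.act (map ℤ[t].const a) x +ᴹ Zτ-action.act (map ((+ 0) ∷_) (swap b)) x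
      ≈⟨ +ᴹ-cong (act-map-const a x) (act-map-shift (swap b) x) ⟩
    τ-action.act a x +ᴹ Z.apply (Zτ-action.act (swap b) x)
      ≈⟨ +ᴹ-cong ≈ᴹ-refl (Z.apply-cong (act-swap b x)) ⟩
    τ-action.act a x +ᴹ Z.apply (τZ-action.act b x) ∎

-- Factorisation of the Legendre step in a differential ring

record Derivation (K : CommutativeRing 0ℓ 0ℓ) : Set where
  open CommutativeRing K
  field
    ∂      : Carrier → Carrier
    ∂-cong : ∀ {f g} → f ≈ g → ∂ f ≈ ∂ g
    ∂-+    : ∀ f g → ∂ (f + g) ≈ ∂ f + ∂ g
    ∂-*    : ∀ f g → ∂ (f * g) ≈ ∂ f * g + f * ∂ g

  open RingProperties ring using (x+x≈x⇒x≈0)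
  open RingSolver K
  open SetoidReasoning setoid

  ∂0 : ∂ 0# ≈ 0#
  ∂0 = x+x≈x⇒x≈0 (∂ 0#) (trans (sym (∂-+ 0# 0#)) (∂-cong (+-identityˡ 0#)))

  ∂-neg : ∀ f → ∂ (- f) ≈ - ∂ f
  ∂-neg f = begin
    ∂ (- f)                    ≈⟨ solve 2 (λ a b → a := (a :+ b) :- b) refl (∂ (- f)) (∂ f) ⟩
    (∂ (- f) + ∂ f) - ∂ f      ≈⟨ +-congʳ (trans (sym (∂-+ (- f) f)) (trans (∂-cong (-‿inverseˡ f)) ∂0)) ⟩
    0# - ∂ f                   ≈⟨ +-identityˡ _ ⟩
    - ∂ f                      ∎

module DifferentialRing
  (K : CommutativeRing 0ℓ 0ℓ) (D : Derivation K)
  (z : CommutativeRing.Carrier K) (∂z : CommutativeRing._≈_ K (Derivation.∂ D z) (CommutativeRing.1# K))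
  where
  open CommutativeRing K hiding (zero)
  open Derivation D using (∂; ∂-cong; ∂-+; ∂-*; ∂0; ∂-neg)
  open Exponentiation semiring using (_^_)
  open RingSolver K
  open RingProperties ring using (x+x≈x⇒x≈0)
  open SetoidReasoning setoid

  w : Carrier
  w = 1# - z

  nat : ℕ → Carrier
  nat = ℕcast K

  ∂1 : ∂ 1# ≈ 0#
  ∂1 = x+x≈x⇒x≈0 (∂ 1#) (begin
    ∂ 1# + ∂ 1#             ≈⟨ +-cong (*-identityʳ _) (*-identityˡ _) ⟨
    ∂ 1# * 1# + 1# * ∂ 1#   ≈⟨ ∂-* 1# 1# ⟨
    ∂ (1# * 1#)             ≈⟨ ∂-cong (*-identityˡ 1#) ⟩
    ∂ 1#                    ∎)

  ∂nat : ∀ k → ∂ (nat k) ≈ 0#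
  ∂nat zero    = ∂0
  ∂nat (suc k) = trans (∂-+ 1# (nat k)) (trans (+-cong ∂1 (∂nat k)) (+-identityˡ 0#))

  ∂-nat* : ∀ k f → ∂ (nat k * f) ≈ nat k * ∂ f
  ∂-nat* k f = trans (∂-* (nat k) f) (trans (+-congʳ (trans (*-congʳ (∂nat k)) (zeroˡ f))) (+-identityˡ _))

  ∂-z* : ∀ f → ∂ (z * f) ≈ f + z * ∂ f
  ∂-z* f = trans (∂-* z f) (+-congʳ (trans (*-congʳ ∂z) (*-identityˡ f)))

  ∂w : ∂ w ≈ - 1#
  ∂w = begin
    ∂ (1# - z)     ≈⟨ ∂-+ 1# (- z) ⟩
    ∂ 1# + ∂ (- z) ≈⟨ +-cong ∂1 (trans (∂-neg z) (-‿cong ∂z)) ⟩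
    0# + - 1#      ≈⟨ +-identityˡ _ ⟩
    - 1#           ∎

  ∂-w* : ∀ f → ∂ (w * f) ≈ w * ∂ f - f
  ∂-w* f = begin
    ∂ (w * f)             ≈⟨ ∂-* w f ⟩
    ∂ w * f + w * ∂ f     ≈⟨ +-congʳ (*-congʳ (trans ∂w (-‿cong (sym (+-identityʳ 1#))))) ⟩
    ℤcast K -[1+ 0 ] * f + w * ∂ f ≈⟨ solve 3 (λ f w g → con -[1+ 0 ] :* f :+ w :* g := w :* g :- f) refl f w (∂ f) ⟩
    w * ∂ f - f           ∎

  ∂^ : ℕ → Carrier → Carrier
  ∂^ k f = fold f ∂ k

  ∂^-cong : ∀ k {f g} → f ≈ g → ∂^ k f ≈ ∂^ k g
  ∂^-cong zero    e = e
  ∂^-cong (suc k) e = ∂-cong (∂^-cong k e)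

  -- Since ∂w = -1, Leibniz gives ∂^k (w g) = w ∂^k g - k ∂^(k-1) g; the summand k f compensates the
  -- last term. This carries one factor w out of the derivative, as `∂^-z∂` does for z.
  ∂^-w∂ : ∀ k f → ∂^ k (w * ∂ f + nat k * f) ≈ w * ∂^ (suc k) f
  ∂^-w∂ k f = trans (lemma k k) (solve 3 (λ a b n → a :- n :* b :+ n :* b := a) refl (w * ∂ (∂^ k f)) (∂^ k f) (nat k))
    where
    -- The constant `j` is separated from the order `k`, so that the induction can vary `k` alone.
    lemma : ∀ j k → ∂^ k (w * ∂ f + nat j * f) ≈ (w * ∂ (∂^ k f) - nat k * ∂^ k f) + nat j * ∂^ k f
    lemma j zero    = solve 3 (λ a b c → a :+ b := (a :- con (+ 0) :* c) :+ b) refl (w * ∂ f) (nat j * f) f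
    lemma j (suc k) = begin
      ∂ (∂^ k (w * ∂ f + nat j * f))
        ≈⟨ ∂-cong (lemma j k) ⟩
      ∂ ((w * ∂ g - nat k * g) + nat j * g)
        ≈⟨ trans (∂-+ _ _) (+-congʳ (∂-+ _ _)) ⟩
      (∂ (w * ∂ g) + ∂ (- (nat k * g))) + ∂ (nat j * g)
        ≈⟨ +-cong (+-cong (∂-w* (∂ g)) (trans (∂-neg _) (-‿cong (∂-nat* k g)))) (∂-nat* j g) ⟩
      ((w * ∂ (∂ g) - ∂ g) - nat k * ∂ g) + nat j * ∂ g
        ≈⟨ solve 4 (λ a b n m → ((a :- b) :- n :* b) :+ m := (a :- (con (+ 1) :+ n) :* b) :+ m) refl (w * ∂ (∂ g)) (∂ g) (nat k) (nat j * ∂ g) ⟩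
      (w * ∂ (∂ g) - (ℤcast K (+ 1) + nat k) * ∂ g) + nat j * ∂ g
        ≈⟨ +-congʳ (+-congˡ (-‿cong (*-congʳ (+-congʳ (+-identityʳ 1#))))) ⟩
      (w * ∂ (∂ g) - nat (suc k) * ∂ g) + nat j * ∂ g ∎
      where g = ∂^ k f

  ∂^-z∂ : ∀ k f → ∂^ k (z * ∂ f - nat k * f) ≈ z * ∂^ (suc k) f
  ∂^-z∂ k f = trans (lemma k k) (solve 3 (λ a b n → a :+ n :* b :- n :* b := a) refl (z * ∂ (∂^ k f)) (∂^ k f) (nat k))
    where
    lemma : ∀ j k → ∂^ k (z * ∂ f - nat j * f) ≈ (z * ∂ (∂^ k f) + nat k * ∂^ k f) - nat j * ∂^ k f
    lemma j zero    = solve 3 (λ a b c → a :- b := (a :+ con (+ 0) :* c) :- b) refl (z * ∂ f) (nat j * f) f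
    lemma j (suc k) = begin
      ∂ (∂^ k (z * ∂ f - nat j * f))
        ≈⟨ ∂-cong (lemma j k) ⟩
      ∂ ((z * ∂ g + nat k * g) - nat j * g)
        ≈⟨ trans (∂-+ _ _) (+-congʳ (∂-+ _ _)) ⟩
      (∂ (z * ∂ g) + ∂ (nat k * g)) + ∂ (- (nat j * g))
        ≈⟨ +-cong (+-cong (∂-z* (∂ g)) (∂-nat* k g)) (trans (∂-neg _) (-‿cong (∂-nat* j g))) ⟩
      ((∂ g + z * ∂ (∂ g)) + nat k * ∂ g) - nat j * ∂ g
        ≈⟨ solve 4 (λ a b n m → ((b :+ a) :+ n :* b) :- m := (a :+ (con (+ 1) :+ n) :* b) :- m) refl (z * ∂ (∂ g)) (∂ g) (nat k) (nat j * ∂ g) ⟩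
      (z * ∂ (∂ g) + (ℤcast K (+ 1) + nat k) * ∂ g) - nat j * ∂ g
        ≈⟨ +-congʳ (+-congˡ (*-congʳ (+-congʳ (+-identityʳ 1#)))) ⟩
      (z * ∂ (∂ g) + nat (suc k) * ∂ g) - nat j * ∂ g ∎
      where g = ∂^ k f

  weight : ℕ → ℕ → Carrier
  weight p q = z ^ p * w ^ q

  -- The logarithmic derivative p/z - q/w of the weight, cleared of denominators.
  logarithmic-derivative : ∀ p q → z * w * ∂ (weight p q) ≈ (nat p * w - nat q * z) * weight p q
  logarithmic-derivative zero zero = begin
    z * w * ∂ (1# * 1#)  ≈⟨ *-congˡ (trans (∂-cong (*-identityˡ 1#)) ∂1) ⟩
    z * w * 0#           ≈⟨ solve 3 (λ z w v → z :* w :* con (+ 0) := (con (+ 0) :* w :- con (+ 0) :* z) :* v) refl z w _ ⟩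
    (nat 0 * w - nat 0 * z) * weight 0 0 ∎
  logarithmic-derivative zero (suc q) = begin
    z * w * ∂ (1# * (w * w ^ q))
      ≈⟨ *-congˡ (∂-cong swap-factors) ⟩
    z * w * ∂ (w * v)
      ≈⟨ *-congˡ (∂-w* v) ⟩
    z * w * (w * ∂ v - v)
      ≈⟨ solve 4 (λ z w v d → z :* w :* (w :* d :- v) := w :* (z :* w :* d) :- z :* w :* v) refl z w v (∂ v) ⟩
    w * (z * w * ∂ v) - z * w * v
      ≈⟨ +-congʳ (*-congˡ (logarithmic-derivative zero q)) ⟩
    w * ((nat 0 * w - nat q * z) * v) - z * w * v
      ≈⟨ solve 4 (λ z w v n → w :* ((con (+ 0) :* w :- n :* z) :* v) :- z :* w :* v := (con (+ 0) :* w :- (con (+ 1) :+ n) :* z) :* (w :* v)) refl z w v (nat q) ⟩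
    (nat 0 * w - (ℤcast K (+ 1) + nat q) * z) * (w * v)
      ≈⟨ *-cong (+-congˡ (-‿cong (*-congʳ (+-congʳ (+-identityʳ 1#))))) (sym swap-factors) ⟩
    (nat 0 * w - nat (suc q) * z) * weight 0 (suc q) ∎
    where
    v = weight 0 q
    swap-factors : 1# * (w * w ^ q) ≈ w * (1# * w ^ q)
    swap-factors = solve 3 (λ a w u → a :* (w :* u) := w :* (a :* u)) refl 1# w (w ^ q)
  logarithmic-derivative (suc p) q = begin
    z * w * ∂ (z * z ^ p * w ^ q)
      ≈⟨ *-congˡ (∂-cong (*-assoc z _ _)) ⟩
    z * w * ∂ (z * v)
      ≈⟨ *-congˡ (∂-z* v) ⟩
    z * w * (v + z * ∂ v)
      ≈⟨ solve 4 (λ z w v d → z :* w :* (v :+ z :* d) := z :* (z :* w :* d) :+ z :* w :* v) refl z w v (∂ v) ⟩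
    z * (z * w * ∂ v) + z * w * v
      ≈⟨ +-congʳ (*-congˡ (logarithmic-derivative p q)) ⟩
    z * ((nat p * w - nat q * z) * v) + z * w * v
      ≈⟨ solve 5 (λ z w v m n → z :* ((m :* w :- n :* z) :* v) :+ z :* w :* v := ((con (+ 1) :+ m) :* w :- n :* z) :* (z :* v)) refl z w v (nat p) (nat q) ⟩
    ((ℤcast K (+ 1) + nat p) * w - nat q * z) * (z * v)
      ≈⟨ *-cong (+-congʳ (*-congʳ (+-congʳ (+-identityʳ 1#)))) (sym (*-assoc z _ _)) ⟩
    (nat (suc p) * w - nat q * z) * weight (suc p) q ∎
    where v = weight p q

  -- Corresponds to multiplication by s under the transform below.
  S : Carrier → Carrier
  S f = z * ∂ (w * f)

  -- The Legendre step with ∂^(p+q) in place of D_{p+q}; the factorial returns in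
  -- `legendreStep≋step`.
  step : ℕ → ℕ → Carrier → Carrier
  step p q f = z ^ q * w ^ p * ∂^ (p ℕ.+ q) (weight p q * f)

  step-00 : ∀ f → step 0 0 f ≈ f
  step-00 f = trans (*-cong (*-identityˡ 1#) (trans (*-congʳ (*-identityˡ 1#)) (*-identityˡ f))) (*-identityˡ f)

  private
    ∂-weight* : ∀ p q f → z * w * ∂ (weight p q * f) ≈ (nat p * w - nat q * z) * weight p q * f + z * w * weight p q * ∂ f
    ∂-weight* p q f = begin
      z * w * ∂ (v * f)                          ≈⟨ *-congˡ (∂-* v f) ⟩
      z * w * (∂ v * f + v * ∂ f)                ≈⟨ solve 6 (λ z w v d f e → z :* w :* (d :* f :+ v :* e) := z :* w :* d :* f :+ z :* w :* v :* e) refl z w v (∂ v) f (∂ f) ⟩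
      z * w * ∂ v * f + z * w * v * ∂ f          ≈⟨ +-congʳ (*-congʳ (logarithmic-derivative p q)) ⟩
      (nat p * w - nat q * z) * v * f + z * w * v * ∂ f ∎
      where v = weight p q

  -- Conjugation by the weight brings `S` + p + 1 into the form that `∂^-w∂` accepts, with the
  -- constant equal to the order p + q of the derivative.
  conjugate-p : ∀ p q f → weight p q * (S f + nat (suc p) * f) ≈ w * ∂ (z * (weight p q * f)) + nat (p ℕ.+ q) * (z * (weight p q * f))
  conjugate-p p q f = begin
    v * (z * ∂ (w * f) + nat (suc p) * f)
      ≈⟨ *-congˡ (+-congʳ (*-congˡ (∂-w* f))) ⟩
    v * (z * (w * ∂ f - f) + (1# + nat p) * f)
      -- The unit enters as a variable `i`, so that w can be written `i - z`. The appended
      -- difference m v f - m i v f makes the identity hold for every `i` and vanishes at `i` = 1.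
      ≈⟨ solve 7 (λ i z v f d m n →
           v :* (z :* ((i :- z) :* d :- f) :+ (i :+ m) :* f)
             := (i :- z) :* (v :* f) :+ ((m :* (i :- z) :- n :* z) :* v :* f :+ z :* (i :- z) :* v :* d)
                 :+ (m :+ n) :* (z :* (v :* f)) :+ (m :* v :* f :- m :* i :* v :* f))
           refl 1# z v f (∂ f) (nat p) (nat q) ⟩
    w * (v * f) + ((nat p * w - nat q * z) * v * f + z * w * v * ∂ f) + (nat p + nat q) * (z * (v * f)) + (nat p * v * f - nat p * 1# * v * f)
      ≈⟨ +-cong (+-cong (+-congˡ (sym (∂-weight* p q f))) (*-congʳ (sym (IntegerCast.ℕcast-+ K p q))))
           (trans (+-congˡ (-‿cong (*-congʳ (*-congʳ (*-identityʳ _))))) (-‿inverseʳ _)) ⟩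
    w * (v * f) + z * w * ∂ (v * f) + nat (p ℕ.+ q) * (z * (v * f)) + 0#
      ≈⟨ solve 5 (λ z w u d k → w :* u :+ z :* w :* d :+ k :+ con (+ 0) := w :* (u :+ z :* d) :+ k) refl z w (v * f) (∂ (v * f)) (nat (p ℕ.+ q) * (z * (v * f))) ⟩
    w * (v * f + z * ∂ (v * f)) + nat (p ℕ.+ q) * (z * (v * f))
      ≈⟨ +-congʳ (*-congˡ (∂-z* (v * f))) ⟨
    w * ∂ (z * (v * f)) + nat (p ℕ.+ q) * (z * (v * f)) ∎
    where v = weight p q

  conjugate-q : ∀ q f → weight 0 q * (S f - nat q * f) ≈ z * ∂ (w * (weight 0 q * f)) - nat q * (w * (weight 0 q * f))
  conjugate-q q f = begin
    v * (z * ∂ (w * f) - nat q * f)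
      ≈⟨ *-congˡ (+-congʳ (*-congˡ (∂-w* f))) ⟩
    v * (z * (w * ∂ f - f) - nat q * f)
      ≈⟨ solve 6 (λ i z v f d n →
           v :* (z :* ((i :- z) :* d :- f) :- n :* f)
             := ((con (+ 0) :* (i :- z) :- n :* z) :* v :* f :+ z :* (i :- z) :* v :* d) :- z :* (v :* f)
                 :- n :* ((i :- z) :* (v :* f)) :+ (n :* i :* v :* f :- n :* v :* f))
           refl 1# z v f (∂ f) (nat q) ⟩
    ((nat 0 * w - nat q * z) * v * f + z * w * v * ∂ f) - z * (v * f) - nat q * (w * (v * f)) + (nat q * 1# * v * f - nat q * v * f)
      ≈⟨ +-cong (+-congʳ (+-congʳ (sym (∂-weight* 0 q f))))
           (trans (+-congʳ (*-congʳ (*-congʳ (*-identityʳ _)))) (-‿inverseʳ _)) ⟩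
    z * w * ∂ (v * f) - z * (v * f) - nat q * (w * (v * f)) + 0#
      ≈⟨ solve 5 (λ z w u d k → z :* w :* d :- z :* u :- k :+ con (+ 0) := z :* (w :* d :- u) :- k) refl z w (v * f) (∂ (v * f)) (nat q * (w * (v * f))) ⟩
    z * (w * ∂ (v * f) - v * f) - nat q * (w * (v * f))
      ≈⟨ +-congʳ (*-congˡ (∂-w* (v * f))) ⟨
    z * ∂ (w * (v * f)) - nat q * (w * (v * f)) ∎
    where v = weight 0 q

  -- One more order of p costs one linear factor in `S` at the input. Together with `step-suc-q`,
  -- which takes over once p has been reduced to 0, this writes the step as the product of all `S` +
  -- i, 1 ≤ i ≤ p, and all `S` - j, 0 ≤ j < q.
  step-suc-p : ∀ p q f → step (suc p) q f ≈ step p q (S f + nat (suc p) * f)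
  step-suc-p p q f = begin
    z ^ q * (w * w ^ p) * ∂^ (suc k) (z * z ^ p * w ^ q * f)
      ≈⟨ *-congˡ (∂^-cong (suc k) (trans (*-congʳ (*-assoc z _ _)) (*-assoc z _ f))) ⟩
    z ^ q * (w * w ^ p) * ∂^ (suc k) (z * (weight p q * f))
      ≈⟨ solve 4 (λ a w b d → a :* (w :* b) :* d := a :* b :* (w :* d)) refl (z ^ q) w (w ^ p) _ ⟩
    z ^ q * w ^ p * (w * ∂^ (suc k) (z * (weight p q * f)))
      ≈⟨ *-congˡ (∂^-w∂ k (z * (weight p q * f))) ⟨
    z ^ q * w ^ p * ∂^ k (w * ∂ (z * (weight p q * f)) + nat k * (z * (weight p q * f)))
      ≈⟨ *-congˡ (∂^-cong k (conjugate-p p q f)) ⟨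
    z ^ q * w ^ p * ∂^ k (weight p q * (S f + nat (suc p) * f)) ∎
    where k = p ℕ.+ q

  step-suc-q : ∀ q f → step 0 (suc q) f ≈ step 0 q (S f - nat q * f)
  step-suc-q q f = begin
    z * z ^ q * 1# * ∂^ (suc q) (1# * (w * w ^ q) * f)
      ≈⟨ *-congˡ (∂^-cong (suc q) (solve 4 (λ i w u f → i :* (w :* u) :* f := w :* (i :* u :* f)) refl 1# w (w ^ q) f)) ⟩
    z * z ^ q * 1# * ∂^ (suc q) (w * (weight 0 q * f))
      ≈⟨ solve 4 (λ z a i d → z :* a :* i :* d := a :* i :* (z :* d)) refl z (z ^ q) 1# _ ⟩
    z ^ q * 1# * (z * ∂^ (suc q) (w * (weight 0 q * f)))
      ≈⟨ *-congˡ (∂^-z∂ q (w * (weight 0 q * f))) ⟨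
    z ^ q * 1# * ∂^ q (z * ∂ (w * (weight 0 q * f)) - nat q * (w * (weight 0 q * f)))
      ≈⟨ *-congˡ (∂^-cong q (conjugate-q q f)) ⟨
    z ^ q * 1# * ∂^ q (weight 0 q * (S f - nat q * f)) ∎

-- Rational polynomials: derivative, the operator T and the Euler operator

ℚring : CommutativeRing 0ℓ 0ℓ
ℚring = ℚₚ.+-*-commutativeRing

open Polynomials ℚring
module ℚSolver = RingSolver ℚring

-- Rationals are stored in lowest terms, which blocks computation; the identity is checked on
-- unnormalised fractions with denominator 1.
ℤtoℚ-+ : ∀ a b → ℤtoℚ (a ℤ.+ b) ≡ ℤtoℚ a ℚ.+ ℤtoℚ b
ℤtoℚ-+ a b = ℚₚ.toℚᵘ-injective (begin
  toℚᵘ (ℤtoℚ (a ℤ.+ b))                   ≈⟨ ℚₚ.toℚᵘ-fromℚᵘ (mkℚᵘ (a ℤ.+ b) 0) ⟩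
  mkℚᵘ (a ℤ.+ b) 0                        ≈⟨ *≡* (cong (ℤ._* + 1) (cong₂ ℤ._+_ (≡.sym (ℤₚ.*-identityʳ a)) (≡.sym (ℤₚ.*-identityʳ b)))) ⟩
  mkℚᵘ a 0 ℚᵘ.+ mkℚᵘ b 0                  ≈⟨ ℚᵘₚ.+-cong (ℚₚ.toℚᵘ-fromℚᵘ (mkℚᵘ a 0)) (ℚₚ.toℚᵘ-fromℚᵘ (mkℚᵘ b 0)) ⟨
  toℚᵘ (ℤtoℚ a) ℚᵘ.+ toℚᵘ (ℤtoℚ b)        ≈⟨ ℚₚ.toℚᵘ-homo-+ (ℤtoℚ a) (ℤtoℚ b) ⟨
  toℚᵘ (ℤtoℚ a ℚ.+ ℤtoℚ b)                ∎)
  where open SetoidReasoning ℚᵘₚ.≃-setoid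

ℤtoℚ-* : ∀ a b → ℤtoℚ (a ℤ.* b) ≡ ℤtoℚ a ℚ.* ℤtoℚ b
ℤtoℚ-* a b = ℚₚ.toℚᵘ-injective (begin
  toℚᵘ (ℤtoℚ (a ℤ.* b))                   ≈⟨ ℚₚ.toℚᵘ-fromℚᵘ (mkℚᵘ (a ℤ.* b) 0) ⟩
  mkℚᵘ a 0 ℚᵘ.* mkℚᵘ b 0                  ≈⟨ ℚᵘₚ.*-cong (ℚₚ.toℚᵘ-fromℚᵘ (mkℚᵘ a 0)) (ℚₚ.toℚᵘ-fromℚᵘ (mkℚᵘ b 0)) ⟨
  toℚᵘ (ℤtoℚ a) ℚᵘ.* toℚᵘ (ℤtoℚ b)        ≈⟨ ℚₚ.toℚᵘ-homo-* (ℤtoℚ a) (ℤtoℚ b) ⟨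
  toℚᵘ (ℤtoℚ a ℚ.* ℤtoℚ b)                ∎)
  where open SetoidReasoning ℚᵘₚ.≃-setoid

ℕtoℚ-+ : ∀ m n → ℕtoℚ (m ℕ.+ n) ≡ ℕtoℚ m ℚ.+ ℕtoℚ n
ℕtoℚ-+ m n = ℤtoℚ-+ (+ m) (+ n)

ℕtoℚ-* : ∀ m n → ℕtoℚ (m ℕ.* n) ≡ ℕtoℚ m ℚ.* ℕtoℚ n
ℕtoℚ-* m n = ≡.trans (cong ℤtoℚ (ℤₚ.pos-* m n)) (ℤtoℚ-* (+ m) (+ n))

ℕtoℚ-suc : ∀ n → ℕtoℚ (suc n) ≡ 1ℚ ℚ.+ ℕtoℚ n
ℕtoℚ-suc n = ℕtoℚ-+ 1 n

reciprocal : ∀ n .{{_ : ℕ.NonZero n}} → ℕtoℚ n ℚ.* (+ 1 ℚ./ n) ≡ 1ℚ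
reciprocal (suc n) = ℚₚ.toℚᵘ-injective (begin
  toℚᵘ (ℕtoℚ (suc n) ℚ.* (+ 1 ℚ./ suc n))         ≈⟨ ℚₚ.toℚᵘ-homo-* (ℕtoℚ (suc n)) (+ 1 ℚ./ suc n) ⟩
  toℚᵘ (ℕtoℚ (suc n)) ℚᵘ.* toℚᵘ (+ 1 ℚ./ suc n)   ≈⟨ ℚᵘₚ.*-cong (ℚₚ.toℚᵘ-fromℚᵘ (mkℚᵘ (+ suc n) 0)) (ℚₚ.toℚᵘ-fromℚᵘ (mkℚᵘ (+ 1) n)) ⟩
  mkℚᵘ (+ suc n) 0 ℚᵘ.* mkℚᵘ (+ 1) n              ≈⟨ *≡* (≡.trans (ℤₚ.*-identityʳ _) (≡.trans (ℤₚ.*-identityʳ _) (cong +_ (≡.sym (≡.trans (ℕₚ.*-identityˡ _) (ℕₚ.*-identityˡ _)))))) ⟩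
  toℚᵘ 1ℚ                                          ∎)
  where open SetoidReasoning ℚᵘₚ.≃-setoid

+P≡⊕ : ∀ p q → p +P q ≡ p ⊕ q
+P≡⊕ []      q       = ≡.refl
+P≡⊕ (a ∷ p) []      = ≡.refl
+P≡⊕ (a ∷ p) (b ∷ q) = cong (a ℚ.+ b ∷_) (+P≡⊕ p q)

*P≡⊗ : ∀ p q → p *P q ≡ p ⊗ q
*P≡⊗ []      q = ≡.refl
*P≡⊗ (a ∷ p) q = ≡.trans (+P≡⊕ (scaleP a q) (0ℚ ∷ p *P q)) (cong (λ r → scaleP a q ⊕ (0ℚ ∷ r)) (*P≡⊗ p q))

iterate≡fold : ∀ k f p → iterate k f p ≡ fold p f k
iterate≡fold zero    f p = ≡.refl
iterate≡fold (suc k) f p = cong f (iterate≡fold k f p)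

-- The local functions of deriv and T have no accessible name; they are recovered by unification.
mutual
  deriv-from : ℚ → Poly → ℕ → Poly → Poly
  deriv-from = _

  deriv-unfold : ∀ a b p → deriv (a ∷ b ∷ p) ≡ (ℕtoℚ 1 ℚ.* b) ∷ deriv-from a (b ∷ p) 2 p
  -- Once the arguments are abstracted to distinct variables, comparing the two sides is a pattern
  -- problem that determines `deriv-from`.
  deriv-unfold a b p with b ∷ p
  ... | r with 2
  ...   | k = ≡.refl

mutual
  T-from : ℕ → Poly → Poly
  T-from = _

  T-unfold : ∀ a p → T (a ∷ p) ≡ scaleP a (Tmono 0) +P T-from 1 p
  T-unfold a p with 1
  ... | k = ≡.refl

coeff-deriv-from : ∀ a r k p i → coeff (deriv-from a r k p) i ≡ ℕtoℚ (k ℕ.+ i) ℚ.* coeff p i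
coeff-deriv-from a r k []      i       = ≡.sym (ℚₚ.*-zeroʳ (ℕtoℚ (k ℕ.+ i)))
coeff-deriv-from a r k (b ∷ p) zero    = cong (λ j → ℕtoℚ j ℚ.* b) (≡.sym (ℕₚ.+-identityʳ k))
coeff-deriv-from a r k (b ∷ p) (suc i) = ≡.trans (coeff-deriv-from a r (suc k) p i) (cong (λ j → ℕtoℚ j ℚ.* coeff p i) (≡.sym (ℕₚ.+-suc k i)))

coeff-deriv : ∀ p i → coeff (deriv p) i ≡ ℕtoℚ (suc i) ℚ.* coeff p (suc i)
coeff-deriv []      i = ≡.sym (ℚₚ.*-zeroʳ (ℕtoℚ (suc i)))
coeff-deriv (a ∷ p) i = coeff-deriv-from a p 1 p i

deriv-cong : ∀ {p q} → p ≋ q → deriv p ≋ deriv q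
deriv-cong {p} {q} e = coeffwise λ i →
  ≡.trans (coeff-deriv p i) (≡.trans (cong (ℕtoℚ (suc i) ℚ.*_) (at e (suc i))) (≡.sym (coeff-deriv q i)))

deriv-⊕ : ∀ p q → deriv (p ⊕ q) ≋ deriv p ⊕ deriv q
deriv-⊕ p q = coeffwise λ i → begin
  coeff (deriv (p ⊕ q)) i                                                        ≡⟨ coeff-deriv (p ⊕ q) i ⟩
  ℕtoℚ (suc i) ℚ.* coeff (p ⊕ q) (suc i)                                         ≡⟨ cong (ℕtoℚ (suc i) ℚ.*_) (coeff-⊕ p q (suc i)) ⟩
  ℕtoℚ (suc i) ℚ.* (coeff p (suc i) ℚ.+ coeff q (suc i))                         ≡⟨ ℚₚ.*-distribˡ-+ (ℕtoℚ (suc i)) _ _ ⟩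
  ℕtoℚ (suc i) ℚ.* coeff p (suc i) ℚ.+ ℕtoℚ (suc i) ℚ.* coeff q (suc i)          ≡⟨ cong₂ ℚ._+_ (coeff-deriv p i) (coeff-deriv q i) ⟨
  coeff (deriv p) i ℚ.+ coeff (deriv q) i                                        ≡⟨ coeff-⊕ (deriv p) (deriv q) i ⟨
  coeff (deriv p ⊕ deriv q) i                                                    ∎
  where open ≡-Reasoning

deriv-scale : ∀ c p → deriv (scale c p) ≋ scale c (deriv p)
deriv-scale c p = coeffwise λ i → begin
  coeff (deriv (scale c p)) i                      ≡⟨ coeff-deriv (scale c p) i ⟩
  ℕtoℚ (suc i) ℚ.* coeff (scale c p) (suc i)       ≡⟨ cong (ℕtoℚ (suc i) ℚ.*_) (coeff-scale c p (suc i)) ⟩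
  ℕtoℚ (suc i) ℚ.* (c ℚ.* coeff p (suc i))         ≡⟨ ℚSolver.solve 3 (λ a b c → a ℚSolver.:* (b ℚSolver.:* c) ℚSolver.:= b ℚSolver.:* (a ℚSolver.:* c)) ≡.refl (ℕtoℚ (suc i)) c (coeff p (suc i)) ⟩
  c ℚ.* (ℕtoℚ (suc i) ℚ.* coeff p (suc i))         ≡⟨ cong (c ℚ.*_) (coeff-deriv p i) ⟨
  c ℚ.* coeff (deriv p) i                          ≡⟨ coeff-scale c (deriv p) i ⟨
  coeff (scale c (deriv p)) i                      ∎
  where open ≡-Reasoning

deriv-∷ : ∀ a p → deriv (a ∷ p) ≋ p ⊕ (0ℚ ∷ deriv p)
deriv-∷ a p = coeffwise λ i → ≡.trans (coeff-deriv (a ∷ p) i) (≡.trans (lemma i) (≡.sym (coeff-⊕ p (0ℚ ∷ deriv p) i)))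
  where
  open ≡-Reasoning
  lemma : ∀ i → ℕtoℚ (suc i) ℚ.* coeff p i ≡ coeff p i ℚ.+ coeff (0ℚ ∷ deriv p) i
  lemma zero    = ≡.trans (ℚₚ.*-identityˡ (coeff p 0)) (≡.sym (ℚₚ.+-identityʳ (coeff p 0)))
  lemma (suc i) = begin
    ℕtoℚ (suc (suc i)) ℚ.* coeff p (suc i)                           ≡⟨ cong (ℚ._* coeff p (suc i)) (ℕtoℚ-suc (suc i)) ⟩
    (1ℚ ℚ.+ ℕtoℚ (suc i)) ℚ.* coeff p (suc i)                        ≡⟨ ℚₚ.*-distribʳ-+ (coeff p (suc i)) 1ℚ (ℕtoℚ (suc i)) ⟩
    1ℚ ℚ.* coeff p (suc i) ℚ.+ ℕtoℚ (suc i) ℚ.* coeff p (suc i)      ≡⟨ cong₂ ℚ._+_ (ℚₚ.*-identityˡ (coeff p (suc i))) (≡.sym (coeff-deriv p i)) ⟩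
    coeff p (suc i) ℚ.+ coeff (deriv p) i                            ∎

deriv-⊗ : ∀ p q → deriv (p ⊗ q) ≋ deriv p ⊗ q ⊕ p ⊗ deriv q
deriv-⊗ []      q = ≋-refl
deriv-⊗ (a ∷ p) q = begin
  deriv (scale a q ⊕ (0ℚ ∷ p ⊗ q))
    ≈⟨ deriv-⊕ (scale a q) (0ℚ ∷ p ⊗ q) ⟩
  deriv (scale a q) ⊕ deriv (0ℚ ∷ p ⊗ q)
    ≈⟨ ⊕-cong (deriv-scale a q) (≋-trans (deriv-∷ 0ℚ (p ⊗ q)) (⊕-cong (≋-refl {p ⊗ q}) (≋-trans (∷-cong ≡.refl (deriv-⊗ p q)) (shift-⊕ (deriv p ⊗ q) (p ⊗ deriv q))))) ⟩
  scale a (deriv q) ⊕ (p ⊗ q ⊕ ((0ℚ ∷ deriv p ⊗ q) ⊕ (0ℚ ∷ p ⊗ deriv q)))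
    ≈⟨ 𝒫.solve 4 (λ u x y v → u 𝒫.:+ (x 𝒫.:+ (y 𝒫.:+ v)) 𝒫.:= (x 𝒫.:+ y) 𝒫.:+ (u 𝒫.:+ v)) ≋-refl (scale a (deriv q)) (p ⊗ q) (0ℚ ∷ deriv p ⊗ q) (0ℚ ∷ p ⊗ deriv q) ⟩
  (p ⊗ q ⊕ (0ℚ ∷ deriv p ⊗ q)) ⊕ (a ∷ p) ⊗ deriv q
    ≈⟨ ⊕-cong (⊕-cong (≋-refl {p ⊗ q}) (≋-sym (shift-⊗ (deriv p) q))) ≋-refl ⟩
  (p ⊗ q ⊕ (0ℚ ∷ deriv p) ⊗ q) ⊕ (a ∷ p) ⊗ deriv q
    ≈⟨ ⊕-cong (⊗-distribʳ q p (0ℚ ∷ deriv p)) (≋-refl {(a ∷ p) ⊗ deriv q}) ⟨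
  (p ⊕ (0ℚ ∷ deriv p)) ⊗ q ⊕ (a ∷ p) ⊗ deriv q
    ≈⟨ ⊕-cong (⊗-cong (deriv-∷ a p) (≋-refl {q})) (≋-refl {(a ∷ p) ⊗ deriv q}) ⟨
  deriv (a ∷ p) ⊗ q ⊕ (a ∷ p) ⊗ deriv q ∎
  where
  open SetoidReasoning (CommutativeRing.setoid polynomialRing)
  module 𝒫 = RingSolver polynomialRing

-- The case P = z^k of T(zP) = ∫₀¹ P + z T(P), a recursion which the reversed list conceals.
Tmono-suc : ∀ k → Tmono (suc k) ≡ (+ 1 ℚ./ suc k) ∷ Tmono k
Tmono-suc k = begin
  reverse (map f (upTo (suc k)))             ≡⟨ cong (λ l → reverse (map f l)) (Listₚ.upTo-∷ʳ k) ⟨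
  reverse (map f (upTo k ∷ʳ k))    ≡⟨ cong reverse (Listₚ.map-++ f (upTo k) (k ∷ [])) ⟩
  reverse (map f (upTo k) ∷ʳ f k)  ≡⟨ Listₚ.reverse-++ (map f (upTo k)) (f k ∷ []) ⟩
  f k ∷ reverse (map f (upTo k))             ∎
  where
  open ≡-Reasoning
  f : ℕ → ℚ
  f i = + 1 ℚ./ suc i

𝒫 : CommutativeRing 0ℓ 0ℓ
𝒫 = polynomialRing

deriv-zP : deriv zP ≋ oneP
deriv-zP = coeffwise λ { zero → ≡.refl ; (suc i) → ≡.refl }

derivation : Derivation 𝒫
derivation = record { ∂ = deriv ; ∂-cong = deriv-cong ; ∂-+ = deriv-⊕ ; ∂-* = deriv-⊗ }

module 𝒟 = DifferentialRing 𝒫 derivation zP deriv-zP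

-- The Euler operator z d/dz on z^k p, with the factor z^k omitted from the result.
θ : ℕ → Poly → Poly
θ k []      = []
θ k (a ∷ p) = (ℕtoℚ k ℚ.* a) ∷ θ (suc k) p

coeff-θ : ∀ k p i → coeff (θ k p) i ≡ ℕtoℚ (k ℕ.+ i) ℚ.* coeff p i
coeff-θ k []      i       = ≡.sym (ℚₚ.*-zeroʳ (ℕtoℚ (k ℕ.+ i)))
coeff-θ k (a ∷ p) zero    = cong (λ j → ℕtoℚ j ℚ.* a) (≡.sym (ℕₚ.+-identityʳ k))
coeff-θ k (a ∷ p) (suc i) = ≡.trans (coeff-θ (suc k) p i) (cong (λ j → ℕtoℚ j ℚ.* coeff p i) (≡.sym (ℕₚ.+-suc k i)))

zP-⊗ : ∀ p → zP ⊗ p ≋ 0ℚ ∷ p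
zP-⊗ p = ≋-trans (shift-⊗ (1ℚ ∷ []) p) (∷-cong ≡.refl (⊗-identityˡ p))

S≋θ : ∀ p → 𝒟.S p ≋ θ 0 (p ⊕ (⊖ (0ℚ ∷ p)))
S≋θ p = begin
  zP ⊗ deriv (𝒟.w ⊗ p)                ≈⟨ zP-⊗ _ ⟩
  0ℚ ∷ deriv (𝒟.w ⊗ p)                ≈⟨ ∷-cong ≡.refl (deriv-cong w⊗) ⟩
  0ℚ ∷ deriv q                        ≈⟨ coeffwise (λ { zero → ≡.sym (≡.trans (coeff-θ 0 q 0) (ℚₚ.*-zeroˡ (coeff q 0)))
                                                      ; (suc i) → ≡.trans (coeff-deriv q i) (≡.sym (coeff-θ 0 q (suc i))) }) ⟩
  θ 0 q                               ∎
  where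
  open SetoidReasoning (CommutativeRing.setoid 𝒫)
  module 𝒫Solver = RingSolver 𝒫
  q = p ⊕ (⊖ (0ℚ ∷ p))
  w⊗ : 𝒟.w ⊗ p ≋ q
  w⊗ = begin
    (oneP ⊕ ⊖ zP) ⊗ p      ≈⟨ 𝒫Solver.solve 3 (λ i z p → (i 𝒫Solver.:+ 𝒫Solver.:- z) 𝒫Solver.:* p 𝒫Solver.:= i 𝒫Solver.:* p 𝒫Solver.:+ 𝒫Solver.:- (z 𝒫Solver.:* p)) ≋-refl oneP zP p ⟩
    oneP ⊗ p ⊕ ⊖ (zP ⊗ p)  ≈⟨ ⊕-cong (⊗-identityˡ p) (⊖-cong (zP-⊗ p)) ⟩
    q                      ∎

-- The transform to signed binomial coefficients

record ℚ-Algebra (K : CommutativeRing 0ℓ 0ℓ) : Set where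
  open CommutativeRing K
  field
    ι   : ℚ → Carrier
    ι-+ : ∀ a b → ι (a ℚ.+ b) ≈ ι a + ι b
    ι-* : ∀ a b → ι (a ℚ.* b) ≈ ι a * ι b
    ι-1 : ι 1ℚ ≈ 1#

-- The transform sends z^k to (-1)^k C(σ , k); abstract K covers both jets and rational numbers.
module Transform
  (K : CommutativeRing 0ℓ 0ℓ) (A : ℚ-Algebra K)
  (σ : CommutativeRing.Carrier K)
  where
  open CommutativeRing K hiding (zero)
  open ℚ-Algebra A
  open RingProperties ring using (x+x≈x⇒x≈0; -0#≈0#)
  open RingSolver K
  open SetoidReasoning setoid

  ι-≡ : ∀ {a b} → a ≡ b → ι a ≈ ι b
  ι-≡ e = reflexive (cong ι e)

  ι-0 : ι 0ℚ ≈ 0#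
  ι-0 = x+x≈x⇒x≈0 (ι 0ℚ) (trans (sym (ι-+ 0ℚ 0ℚ)) (ι-≡ (ℚₚ.+-identityˡ 0ℚ)))

  nat : ℕ → Carrier
  nat k = ι (ℕtoℚ k)

  nat-suc : ∀ k → nat (suc k) ≈ 1# + nat k
  nat-suc k = trans (ι-≡ (ℕtoℚ-suc k)) (trans (ι-+ 1ℚ (ℕtoℚ k)) (+-congʳ ι-1))

  nat-+ : ∀ m n → nat (m ℕ.+ n) ≈ nat m + nat n
  nat-+ m n = trans (ι-≡ (ℕtoℚ-+ m n)) (ι-+ _ _)

  nat-* : ∀ m n → nat (m ℕ.* n) ≈ nat m * nat n
  nat-* m n = trans (ι-≡ (ℕtoℚ-* m n)) (ι-* _ _)

  inverse : ℕ → Carrier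
  inverse k = ι (+ 1 ℚ./ suc k)

  nat*inverse : ∀ k → nat (suc k) * inverse k ≈ 1#
  nat*inverse k = trans (sym (ι-* _ _)) (trans (ι-≡ (reciprocal (suc k))) ι-1)

  basis : ℕ → Carrier
  basis zero    = 1#
  basis (suc k) = inverse k * ((nat k - σ) * basis k)

  basis-suc : ∀ k → nat (suc k) * basis (suc k) ≈ (nat k - σ) * basis k
  basis-suc k = trans (sym (*-assoc _ _ _)) (trans (*-congʳ (nat*inverse k)) (*-identityˡ _))

  -- The offset `k` stands for a factor z^k, so that inductions can run along the coefficient list.
  transform-from : ℕ → Poly → Carrier
  transform-from k []      = 0#
  transform-from k (a ∷ p) = ι a * basis k + transform-from (suc k) p

  transform : Poly → Carrier
  transform = transform-from 0

  transform-≋[] : ∀ k {p} → p ≋ [] → transform-from k p ≈ 0#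
  transform-≋[] k {[]}    e = refl
  transform-≋[] k {a ∷ p} e = trans
    (+-cong (trans (*-congʳ (trans (ι-≡ (head-≋[] e)) ι-0)) (zeroˡ _)) (transform-≋[] (suc k) (tail-≋[] e)))
    (+-identityˡ 0#)

  transform-cong : ∀ k {p q} → p ≋ q → transform-from k p ≈ transform-from k q
  transform-cong k {[]}    {q}     e = sym (transform-≋[] k (≋-sym e))
  transform-cong k {a ∷ p} {[]}    e = transform-≋[] k e
  transform-cong k {a ∷ p} {b ∷ q} e = +-cong (*-congʳ (ι-≡ (head-≋ e))) (transform-cong (suc k) (tail-≋ e))

  transform-⊕ : ∀ k p q → transform-from k (p ⊕ q) ≈ transform-from k p + transform-from k q
  transform-⊕ k []      q       = sym (+-identityˡ _)
  transform-⊕ k (a ∷ p) []      = sym (+-identityʳ _)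
  transform-⊕ k (a ∷ p) (b ∷ q) = trans (+-cong (*-congʳ (ι-+ a b)) (transform-⊕ (suc k) p q))
    (solve 5 (λ a b x u v → (a :+ b) :* x :+ (u :+ v) := (a :* x :+ u) :+ (b :* x :+ v)) refl (ι a) (ι b) (basis k) _ _)

  transform-scale : ∀ k c p → transform-from k (scale c p) ≈ ι c * transform-from k p
  transform-scale k c []      = sym (zeroʳ _)
  transform-scale k c (a ∷ p) = trans (+-cong (*-congʳ (ι-* c a)) (transform-scale (suc k) c p))
    (solve 4 (λ c a x u → c :* a :* x :+ c :* u := c :* (a :* x :+ u)) refl (ι c) (ι a) (basis k) _)

  transform-⊖ : ∀ k p → transform-from k (⊖ p) ≈ - transform-from k p
  transform-⊖ k p = begin
    transform-from k (⊖ p)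
      ≈⟨ solve 2 (λ u v → u := (v :+ u) :- v) refl _ (transform-from k p) ⟩
    (transform-from k p + transform-from k (⊖ p)) - transform-from k p
      ≈⟨ +-congʳ (trans (sym (transform-⊕ k p (⊖ p))) (transform-≋[] k (⊖-inverseʳ p))) ⟩
    0# - transform-from k p
      ≈⟨ +-identityˡ _ ⟩
    - transform-from k p ∎

  -- `S` sends z^k to k z^k - (k+1) z^(k+1), whose transform is k b_k - (k - σ) b_k = σ b_k. This
  -- eigenvalue equation is what dictates the recursion of `basis`.
  transform-θ : ∀ k p → transform-from k (θ k p) - transform-from (suc k) (θ (suc k) p) ≈ σ * transform-from k p
  transform-θ k []      = trans (-‿inverseʳ 0#) (sym (zeroʳ σ))
  transform-θ k (a ∷ p) = begin
    (ι (ℕtoℚ k ℚ.* a) * basis k + u) - (ι (ℕtoℚ (suc k) ℚ.* a) * basis (suc k) + v)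
      ≈⟨ +-cong (+-congʳ (*-congʳ (ι-* _ a))) (-‿cong (+-congʳ (*-congʳ (ι-* _ a)))) ⟩
    (nat k * ι a * basis k + u) - (nat (suc k) * ι a * basis (suc k) + v)
      ≈⟨ solve 7 (λ n m a x y u v → (n :* a :* x :+ u) :- (m :* a :* y :+ v) := a :* (n :* x :- m :* y) :+ (u :- v)) refl (nat k) (nat (suc k)) (ι a) (basis k) (basis (suc k)) u v ⟩
    ι a * (nat k * basis k - nat (suc k) * basis (suc k)) + (u - v)
      ≈⟨ +-cong (*-congˡ (+-congˡ (-‿cong (basis-suc k)))) (transform-θ (suc k) p) ⟩
    ι a * (nat k * basis k - (nat k - σ) * basis k) + σ * transform-from (suc k) p
      ≈⟨ solve 5 (λ a n x σ t → a :* (n :* x :- (n :- σ) :* x) :+ σ :* t := σ :* (a :* x :+ t)) refl (ι a) (nat k) (basis k) σ _ ⟩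
    σ * (ι a * basis k + transform-from (suc k) p) ∎
    where
    u = transform-from (suc k) (θ (suc k) p)
    v = transform-from (suc (suc k)) (θ (suc (suc k)) p)

  transform-S : ∀ p → transform (𝒟.S p) ≈ σ * transform p
  transform-S p = begin
    transform (𝒟.S p)
      ≈⟨ transform-cong 0 (≋-trans (S≋θ p) split) ⟩
    transform (θ 0 p ⊕ (⊖ (θ 0 (0ℚ ∷ p))))
      ≈⟨ trans (transform-⊕ 0 (θ 0 p) _) (+-congˡ (transform-⊖ 0 (θ 0 (0ℚ ∷ p)))) ⟩
    transform (θ 0 p) - (ι (0ℚ ℚ.* 0ℚ) * 1# + transform-from 1 (θ 1 p))
      ≈⟨ +-congˡ (-‿cong (trans (+-congʳ (trans (*-congʳ ι-0) (zeroˡ 1#))) (+-identityˡ _))) ⟩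
    transform (θ 0 p) - transform-from 1 (θ 1 p)
      ≈⟨ transform-θ 0 p ⟩
    σ * transform p ∎
    where
    split : θ 0 (p ⊕ (⊖ (0ℚ ∷ p))) ≋ θ 0 p ⊕ (⊖ (θ 0 (0ℚ ∷ p)))
    split = coeffwise λ i → ≡.trans (coeff-θ 0 (p ⊕ (⊖ (0ℚ ∷ p))) i)
      (≡.trans (cong (ℕtoℚ i ℚ.*_) (≡.trans (coeff-⊕ p _ i) (cong (coeff p i ℚ.+_) (coeff-⊖ (0ℚ ∷ p) i))))
      (≡.trans (ℚSolver.solve 3 (λ n a b → n ℚSolver.:* (a ℚSolver.:+ ℚSolver.:- b) ℚSolver.:= n ℚSolver.:* a ℚSolver.:+ ℚSolver.:- (n ℚSolver.:* b)) ≡.refl (ℕtoℚ i) (coeff p i) (coeff (0ℚ ∷ p) i))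
      (≡.sym (≡.trans (coeff-⊕ (θ 0 p) _ i) (cong₂ ℚ._+_ (coeff-θ 0 p i) (≡.trans (coeff-⊖ (θ 0 (0ℚ ∷ p)) i) (cong ℚ.-_ (coeff-θ 0 (0ℚ ∷ p) i))))))))

  -- rising p * falling q = (p + q)! C(σ + p , p + q)
  rising : ℕ → Carrier
  rising zero    = 1#
  rising (suc a) = rising a * (σ + nat (suc a))

  falling : ℕ → Carrier
  falling zero    = 1#
  falling (suc b) = falling b * (σ - nat b)

  𝒟nat≋ : ∀ k → 𝒟.nat k ≋ const (ℕtoℚ k)
  𝒟nat≋ zero    = ≋-sym (∷-≋[] ≡.refl ≋-refl)
  𝒟nat≋ (suc k) = ≋-trans (⊕-cong (≋-refl {oneP}) (𝒟nat≋ k)) (∷-cong (≡.sym (ℕtoℚ-suc k)) ≋-refl)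

  transform-nat⊗ : ∀ k p → transform (𝒟.nat k ⊗ p) ≈ nat k * transform p
  transform-nat⊗ k p = trans (transform-cong 0 (≋-trans (⊗-cong (𝒟nat≋ k) (≋-refl {p})) (const-⊗ (ℕtoℚ k) p))) (transform-scale 0 (ℕtoℚ k) p)

  transform-step-q : ∀ q p → transform (𝒟.step 0 q p) ≈ falling q * transform p
  transform-step-q zero    p = trans (transform-cong 0 (𝒟.step-00 p)) (sym (*-identityˡ _))
  transform-step-q (suc q) p = begin
    transform (𝒟.step 0 (suc q) p)
      ≈⟨ transform-cong 0 (𝒟.step-suc-q q p) ⟩
    transform (𝒟.step 0 q (𝒟.S p ⊕ (⊖ (𝒟.nat q ⊗ p))))
      ≈⟨ transform-step-q q _ ⟩
    falling q * transform (𝒟.S p ⊕ (⊖ (𝒟.nat q ⊗ p)))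
      ≈⟨ *-congˡ (trans (transform-⊕ 0 (𝒟.S p) _) (+-cong (transform-S p) (trans (transform-⊖ 0 (𝒟.nat q ⊗ p)) (-‿cong (transform-nat⊗ q p))))) ⟩
    falling q * (σ * transform p - nat q * transform p)
      ≈⟨ solve 4 (λ f s n t → f :* (s :* t :- n :* t) := f :* (s :- n) :* t) refl (falling q) σ (nat q) (transform p) ⟩
    falling q * (σ - nat q) * transform p ∎

  transform-step : ∀ p q f → transform (𝒟.step p q f) ≈ rising p * falling q * transform f
  transform-step zero    q f = trans (transform-step-q q f) (*-congʳ (sym (*-identityˡ _)))
  transform-step (suc p) q f = begin
    transform (𝒟.step (suc p) q f)
      ≈⟨ transform-cong 0 (𝒟.step-suc-p p q f) ⟩
    transform (𝒟.step p q (𝒟.S f ⊕ 𝒟.nat (suc p) ⊗ f))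
      ≈⟨ transform-step p q _ ⟩
    rising p * falling q * transform (𝒟.S f ⊕ 𝒟.nat (suc p) ⊗ f)
      ≈⟨ *-congˡ (trans (transform-⊕ 0 (𝒟.S f) _) (+-cong (transform-S f) (transform-nat⊗ (suc p) f))) ⟩
    rising p * falling q * (σ * transform f + nat (suc p) * transform f)
      ≈⟨ solve 5 (λ r f s n t → r :* f :* (s :* t :+ n :* t) := r :* (s :+ n) :* f :* t) refl (rising p) (falling q) σ (nat (suc p)) (transform f) ⟩
    rising p * (σ + nat (suc p)) * falling q * transform f ∎

  module Differentiation
    (D : Derivation K)
    (δ-ι : ∀ a → Derivation.∂ D (ι a) ≈ 0#)
    (δ-σ : Derivation.∂ D σ ≈ 1#)
    where
    open Derivation D using () renaming (∂ to δ; ∂-cong to δ-cong; ∂-+ to δ-+; ∂-* to δ-*; ∂0 to δ-0; ∂-neg to δ-neg)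

    δ-ι* : ∀ a x → δ (ι a * x) ≈ ι a * δ x
    δ-ι* a x = trans (δ-* (ι a) x) (trans (+-congʳ (trans (*-congʳ (δ-ι a)) (zeroˡ x))) (+-identityˡ _))

    δ-basis-suc : ∀ k → nat (suc k) * - δ (basis (suc k)) ≈ (nat k - σ) * - δ (basis k) + basis k
    δ-basis-suc k = begin
      nat (suc k) * - δ (basis (suc k))
        ≈⟨ solve 2 (λ n x → n :* :- x := :- (n :* x)) refl _ _ ⟩
      - (nat (suc k) * δ (basis (suc k)))
        ≈⟨ -‿cong (sym (δ-ι* _ _)) ⟩
      - δ (nat (suc k) * basis (suc k))
        ≈⟨ -‿cong (trans (δ-cong (basis-suc k)) (δ-* _ _)) ⟩
      - (δ (nat k - σ) * basis k + (nat k - σ) * δ (basis k))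
        ≈⟨ -‿cong (+-congʳ (*-congʳ (trans (δ-+ _ _) (+-cong (δ-ι _) (trans (δ-neg σ) (-‿cong δ-σ)))))) ⟩
      - ((0# + - 1#) * basis k + (nat k - σ) * δ (basis k))
        ≈⟨ -‿cong (+-congʳ (*-congʳ (trans (+-identityˡ _) (-‿cong (sym (+-identityʳ 1#)))))) ⟩
      - (ℤcast K -[1+ 0 ] * basis k + (nat k - σ) * δ (basis k))
        ≈⟨ solve 3 (λ b n d → :- (con -[1+ 0 ] :* b :+ n :* d) := n :* :- d :+ b) refl (basis k) (nat k - σ) (δ (basis k)) ⟩
      (nat k - σ) * - δ (basis k) + basis k ∎

    private
      tmono : ℕ → ℕ → Carrier
      tmono j k = transform-from j (Tmono k)

      tmono-suc : ∀ j k → tmono j (suc k) ≈ inverse k * basis j + tmono (suc j) k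
      tmono-suc j k = reflexive (cong (transform-from j) (Tmono-suc k))

    -- At `j` = 0 this yields for T(z^k) the recursion that `δ-basis-suc` gives for -δ b_k. General
    -- `j` is forced by the induction on `k`, since `Tmono-suc` raises the offset.
    tmono-shift : ∀ j k → nat (suc (j ℕ.+ k)) * tmono (suc j) k + basis j ≈ (nat (j ℕ.+ k) - σ) * tmono j k + basis (j ℕ.+ k)
    tmono-shift j zero rewrite ℕₚ.+-identityʳ j = +-congʳ (trans (zeroʳ _) (sym (zeroʳ _)))
    tmono-shift j (suc k) rewrite ℕₚ.+-suc j k = begin
      nat (suc (suc n)) * tmono (suc j) (suc k) + basis j
        ≈⟨ +-congʳ (*-congˡ (tmono-suc (suc j) k)) ⟩
      nat (suc (suc n)) * (inverse k * basis (suc j) + tmono (suc (suc j)) k) + basis j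
        ≈⟨ solve 5 (λ m i y u x → m :* (i :* y :+ u) :+ x := (m :* u :+ y) :+ (i :* (m :* y) :+ (x :- y))) refl (nat (suc (suc n))) (inverse k) (basis (suc j)) (tmono (suc (suc j)) k) (basis j) ⟩
      (nat (suc (suc n)) * tmono (suc (suc j)) k + basis (suc j)) + (inverse k * (nat (suc (suc n)) * basis (suc j)) + (basis j - basis (suc j)))
        ≈⟨ +-cong (tmono-shift (suc j) k) balance ⟩
      ((nat (suc n) - σ) * tmono (suc j) k + basis (suc n)) + (nat (suc n) - σ) * (inverse k * basis j)
        ≈⟨ solve 5 (λ m u b i x → (m :* u :+ b) :+ m :* (i :* x) := m :* (i :* x :+ u) :+ b) refl (nat (suc n) - σ) (tmono (suc j) k) (basis (suc n)) (inverse k) (basis j) ⟩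
      (nat (suc n) - σ) * (inverse k * basis j + tmono (suc j) k) + basis (suc n)
        ≈⟨ +-congʳ (*-congˡ (tmono-suc j k)) ⟨
      (nat (suc n) - σ) * tmono j (suc k) + basis (suc n) ∎
      where
      n = j ℕ.+ k
      nat-n : nat (suc n) ≈ nat j + nat (suc k)
      nat-n = trans (ι-≡ (cong ℕtoℚ (≡.sym (ℕₚ.+-suc j k)))) (nat-+ j (suc k))
      -- Multiplied by k + 1 this is (j + 1) b_{j+1} = (j - σ) b_j.
      balance : inverse k * (nat (suc (suc n)) * basis (suc j)) + (basis j - basis (suc j)) ≈ (nat (suc n) - σ) * (inverse k * basis j)
      balance = begin
        inverse k * (nat (suc (suc n)) * basis (suc j)) + (basis j - basis (suc j))
          ≈⟨ +-congʳ (*-congˡ (*-congʳ (trans (nat-suc (suc n)) (trans (+-congˡ nat-n) (trans (sym (+-assoc _ _ _)) (+-congʳ (sym (nat-suc j)))))))) ⟩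
        inverse k * ((nat (suc j) + nat (suc k)) * basis (suc j)) + (basis j - basis (suc j))
          ≈⟨ solve 5 (λ i a m y x → i :* ((a :+ m) :* y) :+ (x :- y) := i :* (a :* y) :+ (m :* i :* y :- y) :+ x) refl (inverse k) (nat (suc j)) (nat (suc k)) (basis (suc j)) (basis j) ⟩
        inverse k * (nat (suc j) * basis (suc j)) + (nat (suc k) * inverse k * basis (suc j) - basis (suc j)) + basis j
          ≈⟨ +-cong (+-cong (*-congˡ (basis-suc j)) (trans (+-congʳ (trans (*-congʳ (nat*inverse k)) (*-identityˡ _))) (-‿inverseʳ _))) (trans (sym (*-identityˡ _)) (*-congʳ (sym (nat*inverse k)))) ⟩
        inverse k * ((nat j - σ) * basis j) + 0# + nat (suc k) * inverse k * basis j
          ≈⟨ solve 5 (λ i a s x m → i :* ((a :- s) :* x) :+ con (+ 0) :+ m :* i :* x := ((a :+ m) :- s) :* (i :* x)) refl (inverse k) (nat j) σ (basis j) (nat (suc k)) ⟩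
        ((nat j + nat (suc k)) - σ) * (inverse k * basis j)
          ≈⟨ *-congʳ (+-congʳ nat-n) ⟨
        (nat (suc n) - σ) * (inverse k * basis j) ∎

    -- Both sides vanish at `k` = 0 and satisfy the same first-order recursion, whose leading
    -- coefficient `nat (suc k)` is invertible.
    transform-Tmono : ∀ k → transform (Tmono k) ≈ - δ (basis k)
    transform-Tmono zero = sym (trans (-‿cong (trans (δ-cong (sym ι-1)) (δ-ι 1ℚ))) -0#≈0#)
    transform-Tmono (suc k) = cancel-nat k (begin
      nat (suc k) * tmono 0 (suc k)
        ≈⟨ *-congˡ (tmono-suc 0 k) ⟩
      nat (suc k) * (inverse k * 1# + tmono 1 k)
        ≈⟨ solve 4 (λ n i u one → n :* (i :* one :+ u) := n :* i :* one :+ n :* u) refl (nat (suc k)) (inverse k) (tmono 1 k) 1# ⟩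
      nat (suc k) * inverse k * 1# + nat (suc k) * tmono 1 k
        ≈⟨ trans (+-congʳ (trans (*-identityʳ _) (nat*inverse k))) (+-comm _ _) ⟩
      nat (suc k) * tmono 1 k + 1#
        ≈⟨ tmono-shift 0 k ⟩
      (nat k - σ) * tmono 0 k + basis k
        ≈⟨ +-congʳ (*-congˡ (transform-Tmono k)) ⟩
      (nat k - σ) * - δ (basis k) + basis k
        ≈⟨ δ-basis-suc k ⟨
      nat (suc k) * - δ (basis (suc k)) ∎)
      where
      cancel-nat : ∀ k {x y} → nat (suc k) * x ≈ nat (suc k) * y → x ≈ y
      cancel-nat k {x} {y} e = begin
        x                              ≈⟨ trans (*-congʳ (nat*inverse k)) (*-identityˡ x) ⟨
        nat (suc k) * inverse k * x    ≈⟨ solve 3 (λ n i x → n :* i :* x := i :* (n :* x)) refl (nat (suc k)) (inverse k) x ⟩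
        inverse k * (nat (suc k) * x)  ≈⟨ *-congˡ e ⟩
        inverse k * (nat (suc k) * y)  ≈⟨ solve 3 (λ n i x → i :* (n :* x) := n :* i :* x) refl (nat (suc k)) (inverse k) y ⟩
        nat (suc k) * inverse k * y    ≈⟨ trans (*-congʳ (nat*inverse k)) (*-identityˡ y) ⟩
        y                              ∎

    transform-T-from : ∀ k p → transform (T-from k p) ≈ - δ (transform-from k p)
    transform-T-from k []      = sym (trans (-‿cong δ-0) -0#≈0#)
    transform-T-from k (a ∷ p) = begin
      transform (scaleP a (Tmono k) +P T-from (suc k) p)
        ≡⟨ cong transform (+P≡⊕ (scaleP a (Tmono k)) _) ⟩
      transform (scale a (Tmono k) ⊕ T-from (suc k) p)
        ≈⟨ trans (transform-⊕ 0 (scale a (Tmono k)) _) (+-cong (transform-scale 0 a (Tmono k)) (transform-T-from (suc k) p)) ⟩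
      ι a * transform (Tmono k) + - δ (transform-from (suc k) p)
        ≈⟨ +-congʳ (*-congˡ (transform-Tmono k)) ⟩
      ι a * - δ (basis k) + - δ (transform-from (suc k) p)
        ≈⟨ solve 3 (λ a x y → a :* :- x :+ :- y := :- (a :* x :+ y)) refl _ _ _ ⟩
      - (ι a * δ (basis k) + δ (transform-from (suc k) p))
        ≈⟨ -‿cong (trans (δ-+ _ _) (+-congʳ (δ-ι* a (basis k)))) ⟨
      - δ (ι a * basis k + transform-from (suc k) p) ∎

    transform-T : ∀ p → transform (T p) ≈ - δ (transform p)
    transform-T = transform-T-from 0

-- The transform of multiple Legendre polynomials

open Exponentiation (CommutativeRing.semiring 𝒫) using () renaming (_^_ to infixr 8 _⊗^_)

^P≋^ : ∀ p {p′} k → p ≋ p′ → p ^P k ≋ p′ ⊗^ k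
^P≋^ p      zero    e = ≋-refl
^P≋^ p {p′} (suc k) e = ≋-trans (CommutativeRing.reflexive 𝒫 (*P≡⊗ p (p ^P k))) (⊗-cong e (^P≋^ p k e))

1-zP≋w : 1-zP ≋ 𝒟.w
1-zP≋w = coeffwise λ { zero → ≡.refl ; (suc zero) → ≡.refl ; (suc (suc i)) → ≡.refl }

inverse! : ℕ → ℚ
inverse! k = ℚ._/_ (+ 1) (k !) {{k !≢0}}

legendreStep≋step : ∀ L p q → legendreStep L (p , q) ≋ scale (inverse! (p ℕ.+ q)) (𝒟.step p q L)
legendreStep≋step L p q = begin
  (zP ^P q) *P (1-zP ^P p) *P D k (zP ^P p *P 1-zP ^P q *P L)
    ≡⟨ ≡.trans (*P≡⊗ ((zP ^P q) *P (1-zP ^P p)) _) (cong₂ _⊗_ (*P≡⊗ (zP ^P q) (1-zP ^P p)) (cong (scale (inverse! k)) (≡.trans (iterate≡fold k deriv _) (cong (𝒟.∂^ k)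
         (≡.trans (*P≡⊗ (zP ^P p *P 1-zP ^P q) L) (cong (_⊗ L) (*P≡⊗ (zP ^P p) (1-zP ^P q)))))))) ⟩
  (zP ^P q) ⊗ (1-zP ^P p) ⊗ scale (inverse! k) (𝒟.∂^ k (zP ^P p ⊗ 1-zP ^P q ⊗ L))
    ≈⟨ ⊗-cong (⊗-cong (^P≋^ zP q ≋-refl) (^P≋^ 1-zP p 1-zP≋w))
         (scale-cong (≡.refl {x = inverse! k}) (𝒟.∂^-cong k (⊗-cong (⊗-cong (^P≋^ zP p ≋-refl) (^P≋^ 1-zP q 1-zP≋w)) (≋-refl {L})))) ⟩
  zP ⊗^ q ⊗ 𝒟.w ⊗^ p ⊗ scale (inverse! k) (𝒟.∂^ k (𝒟.weight p q ⊗ L))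
    ≈⟨ ≋-trans (⊗-comm v (scale (inverse! k) u)) (≋-trans (scale-⊗ (inverse! k) u v) (scale-cong (≡.refl {x = inverse! k}) (⊗-comm u v))) ⟩
  scale (inverse! k) (𝒟.step p q L) ∎
  where
  open SetoidReasoning (CommutativeRing.setoid 𝒫)
  k = p ℕ.+ q
  u = 𝒟.∂^ k (𝒟.weight p q ⊗ L)
  v = zP ⊗^ q ⊗ 𝒟.w ⊗^ p

factorials : List (ℕ × ℕ) → ℕ
factorials []             = 1
factorials ((p , q) ∷ ps) = (p ℕ.+ q) ! ℕ.* factorials ps

module TransformLegendre
  (K : CommutativeRing 0ℓ 0ℓ) (A : ℚ-Algebra K)
  (σ : CommutativeRing.Carrier K)
  where
  open CommutativeRing K hiding (zero)
  open ℚ-Algebra A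
  open Transform K A σ
  open RingSolver K
  open SetoidReasoning setoid

  -- The hypergeometric term without its denominators: division by `factorials` gives the product of
  -- the C(σ + p , p + q).
  binomials : List (ℕ × ℕ) → Carrier
  binomials []             = 1#
  binomials ((p , q) ∷ ps) = rising p * falling q * binomials ps

  transform-legendreStep : ∀ L p q → nat ((p ℕ.+ q) !) * transform (legendreStep L (p , q)) ≈ rising p * falling q * transform L
  transform-legendreStep L p q = begin
    nat (k !) * transform (legendreStep L (p , q))
      ≈⟨ *-congˡ (trans (transform-cong 0 (legendreStep≋step L p q)) (transform-scale 0 (inverse! k) (𝒟.step p q L))) ⟩
    nat (k !) * (ι (inverse! k) * transform (𝒟.step p q L))
      ≈⟨ trans (sym (*-assoc _ _ _)) (*-congʳ (trans (sym (ι-* _ _)) (trans (ι-≡ (reciprocal (k !) {{k !≢0}})) ι-1))) ⟩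
    1# * transform (𝒟.step p q L)
      ≈⟨ trans (*-identityˡ _) (transform-step p q L) ⟩
    rising p * falling q * transform L ∎
    where k = p ℕ.+ q

  transform-foldl : ∀ ps L → nat (factorials ps) * transform (foldl legendreStep L ps) ≈ binomials ps * transform L
  transform-foldl []             L = *-congʳ ι-1
  transform-foldl ((p , q) ∷ ps) L = begin
    nat ((p ℕ.+ q) ! ℕ.* factorials ps) * transform (foldl legendreStep L′ ps)
      ≈⟨ *-congʳ (nat-* ((p ℕ.+ q) !) (factorials ps)) ⟩
    nat ((p ℕ.+ q) !) * nat (factorials ps) * transform (foldl legendreStep L′ ps)
      ≈⟨ trans (*-assoc _ _ _) (*-congˡ (transform-foldl ps L′)) ⟩
    nat ((p ℕ.+ q) !) * (binomials ps * transform L′)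
      ≈⟨ solve 3 (λ n b t → n :* (b :* t) := b :* (n :* t)) refl _ (binomials ps) (transform L′) ⟩
    binomials ps * (nat ((p ℕ.+ q) !) * transform L′)
      ≈⟨ *-congˡ (transform-legendreStep L p q) ⟩
    binomials ps * (rising p * falling q * transform L)
      ≈⟨ solve 3 (λ b r t → b :* (r :* t) := r :* b :* t) refl (binomials ps) (rising p * falling q) (transform L) ⟩
    rising p * falling q * binomials ps * transform L ∎
    where L′ = legendreStep L (p , q)

  transform-multiLegendre : ∀ ps → nat (factorials ps) * transform (multiLegendre ps) ≈ binomials ps
  transform-multiLegendre ps = trans (transform-foldl ps oneP)
    (trans (*-congˡ (trans (+-identityʳ _) (trans (*-identityʳ _) ι-1))) (*-identityʳ _))

-- Values at natural numbers and jets

rationals : ℚ-Algebra ℚring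
rationals = record { ι = λ a → a ; ι-+ = λ _ _ → ≡.refl ; ι-* = λ _ _ → ≡.refl ; ι-1 = ≡.refl }

module At (s : ℕ) = Transform ℚring rationals (ℕtoℚ s)

valueAt : Poly → ℕ → ℚ
valueAt p s = At.transform s p

nat-cancel : ∀ k {a b} → ℕtoℚ (suc k) ℚ.* a ≡ ℕtoℚ (suc k) ℚ.* b → a ≡ b
nat-cancel k {a} {b} e = begin
  a                                              ≡⟨ expand a ⟩
  (+ 1 ℚ./ suc k) ℚ.* (ℕtoℚ (suc k) ℚ.* a)      ≡⟨ cong ((+ 1 ℚ./ suc k) ℚ.*_) e ⟩
  (+ 1 ℚ./ suc k) ℚ.* (ℕtoℚ (suc k) ℚ.* b)      ≡⟨ expand b ⟨
  b                                              ∎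
  where
  open ≡-Reasoning
  expand : ∀ x → x ≡ (+ 1 ℚ./ suc k) ℚ.* (ℕtoℚ (suc k) ℚ.* x)
  expand x = ≡.trans (≡.sym (ℚₚ.*-identityˡ x)) (≡.trans (cong (ℚ._* x) (≡.trans (≡.sym (reciprocal (suc k))) (ℚₚ.*-comm (ℕtoℚ (suc k)) (+ 1 ℚ./ suc k)))) (ℚₚ.*-assoc (+ 1 ℚ./ suc k) (ℕtoℚ (suc k)) x))

basis-at-0 : ∀ k → At.basis 0 (suc k) ≡ 0ℚ
basis-at-0 k = nat-cancel k (≡.trans (At.basis-suc 0 k) (≡.trans (lemma k) (≡.sym (ℚₚ.*-zeroʳ (ℕtoℚ (suc k))))))
  where
  lemma : ∀ k → (ℕtoℚ k ℚ.- ℕtoℚ 0) ℚ.* At.basis 0 k ≡ 0ℚ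
  lemma zero    = ≡.refl
  lemma (suc k) = ≡.trans (cong ((ℕtoℚ (suc k) ℚ.- ℕtoℚ 0) ℚ.*_) (basis-at-0 k)) (ℚₚ.*-zeroʳ (ℕtoℚ (suc k) ℚ.- ℕtoℚ 0))

-- Pascal's rule with alternating signs. The recursion of `basis` varies `k` at fixed `s`, hence the
-- induction on `k` with `suc k` cancelled at each stage.
pascal : ∀ k s → At.basis (suc s) (suc k) ≡ At.basis s (suc k) ℚ.- At.basis s k
pascal zero s = nat-cancel 0 (begin
  ℕtoℚ 1 ℚ.* At.basis (suc s) 1            ≡⟨ At.basis-suc (suc s) 0 ⟩
  (ℕtoℚ 0 ℚ.- ℕtoℚ (suc s)) ℚ.* 1ℚ         ≡⟨ cong (λ a → (ℕtoℚ 0 ℚ.- a) ℚ.* 1ℚ) (ℕtoℚ-suc s) ⟩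
  (ℕtoℚ 0 ℚ.- (1ℚ ℚ.+ ℕtoℚ s)) ℚ.* 1ℚ      ≡⟨ solve 3 (λ z o s → (z :- (o :+ s)) :* o := (z :- s) :* o :- o :* o) ≡.refl (ℕtoℚ 0) 1ℚ (ℕtoℚ s) ⟩
  (ℕtoℚ 0 ℚ.- ℕtoℚ s) ℚ.* 1ℚ ℚ.- 1ℚ        ≡⟨ cong (ℚ._- 1ℚ) (At.basis-suc s 0) ⟨
  ℕtoℚ 1 ℚ.* At.basis s 1 ℚ.- 1ℚ ℚ.* 1ℚ    ≡⟨ solve 3 (λ n b o → n :* b :- n :* o := n :* (b :- o)) ≡.refl (ℕtoℚ 1) (At.basis s 1) 1ℚ ⟩
  ℕtoℚ 1 ℚ.* (At.basis s 1 ℚ.- 1ℚ)         ∎)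
  where
  open ≡-Reasoning
  open ℚSolver
pascal (suc k) s = nat-cancel (suc k) (begin
  ℕtoℚ (suc (suc k)) ℚ.* At.basis (suc s) (suc (suc k))
    ≡⟨ At.basis-suc (suc s) (suc k) ⟩
  (ℕtoℚ (suc k) ℚ.- ℕtoℚ (suc s)) ℚ.* At.basis (suc s) (suc k)
    ≡⟨ cong₂ ℚ._*_ (cong₂ ℚ._-_ (ℕtoℚ-suc k) (ℕtoℚ-suc s)) (pascal k s) ⟩
  ((1ℚ ℚ.+ ℕtoℚ k) ℚ.- (1ℚ ℚ.+ ℕtoℚ s)) ℚ.* (b ℚ.- a)
    ≡⟨ solve 5 (λ o k s a b → ((o :+ k) :- (o :+ s)) :* (b :- a) := (k :- s) :* b :- (k :- s) :* a) ≡.refl 1ℚ (ℕtoℚ k) (ℕtoℚ s) a b ⟩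
  (ℕtoℚ k ℚ.- ℕtoℚ s) ℚ.* b ℚ.- (ℕtoℚ k ℚ.- ℕtoℚ s) ℚ.* a
    ≡⟨ cong (λ x → (ℕtoℚ k ℚ.- ℕtoℚ s) ℚ.* b ℚ.- x) (At.basis-suc s k) ⟨
  (ℕtoℚ k ℚ.- ℕtoℚ s) ℚ.* b ℚ.- ℕtoℚ (suc k) ℚ.* b
    ≡⟨ solve 5 (λ o k s b n → (k :- s) :* b :- n :* b := ((k :+ o) :- s) :* b :- (o :+ n) :* b) ≡.refl 1ℚ (ℕtoℚ k) (ℕtoℚ s) b (ℕtoℚ (suc k)) ⟩
  ((ℕtoℚ k ℚ.+ 1ℚ) ℚ.- ℕtoℚ s) ℚ.* b ℚ.- (1ℚ ℚ.+ ℕtoℚ (suc k)) ℚ.* b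
    ≡⟨ cong₂ ℚ._-_ (cong (λ x → (x ℚ.- ℕtoℚ s) ℚ.* b) (≡.trans (ℚₚ.+-comm (ℕtoℚ k) 1ℚ) (≡.sym (ℕtoℚ-suc k)))) (cong (ℚ._* b) (≡.sym (ℕtoℚ-suc (suc k)))) ⟩
  (ℕtoℚ (suc k) ℚ.- ℕtoℚ s) ℚ.* b ℚ.- ℕtoℚ (suc (suc k)) ℚ.* b
    ≡⟨ cong (ℚ._- (ℕtoℚ (suc (suc k)) ℚ.* b)) (At.basis-suc s (suc k)) ⟨
  ℕtoℚ (suc (suc k)) ℚ.* At.basis s (suc (suc k)) ℚ.- ℕtoℚ (suc (suc k)) ℚ.* b
    ≡⟨ solve 3 (λ n x b → n :* x :- n :* b := n :* (x :- b)) ≡.refl (ℕtoℚ (suc (suc k))) (At.basis s (suc (suc k))) b ⟩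
  ℕtoℚ (suc (suc k)) ℚ.* (At.basis s (suc (suc k)) ℚ.- b) ∎)
  where
  open ≡-Reasoning
  open ℚSolver
  a = At.basis s k
  b = At.basis s (suc k)

transform-from-at-0 : ∀ k p → At.transform-from 0 (suc k) p ≡ 0ℚ
transform-from-at-0 k []      = ≡.refl
transform-from-at-0 k (a ∷ p) = ≡.trans
  (cong₂ ℚ._+_ (≡.trans (cong (a ℚ.*_) (basis-at-0 k)) (ℚₚ.*-zeroʳ a)) (transform-from-at-0 (suc k) p)) (ℚₚ.+-identityˡ 0ℚ)

transform-from-difference : ∀ k p s → At.transform-from (suc s) (suc k) p ≡ At.transform-from s (suc k) p ℚ.- At.transform-from s k p
transform-from-difference k []      s = ≡.refl
transform-from-difference k (a ∷ p) s = ≡.trans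
  (cong₂ ℚ._+_ (cong (a ℚ.*_) (pascal k s)) (transform-from-difference (suc k) p s))
  (solve 5 (λ a x y u v → a :* (x :- y) :+ (u :- v) := (a :* x :+ u) :- (a :* y :+ v)) ≡.refl a (At.basis s (suc k)) (At.basis s k) (At.transform-from s (suc (suc k)) p) (At.transform-from s (suc k) p))
  where open ℚSolver

negatedSum : (ℕ → ℚ) → ℕ → ℚ
negatedSum f zero    = 0ℚ
negatedSum f (suc s) = negatedSum f s ℚ.- f s

-- By `pascal`, the forward difference of b_(k+1) is -b_k, and b_(k+1) vanishes at 0; so z acts as
-- the negated antidifference with initial value 0.
valueAt-shift : ∀ p s → valueAt (0ℚ ∷ p) s ≡ negatedSum (valueAt p) s
valueAt-shift p s = ≡.trans (drop s) (lemma s)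
  where
  drop : ∀ s → valueAt (0ℚ ∷ p) s ≡ At.transform-from s 1 p
  drop s = ≡.trans (cong (ℚ._+ At.transform-from s 1 p) (ℚₚ.*-zeroˡ 1ℚ)) (ℚₚ.+-identityˡ _)
  lemma : ∀ s → At.transform-from s 1 p ≡ negatedSum (valueAt p) s
  lemma zero    = transform-from-at-0 0 p
  lemma (suc s) = ≡.trans (transform-from-difference 0 p s) (cong (ℚ._- valueAt p s) (lemma s))

-- The value at 0 is the constant coefficient; if it vanishes, differences of consecutive values
-- return the values of the tail, and the coefficients are read off one by one.
valueAt-injective : ∀ p → (∀ s → valueAt p s ≡ 0ℚ) → IsZeroP p
valueAt-injective []      e = []
valueAt-injective (a ∷ p) e = a≡0 ∷ valueAt-injective p λ s → begin
  valueAt p s                                                      ≡⟨ solve 2 (λ x y → y := x :- (x :- y)) ≡.refl (At.transform-from s 1 p) (valueAt p s) ⟩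
  At.transform-from s 1 p ℚ.- (At.transform-from s 1 p ℚ.- valueAt p s) ≡⟨ cong₂ ℚ._-_ (tail≡0 s) (≡.trans (≡.sym (transform-from-difference 0 p s)) (tail≡0 (suc s))) ⟩
  0ℚ ℚ.- 0ℚ                                                        ≡⟨⟩
  0ℚ                                                               ∎
  where
  open ≡-Reasoning
  open ℚSolver
  a≡0 : a ≡ 0ℚ
  a≡0 = begin
    a                                         ≡⟨ ≡.trans (cong₂ ℚ._+_ (ℚₚ.*-identityʳ a) (transform-from-at-0 0 p)) (ℚₚ.+-identityʳ a) ⟨
    a ℚ.* 1ℚ ℚ.+ At.transform-from 0 1 p      ≡⟨ e 0 ⟩
    0ℚ                                        ∎
  tail≡0 : ∀ s → At.transform-from s 1 p ≡ 0ℚ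
  tail≡0 s = begin
    At.transform-from s 1 p                        ≡⟨ ℚₚ.+-identityˡ _ ⟨
    0ℚ ℚ.+ At.transform-from s 1 p                 ≡⟨ cong (ℚ._+ At.transform-from s 1 p) (≡.trans (cong (ℚ._* 1ℚ) a≡0) (ℚₚ.*-zeroˡ 1ℚ)) ⟨
    a ℚ.* 1ℚ ℚ.+ At.transform-from s 1 p           ≡⟨ e s ⟩
    0ℚ                                             ∎

-- The point s + ε of ℚ[ε]: powers of ε record the derivatives in s.
jet : ℕ → Poly
jet s = ℕtoℚ s ∷ 1ℚ ∷ []

const-* : ∀ a b → const (a ℚ.* b) ≋ const a ⊗ const b
const-* a b = ≋-sym (const-⊗ a (const b))

jets : ℚ-Algebra 𝒫
jets = record { ι = const ; ι-+ = λ _ _ → ≋-refl ; ι-* = const-* ; ι-1 = ≋-refl }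

module Jet (s : ℕ) = Transform 𝒫 jets (jet s)

deriv-const : ∀ a → deriv (const a) ≋ []
deriv-const a = ≋-refl

deriv-jet : ∀ s → deriv (jet s) ≋ oneP
deriv-jet s = coeffwise λ { zero → ≡.refl ; (suc i) → ≡.refl }

module JetDerivation (s : ℕ) = Jet.Differentiation s derivation deriv-const (deriv-jet s)

coeff₀-⊗ : ∀ p q → coeff (p ⊗ q) 0 ≡ coeff p 0 ℚ.* coeff q 0
coeff₀-⊗ []      q       = ≡.sym (ℚₚ.*-zeroˡ (coeff q 0))
coeff₀-⊗ (a ∷ p) []      = ≡.sym (ℚₚ.*-zeroʳ a)
coeff₀-⊗ (a ∷ p) (b ∷ q) = ℚₚ.+-identityʳ (a ℚ.* b)

coeff₀-basis : ∀ s k → coeff (Jet.basis s k) 0 ≡ At.basis s k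
coeff₀-basis s zero    = ≡.refl
coeff₀-basis s (suc k) = begin
  coeff (const c ⊗ ((const (ℕtoℚ k) ⊕ ⊖ jet s) ⊗ Jet.basis s k)) 0
    ≡⟨ coeff₀-⊗ (const c) ((const (ℕtoℚ k) ⊕ ⊖ jet s) ⊗ Jet.basis s k) ⟩
  c ℚ.* coeff ((const (ℕtoℚ k) ⊕ ⊖ jet s) ⊗ Jet.basis s k) 0
    ≡⟨ cong (c ℚ.*_) (coeff₀-⊗ (const (ℕtoℚ k) ⊕ ⊖ jet s) (Jet.basis s k)) ⟩
  c ℚ.* ((ℕtoℚ k ℚ.- ℕtoℚ s) ℚ.* coeff (Jet.basis s k) 0)
    ≡⟨ cong (λ x → c ℚ.* ((ℕtoℚ k ℚ.- ℕtoℚ s) ℚ.* x)) (coeff₀-basis s k) ⟩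
  c ℚ.* ((ℕtoℚ k ℚ.- ℕtoℚ s) ℚ.* At.basis s k) ∎
  where
  open ≡-Reasoning
  c = + 1 ℚ./ suc k

coeff₀-transform : ∀ s k p → coeff (Jet.transform-from s k p) 0 ≡ At.transform-from s k p
coeff₀-transform s k []      = ≡.refl
coeff₀-transform s k (a ∷ p) = ≡.trans (coeff-⊕ (const a ⊗ Jet.basis s k) _ 0)
  (cong₂ ℚ._+_ (≡.trans (coeff₀-⊗ (const a) (Jet.basis s k)) (cong (a ℚ.*_) (coeff₀-basis s k))) (coeff₀-transform s (suc k) p))

-- (-∂)^m multiplies the coefficient of ε^(m+i) by (-1)^m (i+1) ⋯ (i+m).
derivativeFactor : ℕ → ℕ → ℚ
derivativeFactor zero    i = 1ℚ
derivativeFactor (suc m) i = ℚ.- (ℕtoℚ (suc i) ℚ.* derivativeFactor m (suc i))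

coeff-transform-Tpow : ∀ s m p i → coeff (Jet.transform s (Tpow m p)) i ≡ derivativeFactor m i ℚ.* coeff (Jet.transform s p) (m ℕ.+ i)
coeff-transform-Tpow s zero    p i = ≡.sym (ℚₚ.*-identityˡ _)
coeff-transform-Tpow s (suc m) p i = begin
  coeff (Jet.transform s (T (Tpow m p))) i
    ≡⟨ at (JetDerivation.transform-T s (Tpow m p)) i ⟩
  coeff (⊖ (deriv x)) i
    ≡⟨ ≡.trans (coeff-⊖ (deriv x) i) (cong ℚ.-_ (coeff-deriv x i)) ⟩
  ℚ.- (ℕtoℚ (suc i) ℚ.* coeff x (suc i))
    ≡⟨ cong (λ y → ℚ.- (ℕtoℚ (suc i) ℚ.* y)) (coeff-transform-Tpow s m p (suc i)) ⟩
  ℚ.- (ℕtoℚ (suc i) ℚ.* (derivativeFactor m (suc i) ℚ.* coeff (Jet.transform s p) (m ℕ.+ suc i)))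
    ≡⟨ solve 3 (λ n d c → :- (n :* (d :* c)) := :- (n :* d) :* c) ≡.refl (ℕtoℚ (suc i)) (derivativeFactor m (suc i)) (coeff (Jet.transform s p) (m ℕ.+ suc i)) ⟩
  ℚ.- (ℕtoℚ (suc i) ℚ.* derivativeFactor m (suc i)) ℚ.* coeff (Jet.transform s p) (m ℕ.+ suc i)
    ≡⟨ cong (λ j → ℚ.- (ℕtoℚ (suc i) ℚ.* derivativeFactor m (suc i)) ℚ.* coeff (Jet.transform s p) j) (ℕₚ.+-suc m i) ⟩
  derivativeFactor (suc m) i ℚ.* coeff (Jet.transform s p) (suc m ℕ.+ i) ∎
  where
  open ≡-Reasoning
  open ℚSolver
  x = Jet.transform s (Tpow m p)

valueAt-Tpow : ∀ m p s → valueAt (Tpow m p) s ≡ derivativeFactor m 0 ℚ.* coeff (Jet.transform s p) m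
valueAt-Tpow m p s = ≡.trans (≡.sym (coeff₀-transform s 0 (Tpow m p)))
  (≡.trans (coeff-transform-Tpow s m p 0) (cong (λ j → derivativeFactor m 0 ℚ.* coeff (Jet.transform s p) j) (ℕₚ.+-identityʳ m)))

-- Quotients of factorials as polynomials in t

scaleAll : ℕ → List (ℕ × ℕ) → List (ℕ × ℕ)
scaleAll t = map (λ { (p , q) → p ℕ.* t , q ℕ.* t })

length-scaleAll : ∀ t qs → length (scaleAll t qs) ≡ length qs
length-scaleAll t []       = ≡.refl
length-scaleAll t (_ ∷ qs) = cong suc (length-scaleAll t qs)

-- The quotient (kt + a + b)! / (kt + a)! as a product of factors linear in t, which places it in
-- ℤ[t].
factorialRatio : ℕ → ℕ → ℕ → ℕ → ℕ
factorialRatio k a zero    t = 1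
factorialRatio k a (suc b) t = (k ℕ.* t ℕ.+ suc (a ℕ.+ b)) ℕ.* factorialRatio k a b t

factorialRatio-correct : ∀ k a b t → (k ℕ.* t ℕ.+ (a ℕ.+ b)) ! ≡ factorialRatio k a b t ℕ.* (k ℕ.* t ℕ.+ a) !
factorialRatio-correct k a zero    t = ≡.trans (cong (λ x → (k ℕ.* t ℕ.+ x) !) (ℕₚ.+-identityʳ a)) (≡.sym (ℕₚ.+-identityʳ _))
factorialRatio-correct k a (suc b) t = begin
  (k ℕ.* t ℕ.+ (a ℕ.+ suc b)) !
    ≡⟨ cong _! (≡.trans (cong (k ℕ.* t ℕ.+_) (ℕₚ.+-suc a b)) (ℕₚ.+-suc (k ℕ.* t) (a ℕ.+ b))) ⟩
  suc (k ℕ.* t ℕ.+ (a ℕ.+ b)) ℕ.* (k ℕ.* t ℕ.+ (a ℕ.+ b)) !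
    ≡⟨ cong₂ ℕ._*_ (≡.sym (ℕₚ.+-suc (k ℕ.* t) (a ℕ.+ b))) (factorialRatio-correct k a b t) ⟩
  (k ℕ.* t ℕ.+ suc (a ℕ.+ b)) ℕ.* (factorialRatio k a b t ℕ.* (k ℕ.* t ℕ.+ a) !)
    ≡⟨ ℕₚ.*-assoc (k ℕ.* t ℕ.+ suc (a ℕ.+ b)) (factorialRatio k a b t) _ ⟨
  (k ℕ.* t ℕ.+ suc (a ℕ.+ b)) ℕ.* factorialRatio k a b t ℕ.* (k ℕ.* t ℕ.+ a) ! ∎
  where open ≡-Reasoning

factorialsRatio : ℕ → ℕ → List (ℕ × ℕ) → ℕ → ℕ
factorialsRatio l r []             t = 1
factorialsRatio l r ((p , q) ∷ qs) t = factorialRatio (p ℕ.+ q) ((p ℕ.+ q) ℕ.* l) ((p ℕ.+ q) ℕ.* r) t ℕ.* factorialsRatio l r qs t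

factorialsRatio-correct : ∀ l r qs t →
  factorials (scaleAll (t ℕ.+ (l ℕ.+ r)) qs) ≡ factorialsRatio l r qs t ℕ.* factorials (scaleAll (t ℕ.+ l) qs)
factorialsRatio-correct l r []             t = ≡.refl
factorialsRatio-correct l r ((p , q) ∷ qs) t = begin
  (p ℕ.* (t ℕ.+ (l ℕ.+ r)) ℕ.+ q ℕ.* (t ℕ.+ (l ℕ.+ r))) ! ℕ.* factorials (scaleAll (t ℕ.+ (l ℕ.+ r)) qs)
    ≡⟨ cong₂ (λ a b → a ! ℕ.* b) distribute (factorialsRatio-correct l r qs t) ⟩
  (k ℕ.* t ℕ.+ (k ℕ.* l ℕ.+ k ℕ.* r)) ! ℕ.* (ν ℕ.* F)
    ≡⟨ cong (ℕ._* (ν ℕ.* F)) (factorialRatio-correct k (k ℕ.* l) (k ℕ.* r) t) ⟩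
  factorialRatio k (k ℕ.* l) (k ℕ.* r) t ℕ.* (k ℕ.* t ℕ.+ k ℕ.* l) ! ℕ.* (ν ℕ.* F)
    ≡⟨ cong (λ a → factorialRatio k (k ℕ.* l) (k ℕ.* r) t ℕ.* a ! ℕ.* (ν ℕ.* F)) (≡.trans (≡.sym (ℕₚ.*-distribˡ-+ k t l)) (ℕₚ.*-distribʳ-+ (t ℕ.+ l) p q)) ⟩
  factorialRatio k (k ℕ.* l) (k ℕ.* r) t ℕ.* (p ℕ.* (t ℕ.+ l) ℕ.+ q ℕ.* (t ℕ.+ l)) ! ℕ.* (ν ℕ.* F)
    ≡⟨ ℕₚ.[m*n]*[o*p]≡[m*o]*[n*p] (factorialRatio k (k ℕ.* l) (k ℕ.* r) t) _ ν F ⟩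
  factorialRatio k (k ℕ.* l) (k ℕ.* r) t ℕ.* ν ℕ.* ((p ℕ.* (t ℕ.+ l) ℕ.+ q ℕ.* (t ℕ.+ l)) ! ℕ.* F) ∎
  where
  open ≡-Reasoning
  k = p ℕ.+ q
  ν = factorialsRatio l r qs t
  F = factorials (scaleAll (t ℕ.+ l) qs)
  distribute : p ℕ.* (t ℕ.+ (l ℕ.+ r)) ℕ.+ q ℕ.* (t ℕ.+ (l ℕ.+ r)) ≡ k ℕ.* t ℕ.+ (k ℕ.* l ℕ.+ k ℕ.* r)
  distribute = ≡.trans (≡.sym (ℕₚ.*-distribʳ-+ (t ℕ.+ (l ℕ.+ r)) p q))
    (≡.trans (ℕₚ.*-distribˡ-+ k t (l ℕ.+ r)) (cong (k ℕ.* t ℕ.+_) (ℕₚ.*-distribˡ-+ k l r)))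

-- Hypergeometric term ratios and spans over ℤ[t]

module Shifts
  (K : CommutativeRing 0ℓ 0ℓ) (A : ℚ-Algebra K)
  (σ : ℕ → CommutativeRing.Carrier K)
  (σ-suc : ∀ s → CommutativeRing._≈_ K (σ (suc s)) (CommutativeRing._+_ K (CommutativeRing.1# K) (σ s)))
  where
  open CommutativeRing K hiding (zero)
  open ℚ-Algebra A
  open Exponentiation semiring using (_^_)
  open RingSolver K
  open SetoidReasoning setoid
  open RingProperties ring using (-0#≈0#)

  module J (s : ℕ) = Transform K A (σ s)
  module JL (s : ℕ) = TransformLegendre K A (σ s)

  nat : ℕ → Carrier
  nat k = ι (ℕtoℚ k)

  nat-suc : ∀ k → nat (suc k) ≈ 1# + nat k
  nat-suc = J.nat-suc 0

  nat-0 : nat 0 ≈ 0#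
  nat-0 = J.ι-0 0

  σ+nat-0 : ∀ s → σ s + nat 0 ≈ σ s
  σ+nat-0 s = trans (+-congˡ nat-0) (+-identityʳ _)

  σ-nat-0 : ∀ s → σ s - nat 0 ≈ σ s
  σ-nat-0 s = trans (+-congˡ (trans (-‿cong nat-0) -0#≈0#)) (+-identityʳ _)

  σ-suc-+ : ∀ s k → σ (suc s) + nat k ≈ σ s + nat (suc k)
  σ-suc-+ s k = begin
    σ (suc s) + nat k       ≈⟨ +-congʳ (σ-suc s) ⟩
    1# + σ s + nat k        ≈⟨ solve 3 (λ i s k → i :+ s :+ k := s :+ (i :+ k)) refl 1# (σ s) (nat k) ⟩
    σ s + (1# + nat k)      ≈⟨ +-congˡ (nat-suc k) ⟨
    σ s + nat (suc k)       ∎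

  σ-suc-- : ∀ s k → σ (suc s) - nat (suc k) ≈ σ s - nat k
  σ-suc-- s k = begin
    σ (suc s) - nat (suc k)     ≈⟨ +-cong (σ-suc s) (-‿cong (nat-suc k)) ⟩
    1# + σ s - (1# + nat k)     ≈⟨ solve 3 (λ i s k → i :+ s :- (i :+ k) := s :- k) refl 1# (σ s) (nat k) ⟩
    σ s - nat k                 ∎

  rising-shift : ∀ s a → J.rising (suc s) a * σ (suc s) ≈ (σ s + nat (suc a)) * J.rising s a
  rising-shift s zero = begin
    1# * σ (suc s)         ≈⟨ *-comm 1# (σ (suc s)) ⟩
    σ (suc s) * 1#         ≈⟨ *-congʳ (trans (sym (σ+nat-0 (suc s))) (σ-suc-+ s 0)) ⟩
    (σ s + nat 1) * 1#     ∎
  rising-shift s (suc a) = begin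
    J.rising (suc s) a * (σ (suc s) + nat (suc a)) * σ (suc s)
      ≈⟨ solve 3 (λ r c x → r :* c :* x := r :* x :* c) refl (J.rising (suc s) a) _ (σ (suc s)) ⟩
    J.rising (suc s) a * σ (suc s) * (σ (suc s) + nat (suc a))
      ≈⟨ *-cong (rising-shift s a) (σ-suc-+ s (suc a)) ⟩
    (σ s + nat (suc a)) * J.rising s a * (σ s + nat (suc (suc a)))
      ≈⟨ solve 3 (λ c r x → c :* r :* x := x :* (r :* c)) refl _ (J.rising s a) _ ⟩
    (σ s + nat (suc (suc a))) * (J.rising s a * (σ s + nat (suc a))) ∎

  falling-shift : ∀ s b → J.falling (suc s) b * (σ (suc s) - nat b) ≈ σ (suc s) * J.falling s b
  falling-shift s zero    = trans (*-comm _ _) (*-congʳ (σ-nat-0 (suc s)))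
  falling-shift s (suc b) = begin
    J.falling (suc s) b * (σ (suc s) - nat b) * (σ (suc s) - nat (suc b))
      ≈⟨ *-cong (falling-shift s b) (σ-suc-- s b) ⟩
    σ (suc s) * J.falling s b * (σ s - nat b)
      ≈⟨ *-assoc _ _ _ ⟩
    σ (suc s) * (J.falling s b * (σ s - nat b)) ∎

  falling-divisible : ∀ s b → ∃ λ u → J.falling s (suc b) ≈ σ s * u
  falling-divisible s zero = 1# , trans (*-comm _ _) (*-congʳ (σ-nat-0 s))
  falling-divisible s (suc b) with u , e ← falling-divisible s b = u * (σ s - nat (suc b)) , trans (*-congʳ e) (*-assoc _ _ _)

  -- The two factors of the hypergeometric term ratio: binomials (σ + 1) / binomials σ = upper σ / lower (σ + 1).
  upper lower : ℕ → List (ℕ × ℕ) → Carrier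
  upper s []             = 1#
  upper s ((p , q) ∷ ps) = (σ s + nat (suc p)) * upper s ps
  lower s []             = 1#
  lower s ((p , q) ∷ ps) = (σ s - nat q) * lower s ps

  binomials : ℕ → List (ℕ × ℕ) → Carrier
  binomials s = JL.binomials s

  -- The term ratio is cross-multiplied, as there is no division in `K`: the factor `σ (suc s)`
  -- released by `falling-shift` is the one that `rising-shift` absorbs.
  binomials-shift : ∀ s ps → lower (suc s) ps * binomials (suc s) ps ≈ upper s ps * binomials s ps
  binomials-shift s []             = refl
  binomials-shift s ((p , q) ∷ ps) = begin
    (l * lower (suc s) ps) * (r′ * f′ * binomials (suc s) ps)
      ≈⟨ solve 5 (λ l L r f B → (l :* L) :* (r :* f :* B) := r :* (f :* l) :* (L :* B)) refl l (lower (suc s) ps) r′ f′ (binomials (suc s) ps) ⟩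
    r′ * (f′ * l) * (lower (suc s) ps * binomials (suc s) ps)
      ≈⟨ *-cong (*-congˡ (falling-shift s q)) (binomials-shift s ps) ⟩
    r′ * (σ (suc s) * f) * (upper s ps * binomials s ps)
      ≈⟨ solve 4 (λ r x f Q → r :* (x :* f) :* Q := r :* x :* f :* Q) refl r′ (σ (suc s)) f (upper s ps * binomials s ps) ⟩
    r′ * σ (suc s) * f * (upper s ps * binomials s ps)
      ≈⟨ *-cong (*-cong (rising-shift s p) refl) refl ⟩
    u * r * f * (upper s ps * binomials s ps)
      ≈⟨ solve 5 (λ u r f U B → u :* r :* f :* (U :* B) := (u :* U) :* (r :* f :* B)) refl u r f (upper s ps) (binomials s ps) ⟩
    (u * upper s ps) * (r * f * binomials s ps) ∎
    where
    l  = σ (suc s) - nat q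
    u  = σ s + nat (suc p)
    r′ = J.rising (suc s) p
    f′ = J.falling (suc s) q
    r  = J.rising s p
    f  = J.falling s q

  -- The factor σ - q from `lower` extends `falling q` to `falling (suc q)`, which contains the
  -- factor σ even for q = 0. Each pair thus contributes one order of vanishing at s = 0.
  binomials-divisible : ∀ s ps → ∃ λ u → lower s ps * binomials s ps ≈ σ s ^ length ps * u
  binomials-divisible s []             = 1# , refl
  binomials-divisible s ((p , q) ∷ ps) with u , e ← binomials-divisible s ps | v , e′ ← falling-divisible s q =
    v * (r * u) , (begin
      (l * lower s ps) * (r * f * binomials s ps)
        ≈⟨ solve 5 (λ l L r f B → (l :* L) :* (r :* f :* B) := (f :* l) :* (r :* (L :* B))) refl l (lower s ps) r f (binomials s ps) ⟩
      (f * l) * (r * (lower s ps * binomials s ps))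
        ≈⟨ *-cong e′ (*-congˡ e) ⟩
      (σ s * v) * (r * (σ s ^ length ps * u))
        ≈⟨ solve 5 (λ x v r y u → (x :* v) :* (r :* (y :* u)) := (x :* y) :* (v :* (r :* u))) refl (σ s) v r (σ s ^ length ps) u ⟩
      (σ s * σ s ^ length ps) * (v * (r * u)) ∎)
    where
    l  = σ s - nat q
    r  = J.rising s p
    f  = J.falling s q

  -- Indexed by the variable t of the recurrence and the point s.
  Family : Set
  Family = ℕ → ℕ → Carrier

  affine : ℕ → ℕ → ℕ → Carrier
  affine u v t = nat (u ℕ.* t ℕ.+ v)

  module Spans (Φ : Family) where

    -- The span over ℤ[t] of the families σ^j Φ, j < d.
    data Span (d : ℕ) : Family → Set where
      span-gen  : ∀ {j} → j < d → Span d (λ t s → σ s ^ j * Φ t s)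
      span-0    : Span d (λ t s → 0#)
      span-+    : ∀ {x y} → Span d x → Span d y → Span d (λ t s → x t s + y t s)
      span-neg  : ∀ {x} → Span d x → Span d (λ t s → - x t s)
      span-lin  : ∀ {x} u v → Span d x → Span d (λ t s → affine u v t * x t s)
      span-resp : ∀ {x y} → (∀ t s → x t s ≈ y t s) → Span d x → Span d y

    -- Membership of `c` in ℤ[t] is expressed by stability of all spans, so that no representing
    -- polynomial has to be written down.
    record Scalar (c : ℕ → Carrier) : Set where
      constructor scalar
      field preserves : ∀ {d x} → Span d x → Span d (λ t s → c t * x t s)
    open Scalar

    scalar-affine : ∀ u v → Scalar (affine u v)
    scalar-affine u v = scalar (span-lin u v)

    scalar-neg : ∀ {c} → Scalar c → Scalar (λ t → - c t)
    scalar-neg {c} sc = scalar λ {d} {x} S →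
      span-resp (λ t s → solve 2 (λ c x → :- (c :* x) := (:- c) :* x) refl (c t) (x t s)) (span-neg (preserves sc S))

    scalar-one : Scalar (λ t → 1#)
    scalar-one = scalar λ {d} {x} S → span-resp (λ t s → sym (*-identityˡ (x t s))) S

    scalar-* : ∀ {c e} → Scalar c → Scalar e → Scalar (λ t → c t * e t)
    scalar-* {c} {e} sc se = scalar λ {d} {x} S →
      span-resp (λ t s → sym (*-assoc (c t) (e t) (x t s))) (preserves sc (preserves se S))

    scalar-resp : ∀ {c e} → (∀ t → c t ≈ e t) → Scalar c → Scalar e
    scalar-resp eq sc = scalar λ {d} {x} S → span-resp (λ t s → *-congʳ (eq t)) (preserves sc S)

    span-σ : ∀ {d x} → Span d x → Span (suc d) (λ t s → σ s * x t s)
    span-σ (span-gen {j} j<d)          = span-resp (λ t s → *-assoc (σ s) (σ s ^ j) (Φ t s)) (span-gen (s≤s j<d))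
    span-σ span-0                      = span-resp (λ t s → sym (zeroʳ (σ s))) span-0
    span-σ (span-+ {x} {y} Sx Sy)      = span-resp (λ t s → sym (distribˡ (σ s) (x t s) (y t s))) (span-+ (span-σ Sx) (span-σ Sy))
    span-σ (span-neg {x} S)            = span-resp (λ t s → solve 2 (λ c x → :- (c :* x) := c :* (:- x)) refl (σ s) (x t s)) (span-neg (span-σ S))
    span-σ (span-lin {x} u v S)        = span-resp (λ t s → solve 3 (λ c j x → c :* (j :* x) := j :* (c :* x)) refl (affine u v t) (σ s) (x t s)) (span-lin u v (span-σ S))
    span-σ (span-resp e S)             = span-resp (λ t s → *-congˡ (e t s)) (span-σ S)

    span-≤ : ∀ {d d′ x} → d ≤ d′ → Span d x → Span d′ x
    span-≤ le (span-gen j<d)     = span-gen (ℕₚ.≤-trans j<d le)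
    span-≤ le span-0             = span-0
    span-≤ le (span-+ Sx Sy)     = span-+ (span-≤ le Sx) (span-≤ le Sy)
    span-≤ le (span-neg S)       = span-neg (span-≤ le S)
    span-≤ le (span-lin u v S)   = span-lin u v (span-≤ le S)
    span-≤ le (span-resp e S)    = span-resp e (span-≤ le S)

    span-factor : ∀ {c} → Scalar c → ∀ {d x} → Span d x → Span (suc d) (λ t s → (σ s + c t) * x t s)
    span-factor {c} sc {d} {x} S = span-resp (λ t s → sym (distribʳ (x t s) (σ s) (c t)))
      (span-+ (span-σ S) (span-≤ (ℕₚ.n≤1+n d) (preserves sc S)))

    -- With leading coefficient exactly 1, the top term σ^d Φ of two such families is the same and
    -- can be isolated without division.
    record Monic (d : ℕ) (x : Family) : Set where
      field
        rest   : Family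
        rest∈  : Span d rest
        x≈     : ∀ t s → x t s ≈ σ s ^ d * Φ t s + rest t s

    monic-Φ : Monic 0 Φ
    monic-Φ = record
      { rest = λ t s → 0# ; rest∈ = span-0
      ; x≈ = λ t s → sym (trans (+-identityʳ (1# * Φ t s)) (*-identityˡ (Φ t s))) }

    monic-resp : ∀ {d x y} → (∀ t s → x t s ≈ y t s) → Monic d x → Monic d y
    monic-resp e M = record { rest = rest ; rest∈ = rest∈ ; x≈ = λ t s → trans (sym (e t s)) (x≈ t s) }
      where open Monic M

    monic-factor : ∀ {c} → Scalar c → ∀ {d x} → Monic d x → Monic (suc d) (λ t s → (σ s + c t) * x t s)
    monic-factor {c} sc {d} {x} M = record
      { rest  = λ t s → c t * (σ s ^ d * Φ t s) + (σ s + c t) * rest t s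
      ; rest∈ = span-+ (preserves sc (span-gen (ℕₚ.n<1+n d))) (span-factor sc rest∈)
      ; x≈    = λ t s → trans (*-congˡ (x≈ t s))
          (solve 5 (λ j c y f r → (j :+ c) :* (y :* f :+ r) := (j :* y) :* f :+ (c :* (y :* f) :+ (j :+ c) :* r))
            refl (σ s) (c t) (σ s ^ d) (Φ t s) (rest t s))
      }
      where open Monic M

    -- The new bound stays existential, because `generated-n` lowers any bound to the number of
    -- pairs.
    Multiplier : Family → Set
    Multiplier μ = ∀ {d x} → Span d x → ∃ λ d′ → Span d′ (λ t s → μ t s * x t s)

    multiplier-one : Multiplier (λ t s → 1#)
    multiplier-one {d} S = d , preserves scalar-one S

    multiplier-* : ∀ {μ ν} → Multiplier μ → Multiplier ν → Multiplier (λ t s → μ t s * ν t s)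
    multiplier-* {μ} {ν} mμ mν {x = x} S with d , S′ ← mν S with d′ , S″ ← mμ S′ =
      d′ , span-resp (λ t s → sym (*-assoc (μ t s) (ν t s) (x t s))) S″

    multiplier-factor : ∀ {c} → Scalar c → Multiplier (λ t s → σ s + c t)
    multiplier-factor sc {d} S = suc d , span-factor sc S

  module Ratios (ps : List (ℕ × ℕ)) where

    Φ : Family
    Φ t s = binomials s (scaleAll t ps)

    open Spans Φ

    monic-lower : ∀ qs {d x} → Monic d x → Monic (length qs ℕ.+ d) (λ t s → lower s (scaleAll t qs) * x t s)
    monic-lower []             {x = x} M = monic-resp (λ t s → sym (*-identityˡ (x t s))) M
    monic-lower ((p , q) ∷ qs) {x = x} M = monic-resp
      (λ t s → trans (*-cong (+-congˡ (-‿cong (reflexive (cong nat (ℕₚ.+-identityʳ (q ℕ.* t)))))) refl)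
                       (sym (*-assoc (σ s - nat (q ℕ.* t)) (lower s (scaleAll t qs)) (x t s))))
      (monic-factor (scalar-neg (scalar-affine q 0)) (monic-lower qs M))

    monic-upper : ∀ qs {d x} → Monic d x → Monic (length qs ℕ.+ d) (λ t s → upper s (scaleAll t qs) * x t s)
    monic-upper []             {x = x} M = monic-resp (λ t s → sym (*-identityˡ (x t s))) M
    monic-upper ((p , q) ∷ qs) {x = x} M = monic-resp
      (λ t s → trans (*-cong (+-congˡ (reflexive (cong nat (ℕₚ.+-comm (p ℕ.* t) 1)))) refl)
                       (sym (*-assoc (σ s + nat (suc (p ℕ.* t))) (upper s (scaleAll t qs)) (x t s))))
      (monic-factor (scalar-affine p 1) (monic-upper qs M))

    monic-^ : ∀ k → Monic k (λ t s → σ s ^ k * Φ t s)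
    monic-^ zero    = monic-resp (λ t s → sym (*-identityˡ (Φ t s))) monic-Φ
    monic-^ (suc k) = monic-resp (λ t s → trans (*-congʳ (σ+nat-0 s)) (sym (*-assoc (σ s) (σ s ^ k) (Φ t s))))
      (monic-factor (scalar-affine 0 0) (monic-^ k))

    monic-suc^ : ∀ k → Monic k (λ t s → σ (suc s) ^ k * Φ t s)
    monic-suc^ zero    = monic-resp (λ t s → sym (*-identityˡ (Φ t s))) monic-Φ
    monic-suc^ (suc k) = monic-resp
      (λ t s → trans (*-congʳ (trans (sym (σ-suc-+ s 0)) (σ+nat-0 (suc s)))) (sym (*-assoc (σ (suc s)) (σ (suc s) ^ k) (Φ t s))))
      (monic-factor (scalar-affine 0 1) (monic-suc^ k))

    -- z telescoper (s + 1) + (1 - z) telescoper (s) acts as telescoper (0).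
    telescoper : ℕ → Family
    telescoper k t s = lower s (scaleAll t ps) * (σ s ^ k * Φ t s)

    monic-telescoper : ∀ k → Monic (length ps ℕ.+ k) (telescoper k)
    monic-telescoper k = monic-lower ps (monic-^ k)

    -- The factor `lower` is chosen so that `binomials-shift` turns its product with Φ at s + 1 into
    -- `upper` times Φ at s. The shifted telescoper is therefore again a monic multiple of the
    -- unshifted Φ, of the same degree.
    monic-telescoper-suc : ∀ k → Monic (length ps ℕ.+ k) (λ t s → telescoper k t (suc s))
    monic-telescoper-suc k = monic-resp shift (monic-upper ps (monic-suc^ k))
      where
      shift : ∀ t s → upper s (scaleAll t ps) * (σ (suc s) ^ k * Φ t s) ≈ telescoper k t (suc s)
      shift t s = begin
        u * (y * Φ t s)                            ≈⟨ solve 3 (λ u y f → u :* (y :* f) := y :* (u :* f)) refl u y (Φ t s) ⟩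
        y * (u * Φ t s)                            ≈⟨ *-congˡ (binomials-shift s (scaleAll t ps)) ⟨
        y * (l * Φ t (suc s))                      ≈⟨ solve 3 (λ u y f → y :* (u :* f) := u :* (y :* f)) refl l y (Φ t (suc s)) ⟩
        l * (y * Φ t (suc s))                      ∎
        where
        y = σ (suc s) ^ k
        u = upper s (scaleAll t ps)
        l = lower (suc s) (scaleAll t ps)

    telescoper-0 : ∀ k t → ∃ λ u → telescoper k t 0 ≈ σ 0 ^ length ps * u
    telescoper-0 k t with u , e ← binomials-divisible 0 (scaleAll t ps) = y * u , (begin
        l * (y * Φ t 0)                              ≈⟨ solve 3 (λ l y f → l :* (y :* f) := y :* (l :* f)) refl l y (Φ t 0) ⟩
        y * (l * Φ t 0)                              ≈⟨ *-congˡ e ⟩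
        y * (σ 0 ^ length (scaleAll t ps) * u)       ≈⟨ solve 3 (λ y x u → y :* (x :* u) := x :* (y :* u)) refl y _ u ⟩
        σ 0 ^ length (scaleAll t ps) * (y * u)       ≡⟨ cong (λ n → σ 0 ^ n * (y * u)) (length-scaleAll t ps) ⟩
        σ 0 ^ length ps * (y * u)                    ∎)
      where
      y = σ 0 ^ k
      l = lower 0 (scaleAll t ps)

    rising-ratio : ∀ p l → ∃ λ μ → Multiplier μ × (∀ t s → J.rising s (p ℕ.* t ℕ.+ l) ≈ μ t s * J.rising s (p ℕ.* t))
    rising-ratio p zero = (λ t s → 1#) , multiplier-one
      , λ t s → trans (reflexive (cong (J.rising s) (ℕₚ.+-identityʳ (p ℕ.* t)))) (sym (*-identityˡ (J.rising s (p ℕ.* t))))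
    rising-ratio p (suc l) with μ , m , e ← rising-ratio p l =
      (λ t s → (σ s + affine p (suc l) t) * μ t s) , multiplier-* (multiplier-factor (scalar-affine p (suc l))) m
      , λ t s → begin
        J.rising s (p ℕ.* t ℕ.+ suc l)
          ≡⟨ cong (J.rising s) (ℕₚ.+-suc (p ℕ.* t) l) ⟩
        J.rising s (p ℕ.* t ℕ.+ l) * (σ s + nat (suc (p ℕ.* t ℕ.+ l)))
          ≈⟨ *-cong (e t s) (+-congˡ (reflexive (cong nat (≡.sym (ℕₚ.+-suc (p ℕ.* t) l))))) ⟩
        μ t s * J.rising s (p ℕ.* t) * (σ s + affine p (suc l) t)
          ≈⟨ solve 3 (λ m r f → m :* r :* f := f :* m :* r) refl (μ t s) (J.rising s (p ℕ.* t)) (σ s + affine p (suc l) t) ⟩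
        (σ s + affine p (suc l) t) * μ t s * J.rising s (p ℕ.* t) ∎

    falling-ratio : ∀ q l → ∃ λ μ → Multiplier μ × (∀ t s → J.falling s (q ℕ.* t ℕ.+ l) ≈ μ t s * J.falling s (q ℕ.* t))
    falling-ratio q zero = (λ t s → 1#) , multiplier-one
      , λ t s → trans (reflexive (cong (J.falling s) (ℕₚ.+-identityʳ (q ℕ.* t)))) (sym (*-identityˡ (J.falling s (q ℕ.* t))))
    falling-ratio q (suc l) with μ , m , e ← falling-ratio q l =
      (λ t s → (σ s - affine q l t) * μ t s) , multiplier-* (multiplier-factor (scalar-neg (scalar-affine q l))) m
      , λ t s → begin
        J.falling s (q ℕ.* t ℕ.+ suc l)
          ≡⟨ cong (J.falling s) (ℕₚ.+-suc (q ℕ.* t) l) ⟩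
        J.falling s (q ℕ.* t ℕ.+ l) * (σ s - affine q l t)
          ≈⟨ *-cong (e t s) refl ⟩
        μ t s * J.falling s (q ℕ.* t) * (σ s - affine q l t)
          ≈⟨ solve 3 (λ m r f → m :* r :* f := f :* m :* r) refl (μ t s) (J.falling s (q ℕ.* t)) (σ s - affine q l t) ⟩
        (σ s - affine q l t) * μ t s * J.falling s (q ℕ.* t) ∎

    binomials-ratio : ∀ l qs → ∃ λ μ → Multiplier μ × (∀ t s → binomials s (scaleAll (t ℕ.+ l) qs) ≈ μ t s * binomials s (scaleAll t qs))
    binomials-ratio l [] = (λ t s → 1#) , multiplier-one , λ t s → sym (*-identityˡ 1#)
    binomials-ratio l ((p , q) ∷ qs)
      with μ₁ , m₁ , e₁ ← rising-ratio p (p ℕ.* l) | μ₂ , m₂ , e₂ ← falling-ratio q (q ℕ.* l) | μ₃ , m₃ , e₃ ← binomials-ratio l qs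
      = (λ t s → μ₁ t s * μ₂ t s * μ₃ t s) , multiplier-* (multiplier-* m₁ m₂) m₃
      , λ t s → begin
        J.rising s (p ℕ.* (t ℕ.+ l)) * J.falling s (q ℕ.* (t ℕ.+ l)) * binomials s (scaleAll (t ℕ.+ l) qs)
          ≡⟨ cong₂ (λ a b → J.rising s a * J.falling s b * binomials s (scaleAll (t ℕ.+ l) qs)) (ℕₚ.*-distribˡ-+ p t l) (ℕₚ.*-distribˡ-+ q t l) ⟩
        J.rising s (p ℕ.* t ℕ.+ p ℕ.* l) * J.falling s (q ℕ.* t ℕ.+ q ℕ.* l) * binomials s (scaleAll (t ℕ.+ l) qs)
          ≈⟨ *-cong (*-cong (e₁ t s) (e₂ t s)) (e₃ t s) ⟩
        (μ₁ t s * r t s) * (μ₂ t s * f t s) * (μ₃ t s * b t s)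
          ≈⟨ solve 6 (λ m₁ r m₂ f m₃ b → (m₁ :* r) :* (m₂ :* f) :* (m₃ :* b) := m₁ :* m₂ :* m₃ :* (r :* f :* b)) refl (μ₁ t s) (r t s) (μ₂ t s) (f t s) (μ₃ t s) (b t s) ⟩
        μ₁ t s * μ₂ t s * μ₃ t s * (r t s * f t s * b t s) ∎
      where
      r f b : Family
      r t s = J.rising s (p ℕ.* t)
      f t s = J.falling s (q ℕ.* t)
      b t s = binomials s (scaleAll t qs)

    scalar-nat-* : ∀ (f g : ℕ → ℕ) → Scalar (λ t → nat (f t)) → Scalar (λ t → nat (g t)) → Scalar (λ t → nat (f t ℕ.* g t))
    scalar-nat-* f g sf sg = scalar-resp {λ t → nat (f t) * nat (g t)} {λ t → nat (f t ℕ.* g t)} (λ t → sym (J.nat-* 0 (f t) (g t))) (scalar-* sf sg)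

    scalar-factorialRatio : ∀ k a b → Scalar (λ t → nat (factorialRatio k a b t))
    scalar-factorialRatio k a zero    = scalar-resp (λ t → sym ι-1) scalar-one
    scalar-factorialRatio k a (suc b) = scalar-nat-* (λ t → k ℕ.* t ℕ.+ suc (a ℕ.+ b)) (factorialRatio k a b) (scalar-affine k (suc (a ℕ.+ b))) (scalar-factorialRatio k a b)

    scalar-factorialsRatio : ∀ l r qs → Scalar (λ t → nat (factorialsRatio l r qs t))
    scalar-factorialsRatio l r []             = scalar-resp (λ t → sym ι-1) scalar-one
    scalar-factorialsRatio l r ((p , q) ∷ qs) = scalar-nat-* (factorialRatio k (k ℕ.* l) (k ℕ.* r)) (factorialsRatio l r qs) (scalar-factorialRatio k (k ℕ.* l) (k ℕ.* r)) (scalar-factorialsRatio l r qs)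
      where k = p ℕ.+ q

    -- The factorials are those of index t + `N`, shared by all l ≤ `N`: they clear every
    -- denominator at once and leave quotients that are polynomial in t.
    normalizedTransform : ℕ → ℕ → Family
    normalizedTransform N l t s = nat (factorials (scaleAll (t ℕ.+ N) ps)) * J.transform s (multiLegendre (scaleAll (t ℕ.+ l) ps))

    normalizedTransform∈Span : ∀ l r → ∃ λ d → Span d (normalizedTransform (l ℕ.+ r) l)
    normalizedTransform∈Span l r
      with μ , m , e ← binomials-ratio l ps
      with d , S ← m (span-resp (λ t s → *-identityˡ (Φ t s)) (span-gen {d = 1} {j = 0} (s≤s z≤n)))
      = d , span-resp (λ t s → begin
          nat (ν t) * (μ t s * Φ t s)
            ≈⟨ *-congˡ (e t s) ⟨
          nat (ν t) * binomials s (scaleAll (t ℕ.+ l) ps)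
            ≈⟨ *-congˡ (JL.transform-multiLegendre s (scaleAll (t ℕ.+ l) ps)) ⟨
          nat (ν t) * (nat (factorials (scaleAll (t ℕ.+ l) ps)) * H t s)
            ≈⟨ *-assoc _ _ _ ⟨
          nat (ν t) * nat (factorials (scaleAll (t ℕ.+ l) ps)) * H t s
            ≈⟨ *-congʳ (J.nat-* 0 (ν t) _) ⟨
          nat (ν t ℕ.* factorials (scaleAll (t ℕ.+ l) ps)) * H t s
            ≡⟨ cong (λ a → nat a * H t s) (factorialsRatio-correct l r ps t) ⟨
          normalizedTransform (l ℕ.+ r) l t s ∎) (Scalar.preserves (scalar-factorialsRatio l r ps) S)
      where
      ν = factorialsRatio l r ps
      H : Family
      H t s = J.transform s (multiLegendre (scaleAll (t ℕ.+ l) ps))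

-- Vanishing jets and modules of functions

-- The jet at 0 is ε itself, the same list as `zP`, so each power shifts the coefficients by one.
coeff-jet₀^ : ∀ n u i → i < n → coeff (jet 0 ⊗^ n ⊗ u) i ≡ 0ℚ
coeff-jet₀^ (suc n) u i i<n = ≡.trans (at shifted i) (lemma i i<n)
  where
  open SetoidReasoning (CommutativeRing.setoid 𝒫)
  shifted : jet 0 ⊗^ suc n ⊗ u ≋ 0ℚ ∷ (jet 0 ⊗^ n ⊗ u)
  shifted = ≋-trans (⊗-assoc (jet 0) (jet 0 ⊗^ n) u) (zP-⊗ (jet 0 ⊗^ n ⊗ u))
  lemma : ∀ i → i < suc n → coeff (0ℚ ∷ (jet 0 ⊗^ n ⊗ u)) i ≡ 0ℚ
  lemma zero    _         = ≡.refl
  lemma (suc i) (s≤s i<n) = coeff-jet₀^ n u i i<n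

-- Two homomorphisms from ℤ are in use, `ℤtoℚ` on values of polynomials and `ℤcast` on
-- specialisations, so the map is a parameter.
record IntegerAction (K : CommutativeRing 0ℓ 0ℓ) : Set where
  open CommutativeRing K
  field
    cast   : ℤ → Carrier
    cast-+ : ∀ a b → cast (a ℤ.+ b) ≈ cast a + cast b
    cast-* : ∀ a b → cast (a ℤ.* b) ≈ cast a * cast b
    cast-0 : cast (+ 0) ≈ 0#
    cast-1 : cast (+ 1) ≈ 1#

module FunctionModule
  (X : Set) (K : CommutativeRing 0ℓ 0ℓ) (C : IntegerAction K)
  where
  open CommutativeRing K hiding (zero)
  open IntegerAction C

  record _≐_ (f g : X → Carrier) : Set where
    constructor pointwise
    field on : ∀ x → f x ≈ g x
  open _≐_ public

  functionModule : Mod ℤring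
  functionModule = record
    { Carrierᴹ = X → Carrier
    ; _≈ᴹ_ = _≐_
    ; _+ᴹ_ = λ f g x → f x + g x
    ; _*ₗ_ = λ a f x → cast a * f x
    ; 0ᴹ   = λ x → 0#
    ; -ᴹ_  = λ f x → - f x
    ; isLeftModule = record
      { isLeftSemimodule = record
        { +ᴹ-isCommutativeMonoid = record
          { isMonoid = record
            { isSemigroup = record
              { isMagma = record
                { isEquivalence = record
                  { refl  = pointwise λ x → refl
                  ; sym   = λ e → pointwise λ x → sym (on e x)
                  ; trans = λ e f → pointwise λ x → trans (on e x) (on f x) }
                ; ∙-cong = λ e f → pointwise λ x → +-cong (on e x) (on f x) }
              ; assoc = λ f g h → pointwise λ x → +-assoc _ _ _ }
            ; identity = (λ f → pointwise λ x → +-identityˡ _) , (λ f → pointwise λ x → +-identityʳ _) }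
          ; comm = λ f g → pointwise λ x → +-comm _ _ }
        ; isPreleftSemimodule = record
          { *ₗ-cong      = λ e f → pointwise λ x → *-cong (reflexive (cong cast e)) (on f x)
          ; *ₗ-zeroˡ     = λ f → pointwise λ x → trans (*-congʳ cast-0) (zeroˡ _)
          ; *ₗ-distribʳ  = λ f a b → pointwise λ x → trans (*-congʳ (cast-+ a b)) (distribʳ _ _ _)
          ; *ₗ-identityˡ = λ f → pointwise λ x → trans (*-congʳ cast-1) (*-identityˡ _)
          ; *ₗ-assoc     = λ a b f → pointwise λ x → trans (*-congʳ (cast-* a b)) (*-assoc _ _ _)
          ; *ₗ-zeroʳ     = λ a → pointwise λ x → zeroʳ _
          ; *ₗ-distribˡ  = λ a f g → pointwise λ x → distribˡ _ _ _
          }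
        }
      ; -ᴹ‿cong = λ e → pointwise λ x → -‿cong (on e x)
      ; -ᴹ‿inverse = (λ f → pointwise λ x → -‿inverseˡ _) , (λ f → pointwise λ x → -‿inverseʳ _)
      }
    }

  multiplication : (X → Carrier) → LinearMap functionModule functionModule
  multiplication c = record
    { apply      = λ f x → c x * f x
    ; apply-cong = λ e → pointwise λ x → *-congˡ (on e x)
    ; apply-+    = λ f g → pointwise λ x → distribˡ _ _ _
    ; apply-*ₗ   = λ a f → pointwise λ x → solve 3 (λ c a f → c :* (a :* f) := a :* (c :* f)) refl (c x) (cast a) (f x)
    }
    where open RingSolver K

-- Generation and linear relations over ℤ[t][z]

ℤ-*-nonzero : ∀ {a b : ℤ} → ¬ a ≡ + 0 → ¬ b ≡ + 0 → ¬ a ℤ.* b ≡ + 0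
ℤ-*-nonzero {a} a≢0 b≢0 e with ℤₚ.i*j≡0⇒i≡0∨j≡0 a e
... | inj₁ a≡0 = a≢0 a≡0
... | inj₂ b≡0 = b≢0 b≡0

module ℤ[t]-domain = PolynomialDomain ℤring (λ a → a ℤₚ.≟ + 0) ℤ-*-nonzero

ℤ[t]-1≉0 : ¬ ℤ[t]._≋_ (ℤ[t].const (+ 1)) []
ℤ[t]-1≉0 e with ℤ[t].head-≋[] e
... | ()

module Elimination = UnimodularRelations ℤ[t].polynomialRing ℤ[t]-domain.polynomial-zero? (λ {p} {q} → ℤ[t]-domain.⊗-nonzero {p} {q}) ℤ[t]-1≉0

module ℤ[t][z] = Polynomials ℤ[t].polynomialRing

module Combinations (M : Mod ℤring) (τ Z : LinearMap M M)
  (commutes : ∀ x → LeftModule._≈ᴹ_ M (LinearMap.apply Z (LinearMap.apply τ x)) (LinearMap.apply τ (LinearMap.apply Z x))) where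
  open Swap M τ Z commutes public
  open LeftModule M
  open τZ-action using (act; act-congʳ; act-congˡ; act-⊕; act-+; act-⊗; act-zeroʳ)
  open CommutativeSemigroupProperties (CommutativeMonoid.commutativeSemigroup +ᴹ-commutativeMonoid) using (interchange)
  open SetoidReasoning ≈ᴹ-setoid

  Coefficient : Set
  Coefficient = List (List ℤ)

  sumᴹ : ∀ {k} → (Fin k → Carrierᴹ) → Carrierᴹ
  sumᴹ {zero}  f = 0ᴹ
  sumᴹ {suc k} f = f zero +ᴹ sumᴹ (λ i → f (suc i))

  sumᴹ-cong : ∀ {k} {f g : Fin k → Carrierᴹ} → (∀ i → f i ≈ᴹ g i) → sumᴹ f ≈ᴹ sumᴹ g
  sumᴹ-cong {zero}  e = ≈ᴹ-refl
  sumᴹ-cong {suc k} e = +ᴹ-cong (e zero) (sumᴹ-cong (λ i → e (suc i)))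

  sumᴹ-+ : ∀ {k} (f g : Fin k → Carrierᴹ) → sumᴹ (λ i → f i +ᴹ g i) ≈ᴹ sumᴹ f +ᴹ sumᴹ g
  sumᴹ-+ {zero}  f g = ≈ᴹ-sym (+ᴹ-identityˡ 0ᴹ)
  sumᴹ-+ {suc k} f g = ≈ᴹ-trans (+ᴹ-cong ≈ᴹ-refl (sumᴹ-+ (λ i → f (suc i)) (λ i → g (suc i)))) (interchange _ _ _ _)

  sumᴹ-act : ∀ {k} b (f : Fin k → Carrierᴹ) → sumᴹ (λ i → act b (f i)) ≈ᴹ act b (sumᴹ f)
  sumᴹ-act {zero}  b f = ≈ᴹ-sym (act-zeroʳ b)
  sumᴹ-act {suc k} b f = ≈ᴹ-trans (+ᴹ-cong ≈ᴹ-refl (sumᴹ-act b (λ i → f (suc i)))) (≈ᴹ-sym (act-+ b _ _))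

  sumᴹ-0 : ∀ {k} {f : Fin k → Carrierᴹ} → (∀ i → f i ≈ᴹ 0ᴹ) → sumᴹ f ≈ᴹ 0ᴹ
  sumᴹ-0 {zero}  e = ≈ᴹ-refl
  sumᴹ-0 {suc k} e = ≈ᴹ-trans (+ᴹ-cong (e zero) (sumᴹ-0 (λ i → e (suc i)))) (+ᴹ-identityˡ 0ᴹ)

  module _ {r : ℕ} (e : Fin r → Carrierᴹ) where

    evaluate : (Fin r → Coefficient) → Carrierᴹ
    evaluate c = sumᴹ (λ j → act (c j) (e j))

    evaluate-cong : ∀ {c c′} → (∀ j → c j ℤ[t][z].≋ c′ j) → evaluate c ≈ᴹ evaluate c′
    evaluate-cong eq = sumᴹ-cong {r} (λ j → act-congˡ (e j) (eq j))

    evaluate-⊕ : ∀ c c′ → evaluate (λ j → c j ℤ[t][z].⊕ c′ j) ≈ᴹ evaluate c +ᴹ evaluate c′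
    evaluate-⊕ c c′ = ≈ᴹ-trans (sumᴹ-cong {r} (λ j → act-⊕ (e j) (c j) (c′ j))) (sumᴹ-+ {r} (λ j → act (c j) (e j)) (λ j → act (c′ j) (e j)))

    evaluate-⊗ : ∀ b c → evaluate (λ j → b ℤ[t][z].⊗ c j) ≈ᴹ act b (evaluate c)
    evaluate-⊗ b c = ≈ᴹ-trans (sumᴹ-cong {r} (λ j → act-⊗ b (c j) (e j))) (sumᴹ-act {r} b (λ j → act (c j) (e j)))

    evaluate-0 : evaluate (λ j → []) ≈ᴹ 0ᴹ
    evaluate-0 = sumᴹ-0 {r} (λ j → ≈ᴹ-refl)

    evaluate-combine : ∀ {k} (g : Vec Coefficient k) (vs : Vec (Fin r → Coefficient) k) →
      sumᴹ (λ l → act (Vec.lookup g l) (evaluate (Vec.lookup vs l))) ≈ᴹ evaluate (Elimination.combine g vs)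
    evaluate-combine []      []       = ≈ᴹ-sym evaluate-0
    evaluate-combine (b ∷ g) (v ∷ vs) = ≈ᴹ-trans
      (+ᴹ-cong (≈ᴹ-sym (evaluate-⊗ b v)) (evaluate-combine g vs))
      (≈ᴹ-sym (evaluate-⊕ (λ j → b ℤ[t][z].⊗ v j) (Elimination.combine g vs)))

  act-dot-0 : ∀ {k} (w g : Vec Coefficient k) x → (∀ l → act (Vec.lookup g l) x ≈ᴹ 0ᴹ) → act (Elimination.dot w g) x ≈ᴹ 0ᴹ
  act-dot-0 []      []      x e = ≈ᴹ-refl
  act-dot-0 (b ∷ w) (c ∷ g) x e = begin
    act (b ℤ[t][z].⊗ c ℤ[t][z].⊕ Elimination.dot w g) x
      ≈⟨ act-⊕ x (b ℤ[t][z].⊗ c) (Elimination.dot w g) ⟩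
    act (b ℤ[t][z].⊗ c) x +ᴹ act (Elimination.dot w g) x
      ≈⟨ +ᴹ-cong (≈ᴹ-trans (act-⊗ b c x) (≈ᴹ-trans (act-congʳ b (e zero)) (act-zeroʳ b))) (act-dot-0 w g x (λ l → e (suc l))) ⟩
    0ᴹ +ᴹ 0ᴹ
      ≈⟨ +ᴹ-identityˡ 0ᴹ ⟩
    0ᴹ ∎

  data Generated (e : ℕ → Carrierᴹ) (d : ℕ) : Carrierᴹ → Set where
    gen  : ∀ {j} → j < d → Generated e d (e j)
    zer  : Generated e d 0ᴹ
    add  : ∀ {x y} → Generated e d x → Generated e d y → Generated e d (x +ᴹ y)
    mul  : ∀ b {x} → Generated e d x → Generated e d (act b x)
    resp : ∀ {x y} → x ≈ᴹ y → Generated e d x → Generated e d y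

  generated-≤ : ∀ {e d d′ x} → d ≤ d′ → Generated e d x → Generated e d′ x
  generated-≤ le (gen j<d)  = gen (ℕₚ.≤-trans j<d le)
  generated-≤ le zer        = zer
  generated-≤ le (add S S′) = add (generated-≤ le S) (generated-≤ le S′)
  generated-≤ le (mul b S)  = mul b (generated-≤ le S)
  generated-≤ le (resp e S) = resp e (generated-≤ le S)

  generated-trans : ∀ {e d d′ x} → (∀ j → j < d → Generated e d′ (e j)) → Generated e d x → Generated e d′ x
  generated-trans G (gen j<d)  = G _ j<d
  generated-trans G zer        = zer
  generated-trans G (add S S′) = add (generated-trans G S) (generated-trans G S′)
  generated-trans G (mul b S)  = mul b (generated-trans G S)
  generated-trans G (resp e S) = resp e (generated-trans G S)

  -- The hypothesis rewrites the top generator by lower ones, so the bound falls by one at a time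
  -- until it reaches `n`.
  generated-reduce : ∀ {e} n → (∀ k → Generated e (n ℕ.+ k) (e (n ℕ.+ k))) → ∀ k {x} → Generated e (n ℕ.+ k) x → Generated e n x
  generated-reduce {e} n G zero    {x} S = ≡.subst (λ d → Generated e d x) (ℕₚ.+-identityʳ n) S
  generated-reduce {e} n G (suc k) {x} S = generated-reduce n G k (generated-trans step S)
    where
    step : ∀ j → j < n ℕ.+ suc k → Generated e (n ℕ.+ k) (e j)
    step j j< with ℕₚ.m<1+n⇒m<n∨m≡n (≡.subst (j <_) (ℕₚ.+-suc n k) j<)
    ... | inj₁ j<n+k  = gen j<n+k
    ... | inj₂ ≡.refl = G k

  unit : ∀ {r} → Fin r → Fin r → Coefficient
  unit zero    zero    = ℤ[t][z].const (ℤ[t].const (+ 1))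
  unit zero    (suc j) = []
  unit (suc i) zero    = []
  unit (suc i) (suc j) = unit i j

  evaluate-unit : ∀ {r} (e : Fin r → Carrierᴹ) i → evaluate e (unit i) ≈ᴹ e i
  evaluate-unit {suc r} e zero    = ≈ᴹ-trans (+ᴹ-cong (LeftModule.*ₗ-identityˡ MτZ (e zero)) (sumᴹ-0 {r} (λ j → ≈ᴹ-refl))) (+ᴹ-identityʳ _)
  evaluate-unit e (suc i) = ≈ᴹ-trans (+ᴹ-identityˡ _) (evaluate-unit (λ j → e (suc j)) i)

  -- The generators may be dependent, and any choice of coordinates serves: a relation between
  -- coordinate vectors passes to the elements.
  coordinates : ∀ {e d x} → Generated e d x → ∃ λ c → evaluate {d} (λ j → e (toℕ j)) c ≈ᴹ x
  coordinates {e} (gen j<d) = unit (fromℕ< j<d)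
    , ≈ᴹ-trans (evaluate-unit (λ j → e (toℕ j)) (fromℕ< j<d)) (≈ᴹ-reflexive (cong e (Finₚ.toℕ-fromℕ< j<d)))
  coordinates {e} {d} zer        = (λ j → []) , evaluate-0 {d} (λ j → e (toℕ j))
  coordinates {e} (add S S′) with c , eq ← coordinates S | c′ , eq′ ← coordinates S′ =
    (λ j → c j ℤ[t][z].⊕ c′ j) , ≈ᴹ-trans (evaluate-⊕ (λ j → e (toℕ j)) c c′) (+ᴹ-cong eq eq′)
  coordinates {e} (mul b S) with c , eq ← coordinates S =
    (λ j → b ℤ[t][z].⊗ c j) , ≈ᴹ-trans (evaluate-⊗ (λ j → e (toℕ j)) b c) (act-congʳ b eq)
  coordinates (resp eq′ S) with c , eq ← coordinates S = c , ≈ᴹ-trans eq eq′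

-- Specialisation at ζ

open import Data.Nat using (_+_; _*_)

-- Sequences over K model K[t], with t acting as the shift and z as multiplication by ζ.
module Specialisation (K : CommutativeRing 0ℓ 0ℓ) (charZero : CharZero K) (ζ : CommutativeRing.Carrier K) where
  private
    module K = CommutativeRing K
  open IntegerCast K

  action : IntegerAction K
  action = record { cast = ℤcast K ; cast-+ = ℤcast-+ ; cast-* = ℤcast-* ; cast-0 = K.refl ; cast-1 = ℤcast-1 }

  open FunctionModule ℕ K action
  open LeftModule functionModule

  shift : (ℕ → K.Carrier) → ℕ → K.Carrier
  shift f zero    = K.0#
  shift f (suc i) = f i

  τ Z : LinearMap functionModule functionModule
  τ = record
    { apply      = shift
    ; apply-cong = λ e → pointwise λ { zero → K.refl ; (suc i) → on e i }
    ; apply-+    = λ f g → pointwise λ { zero → K.sym (K.+-identityˡ K.0#) ; (suc i) → K.refl }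
    ; apply-*ₗ   = λ a f → pointwise λ { zero → K.sym (K.zeroʳ _) ; (suc i) → K.refl }
    }
  Z = multiplication (λ _ → ζ)

  commutes : ∀ f → LinearMap.apply Z (LinearMap.apply τ f) ≈ᴹ LinearMap.apply τ (LinearMap.apply Z f)
  commutes f = pointwise λ { zero → K.zeroʳ ζ ; (suc i) → K.refl }

  open Combinations functionModule τ Z commutes

  one : ℕ → K.Carrier
  one zero    = K.1#
  one (suc i) = K.0#

  act-row : ∀ row f i → Z-action.act row f i K.≈ evalℤK K row ζ K.* f i
  act-row []        f i = K.sym (K.zeroˡ _)
  act-row (c ∷ row) f i = K.trans (K.+-congˡ (K.*-congˡ (act-row row f i)))
    (solve 4 (λ c z r f → c :* f :+ z :* (r :* f) := (c :+ z :* r) :* f) K.refl _ ζ (evalℤK K row ζ) (f i))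
    where open RingSolver K

  act-rows : ∀ G f → All (λ row → evalℤK K row ζ K.≈ K.0#) G → Zτ-action.act G f ≈ᴹ 0ᴹ
  act-rows []        f []       = ≈ᴹ-refl
  act-rows (row ∷ G) f (e ∷ es) = ≈ᴹ-trans
    (+ᴹ-cong {Z-action.act row f} {0ᴹ} (pointwise λ i → K.trans (act-row row f i) (K.trans (K.*-congʳ e) (K.zeroˡ _)))
      (≈ᴹ-trans (LinearMap.apply-cong τ (act-rows G f es)) (LinearMap.apply-0 τ)))
    (+ᴹ-identityˡ 0ᴹ)

  act-one : ∀ δ i → τ-action.act δ one i K.≈ ℤcast K (ℤ[t].coeff δ i)
  act-one []      i       = K.refl
  act-one (a ∷ δ) zero    = K.trans (K.+-identityʳ _) (K.*-identityʳ _)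
  act-one (a ∷ δ) (suc i) = K.trans (K.+-cong (K.zeroʳ _) (act-one δ i)) (K.+-identityˡ _)

  cast-injective : ∀ a → ℤcast K a K.≈ K.0# → a ≡ + 0
  cast-injective (+ zero)  e = ≡.refl
  cast-injective (+ suc n) e = ⊥-elim (charZero n e)
  cast-injective -[1+ n ]  e = ⊥-elim (charZero n (K.trans (K.sym (-‿involutive _)) (K.trans (K.-‿cong e) -0#≈0#)))
    where open RingProperties K.ring

  -- If all coefficients vanished at ζ, each entry of `g` would annihilate `one`, the constant
  -- polynomial 1 of K[t], and so would their combination δ. But δ applied to `one` displays the
  -- casts of its own coefficients, and in characteristic zero these vanish only with δ.
  nonvanishing : ∀ {k} (w g : Vec (List (List ℤ)) k) δ → ¬ δ ℤ[t].≋ [] → Elimination.dot w g ℤ[t][z].≋ ℤ[t][z].const δ →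
    ¬ (∀ l → All (λ row → evalℤK K row ζ K.≈ K.0#) (swap (Vec.lookup g l)))
  nonvanishing w g δ δ≉0 e zeros = δ≉0 (ℤ[t].coeffwise λ i → cast-injective (ℤ[t].coeff δ i)
    (K.trans (K.sym (act-one δ i)) (on act-δ i)))
    where
    open SetoidReasoning ≈ᴹ-setoid
    act-δ : τ-action.act δ one ≈ᴹ 0ᴹ
    act-δ = begin
      τ-action.act δ one                          ≈⟨ τZ-action.act-const δ one ⟨
      τZ-action.act (ℤ[t][z].const δ) one         ≈⟨ τZ-action.act-congˡ one e ⟨
      τZ-action.act (Elimination.dot w g) one     ≈⟨ act-dot-0 w g one (λ l → ≈ᴹ-trans (≈ᴹ-sym (act-swap functionModule τ Z commutes (Vec.lookup g l) one)) (act-rows (swap (Vec.lookup g l)) one (zeros l))) ⟩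
      0ᴹ                                          ∎

-- The recurrence on values in t, s and powers of ε

negatedSum-cong : ∀ {f g : ℕ → ℚ} → (∀ s → f s ≡ g s) → ∀ s → negatedSum f s ≡ negatedSum g s
negatedSum-cong e zero    = ≡.refl
negatedSum-cong e (suc s) = cong₂ ℚ._-_ (negatedSum-cong e s) (e s)

negatedSum-+ : ∀ (f g : ℕ → ℚ) s → negatedSum (λ r → f r ℚ.+ g r) s ≡ negatedSum f s ℚ.+ negatedSum g s
negatedSum-+ f g zero    = ≡.refl
negatedSum-+ f g (suc s) = ≡.trans (cong (ℚ._- (f s ℚ.+ g s)) (negatedSum-+ f g s))
  (solve 4 (λ a b x y → (a :+ b) :- (x :+ y) := (a :- x) :+ (b :- y)) ≡.refl (negatedSum f s) (negatedSum g s) (f s) (g s))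
  where open ℚSolver

negatedSum-* : ∀ c (f : ℕ → ℚ) s → negatedSum (λ r → c ℚ.* f r) s ≡ c ℚ.* negatedSum f s
negatedSum-* c f zero    = ≡.sym (ℚₚ.*-zeroʳ c)
negatedSum-* c f (suc s) = ≡.trans (cong (ℚ._- (c ℚ.* f s)) (negatedSum-* c f s))
  (solve 3 (λ c a x → c :* a :- c :* x := c :* (a :- x)) ≡.refl c (negatedSum f s) (f s))
  where open ℚSolver

negatedSum-telescope : ∀ (f : ℕ → ℚ) s → negatedSum (λ r → f (suc r)) s ℚ.- negatedSum f s ℚ.+ f s ≡ f 0
negatedSum-telescope f zero    = ℚₚ.+-identityˡ (f 0)
negatedSum-telescope f (suc s) = ≡.trans
  (solve 4 (λ a b x y → (a :- y) :- (b :- x) :+ y := a :- b :+ x) ≡.refl (negatedSum (λ r → f (suc r)) s) (negatedSum f s) (f s) (f (suc s)))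
  (negatedSum-telescope f s)
  where open ℚSolver

-- In z f(s+1) + (1 - z) f(s) the common leading part `x` has total coefficient z + (1 - z) = 1, so
-- it is isolated without dividing by a polynomial in z: x = z y - z y⁺ - y.
telescope-solve : ∀ (f x y y⁺ : ℕ → ℚ) → (∀ r → f r ≡ x r ℚ.+ y r) → (∀ r → f (suc r) ≡ x r ℚ.+ y⁺ r) → f 0 ≡ 0ℚ →
  ∀ s → negatedSum y s ℚ.+ (ℚ.- negatedSum y⁺ s ℚ.+ ℚ.- y s) ≡ x s
telescope-solve f x y y⁺ f≡ f⁺≡ f₀≡0 s = begin
  negatedSum y s ℚ.+ (ℚ.- negatedSum y⁺ s ℚ.+ ℚ.- y s)
    ≡⟨ solve 5 (λ E a b c d → a :+ (:- b :+ :- c) := d :- ((E :+ b) :- (E :+ a) :+ (d :+ c))) ≡.refl (negatedSum x s) (negatedSum y s) (negatedSum y⁺ s) (y s) (x s) ⟩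
  x s ℚ.- ((negatedSum x s ℚ.+ negatedSum y⁺ s) ℚ.- (negatedSum x s ℚ.+ negatedSum y s) ℚ.+ (x s ℚ.+ y s))
    ≡⟨ cong (λ a → x s ℚ.- a) (cong₂ ℚ._+_ (cong₂ ℚ._-_ (≡.trans (negatedSum-cong f⁺≡ s) (negatedSum-+ x y⁺ s)) (≡.trans (negatedSum-cong f≡ s) (negatedSum-+ x y s))) (f≡ s)) ⟨
  x s ℚ.- (negatedSum (λ r → f (suc r)) s ℚ.- negatedSum f s ℚ.+ f s)
    ≡⟨ cong (λ a → x s ℚ.- a) (≡.trans (negatedSum-telescope f s) f₀≡0) ⟩
  x s ℚ.- 0ℚ
    ≡⟨ ℚₚ.+-identityʳ (x s) ⟩
  x s ∎
  where
  open ≡-Reasoning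
  open ℚSolver

jet-suc : ∀ s → jet (suc s) ≋ oneP ⊕ jet s
jet-suc s = ∷-cong (ℕtoℚ-suc s) ≋-refl

rationalAction : IntegerAction ℚring
rationalAction = record { cast = ℤtoℚ ; cast-+ = ℤtoℚ-+ ; cast-* = ℤtoℚ-* ; cast-0 = ≡.refl ; cast-1 = ≡.refl }

-- ℚ-valued functions of t, s and i, with t acting by multiplication and z as h(s) ↦ -Σ_{r<s} h(r);
-- the i-th component is the coefficient of ε^i.
module Values (ps : List (ℕ × ℕ)) where
  n : ℕ
  n = length ps

  Point : Set
  Point = ℕ × ℕ × Fin n

  open FunctionModule Point ℚring rationalAction
  open LeftModule functionModule

  τ Z : LinearMap functionModule functionModule
  τ = multiplication (λ (t , s , i) → ℕtoℚ t)
  Z = record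
    { apply      = λ f (t , s , i) → negatedSum (λ r → f (t , r , i)) s
    ; apply-cong = λ e → pointwise λ (t , s , i) → negatedSum-cong (λ r → on e (t , r , i)) s
    ; apply-+    = λ f g → pointwise λ (t , s , i) → negatedSum-+ (λ r → f (t , r , i)) (λ r → g (t , r , i)) s
    ; apply-*ₗ   = λ a f → pointwise λ (t , s , i) → negatedSum-* (ℤtoℚ a) (λ r → f (t , r , i)) s
    }

  commutes : ∀ f → LinearMap.apply Z (LinearMap.apply τ f) ≈ᴹ LinearMap.apply τ (LinearMap.apply Z f)
  commutes f = pointwise λ (t , s , i) → negatedSum-* (ℕtoℚ t) (λ r → f (t , r , i)) s

  open Combinations functionModule τ Z commutes

  values : (ℕ → Fin n → Poly) → Point → ℚ
  values P (t , s , i) = valueAt (P t i) s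

  -- By `valueAt-shift`, the partial sums in `Z` are multiplication by z on values of polynomials;
  -- this ties the abstract action to the products in the theorem.
  act-row-values : ∀ row P t s i → Z-action.act row (values P) (t , s , i) ≡ valueAt (map ℤtoℚ row ⊗ P t i) s
  act-row-values []        P t s i = ≡.refl
  act-row-values (c ∷ row) P t s i = ≡.sym (begin
    valueAt (scale (ℤtoℚ c) (P t i) ⊕ (0ℚ ∷ (map ℤtoℚ row ⊗ P t i))) s
      ≡⟨ At.transform-⊕ s 0 (scale (ℤtoℚ c) (P t i)) (0ℚ ∷ (map ℤtoℚ row ⊗ P t i)) ⟩
    valueAt (scale (ℤtoℚ c) (P t i)) s ℚ.+ valueAt (0ℚ ∷ (map ℤtoℚ row ⊗ P t i)) s
      ≡⟨ cong₂ ℚ._+_ (At.transform-scale s 0 (ℤtoℚ c) (P t i)) (valueAt-shift (map ℤtoℚ row ⊗ P t i) s) ⟩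
    ℤtoℚ c ℚ.* valueAt (P t i) s ℚ.+ negatedSum (valueAt (map ℤtoℚ row ⊗ P t i)) s
      ≡⟨ cong (ℤtoℚ c ℚ.* valueAt (P t i) s ℚ.+_) (negatedSum-cong (λ r → act-row-values row P t r i) s) ⟨
    Z-action.act (c ∷ row) (values P) (t , s , i) ∎)
    where open ≡-Reasoning

  act-values : ∀ G P t s i → Zτ-action.act G (values P) (t , s , i) ≡ valueAt (evalT G t ⊗ P t i) s
  act-values []        P t s i = ≡.refl
  act-values (row ∷ G) P t s i = ≡.sym (begin
    valueAt ((map ℤtoℚ row +P scaleP (ℕtoℚ t) (evalT G t)) ⊗ P t i) s
      ≡⟨ cong (λ q → valueAt (q ⊗ P t i) s) (+P≡⊕ (map ℤtoℚ row) (scaleP (ℕtoℚ t) (evalT G t))) ⟩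
    valueAt ((map ℤtoℚ row ⊕ scale (ℕtoℚ t) (evalT G t)) ⊗ P t i) s
      ≡⟨ At.transform-cong s 0 (≋-trans (⊗-distribʳ (P t i) (map ℤtoℚ row) (scale (ℕtoℚ t) (evalT G t))) (⊕-cong (≋-refl {map ℤtoℚ row ⊗ P t i}) (scale-⊗ (ℕtoℚ t) (evalT G t) (P t i)))) ⟩
    valueAt (map ℤtoℚ row ⊗ P t i ⊕ scale (ℕtoℚ t) (evalT G t ⊗ P t i)) s
      ≡⟨ At.transform-⊕ s 0 (map ℤtoℚ row ⊗ P t i) _ ⟩
    valueAt (map ℤtoℚ row ⊗ P t i) s ℚ.+ valueAt (scale (ℕtoℚ t) (evalT G t ⊗ P t i)) s
      ≡⟨ cong₂ ℚ._+_ (act-row-values row P t s i) (≡.trans (cong (ℕtoℚ t ℚ.*_) (act-values G P t s i)) (≡.sym (At.transform-scale s 0 (ℕtoℚ t) (evalT G t ⊗ P t i)))) ⟨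
    Zτ-action.act (row ∷ G) (values P) (t , s , i) ∎)
    where open ≡-Reasoning

  sum-values : ∀ {k} (G : Fin k → Poly2ℤ) (P : Fin k → ℕ → Fin n → Poly) t s i →
    valueAt (sumP (tabulate λ l → evalT (G l) t *P P l t i)) s ≡ sumᴹ (λ l → Zτ-action.act (G l) (values (P l))) (t , s , i)
  sum-values {zero}  G P t s i = ≡.refl
  sum-values {suc k} G P t s i = begin
    valueAt ((evalT (G zero) t *P P zero t i) +P rest) s
      ≡⟨ cong (λ q → valueAt q s) (≡.trans (+P≡⊕ (evalT (G zero) t *P P zero t i) rest) (cong (_⊕ rest) (*P≡⊗ (evalT (G zero) t) (P zero t i)))) ⟩
    valueAt ((evalT (G zero) t ⊗ P zero t i) ⊕ rest) s
      ≡⟨ At.transform-⊕ s 0 (evalT (G zero) t ⊗ P zero t i) rest ⟩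
    valueAt (evalT (G zero) t ⊗ P zero t i) s ℚ.+ valueAt rest s
      ≡⟨ cong₂ ℚ._+_ (≡.sym (act-values (G zero) (P zero) t s i)) (sum-values (λ l → G (suc l)) (λ l → P (suc l)) t s i) ⟩
    sumᴹ (λ l → Zτ-action.act (G l) (values (P l))) (t , s , i) ∎
    where
    open ≡-Reasoning
    rest = sumP (tabulate λ l → evalT (G (suc l)) t *P P (suc l) t i)

  module Jets = Shifts 𝒫 jets jet jet-suc
  open Jets using (Family)
  open Jets.Ratios ps
  open Jets.Spans Φ

  coefficients : Family → Point → ℚ
  coefficients x (t , s , i) = coeff (x t s) (toℕ i)

  e : ℕ → Point → ℚ
  e j = coefficients (λ t s → jet s ⊗^ j ⊗ Φ t s)

  generated-neg : ∀ {d y} → Generated e d y → Generated e d (-ᴹ y)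
  generated-neg {y = y} S = resp
    (≈ᴹ-trans (τZ-action.act-const (ℤ[t].const (ℤ.- + 1)) y) (≈ᴹ-trans (τ-action.act-const (ℤ.- + 1) y)
      (pointwise λ x → ≡.sym (ℚₚ.neg-distribˡ-* 1ℚ (y x) ⟨≡⟩ cong ℚ.-_ (ℚₚ.*-identityˡ (y x))))))
    (mul (ℤ[t][z].const (ℤ[t].const (ℤ.- + 1))) S)
    where
    infixr 2 _⟨≡⟩_
    _⟨≡⟩_ : ∀ {a b c : ℚ} → b ≡ a → b ≡ c → c ≡ a
    p ⟨≡⟩ q = ≡.trans (≡.sym q) p

  generated-Z : ∀ {d y} → Generated e d y → Generated e d (LinearMap.apply Z y)
  generated-Z {y = y} S = resp
    (≈ᴹ-trans (τZ-action.act-shift (ℤ[t][z].const (ℤ[t].const (+ 1))) y) (LinearMap.apply-cong Z (LeftModule.*ₗ-identityˡ MτZ y)))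
    -- The multiplier is the polynomial z: its constant term `[]` is the zero of ℤ[t].
    (mul ([] ∷ ℤ[t][z].const (ℤ[t].const (+ 1))) S)

  generated-affine : ∀ {d y} u v → Generated e d y → Generated e d (λ x → ℕtoℚ (u * proj₁ x + v) ℚ.* y x)
  generated-affine {y = y} u v S = resp
    (≈ᴹ-trans (τZ-action.act-const (+ v ∷ + u ∷ []) y) (pointwise λ (t , s , i) → begin
      ℕtoℚ v ℚ.* y (t , s , i) ℚ.+ ℕtoℚ t ℚ.* (ℕtoℚ u ℚ.* y (t , s , i) ℚ.+ ℕtoℚ t ℚ.* 0ℚ)
        ≡⟨ solve 4 (λ v t u y → v :* y :+ t :* (u :* y :+ t :* con (+ 0)) := (u :* t :+ v) :* y) ≡.refl (ℕtoℚ v) (ℕtoℚ t) (ℕtoℚ u) (y (t , s , i)) ⟩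
      (ℕtoℚ u ℚ.* ℕtoℚ t ℚ.+ ℕtoℚ v) ℚ.* y (t , s , i)
        ≡⟨ cong (ℚ._* y (t , s , i)) (≡.trans (ℕtoℚ-+ (u * t) v) (cong (ℚ._+ ℕtoℚ v) (ℕtoℚ-* u t))) ⟨
      ℕtoℚ (u * t + v) ℚ.* y (t , s , i) ∎))
    (mul (ℤ[t][z].const (+ v ∷ + u ∷ [])) S)
    where
    open ≡-Reasoning
    open ℚSolver

  generated : ∀ {d x} → Span d x → Generated e d (coefficients x)
  generated (span-gen j<d)      = gen j<d
  generated span-0              = zer
  generated (span-+ {x} {y} S S′) = resp (pointwise λ (t , s , i) → ≡.sym (coeff-⊕ (x t s) (y t s) (toℕ i))) (add (generated S) (generated S′))
  generated (span-neg {x} S)    = resp (pointwise λ (t , s , i) → ≡.sym (coeff-⊖ (x t s) (toℕ i))) (generated-neg (generated S))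
  generated (span-lin {x} u v S) = resp
    (pointwise λ (t , s , i) → ≡.sym (≡.trans (at (const-⊗ (ℕtoℚ (u * t + v)) (x t s)) (toℕ i)) (coeff-scale (ℕtoℚ (u * t + v)) (x t s) (toℕ i))))
    (generated-affine u v (generated S))
  generated (span-resp eq S)    = resp (pointwise λ (t , s , i) → at (eq t s) (toℕ i)) (generated S)

  generated-relation : ∀ {d y y⁺} (f : Family) → Span d y → Span d y⁺ →
    (∀ t s → f t s ≋ jet s ⊗^ d ⊗ Φ t s ⊕ y t s) → (∀ t s → f t (suc s) ≋ jet s ⊗^ d ⊗ Φ t s ⊕ y⁺ t s) →
    (∀ t i → coeff (f t 0) (toℕ {n} i) ≡ 0ℚ) → Generated e d (e d)
  generated-relation {d} {y} {y⁺} f S S⁺ f≋ f⁺≋ f₀≡0 = resp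
    (pointwise λ (t , s , i) → telescope-solve (λ r → coeff (f t r) (toℕ i)) (λ r → e d (t , r , i))
      (λ r → coefficients y (t , r , i)) (λ r → coefficients y⁺ (t , r , i))
      (λ r → ≡.trans (at (f≋ t r) (toℕ i)) (coeff-⊕ (jet r ⊗^ d ⊗ Φ t r) (y t r) (toℕ i)))
      (λ r → ≡.trans (at (f⁺≋ t r) (toℕ i)) (coeff-⊕ (jet r ⊗^ d ⊗ Φ t r) (y⁺ t r) (toℕ i)))
      (f₀≡0 t i) s)
    (add (generated-Z (generated S)) (add (generated-neg (generated-Z (generated S⁺))) (generated-neg (generated S))))

  -- The telescoper at s = 0 is divisible by ε^n, which makes its coefficients vanish for every
  -- index i < n carried by `Point`; this is the origin of the bound m < n.
  generated-e : ∀ k → Generated e (n + k) (e (n + k))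
  generated-e k = generated-relation (telescoper k) (rest∈ M) (rest∈ M⁺) (x≈ M) (x≈ M⁺)
    λ t i → telescoper-coefficients t i (telescoper-0 k t)
    where
    open Monic
    M  = monic-telescoper k
    M⁺ = monic-telescoper-suc k
    telescoper-coefficients : ∀ t i → (∃ λ u → telescoper k t 0 ≋ jet 0 ⊗^ n ⊗ u) → coeff (telescoper k t 0) (toℕ {n} i) ≡ 0ℚ
    telescoper-coefficients t i (u , eq) = ≡.trans (at eq (toℕ i)) (coeff-jet₀^ n u (toℕ i) (Finₚ.toℕ<n i))

  generated-n : ∀ {d x} → Span d x → Generated e n (coefficients x)
  generated-n {d} S = generated-reduce n generated-e d (generated-≤ (ℕₚ.m≤n+m d n) (generated S))

  normalized : Fin (suc n) → Point → ℚ
  normalized l = coefficients (normalizedTransform n (toℕ l))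

  normalized-coordinates : ∀ l → ∃ λ c → evaluate {n} (λ j → e (toℕ j)) c ≈ᴹ normalized l
  normalized-coordinates l = coordinates (≡.subst (λ N → Generated e n (coefficients (normalizedTransform N (toℕ l))))
    (ℕₚ.m+[n∸m]≡n (ℕₚ.≤-pred (Finₚ.toℕ<n l))) (generated-n (proj₂ (normalizedTransform∈Span (toℕ l) (n ∸ toℕ l)))))

  vectors : Vec (Fin n → List (List ℤ)) (suc n)
  vectors = Vec.tabulate (λ l → proj₁ (normalized-coordinates l))

  relation-normalized : ∀ g → (∀ j → Elimination.combine g vectors j ℤ[t][z].≋ []) →
    sumᴹ (λ l → Zτ-action.act (swap (Vec.lookup g l)) (normalized l)) ≈ᴹ 0ᴹ
  relation-normalized g eq = begin
    sumᴹ (λ l → Zτ-action.act (swap (Vec.lookup g l)) (normalized l))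
      ≈⟨ sumᴹ-cong {suc n} (λ l → ≈ᴹ-trans (act-swap functionModule τ Z commutes (Vec.lookup g l) (normalized l))
           (τZ-action.act-congʳ (Vec.lookup g l) (≈ᴹ-sym (≈ᴹ-trans
             (≈ᴹ-reflexive (cong (evaluate {n} (λ j → e (toℕ j))) (Vecₚ.lookup∘tabulate (λ l → proj₁ (normalized-coordinates l)) l)))
             (proj₂ (normalized-coordinates l)))))) ⟩
    sumᴹ (λ l → τZ-action.act (Vec.lookup g l) (evaluate {n} (λ j → e (toℕ j)) (Vec.lookup vectors l)))
      ≈⟨ evaluate-combine (λ j → e (toℕ j)) g vectors ⟩
    evaluate {n} (λ j → e (toℕ j)) (Elimination.combine g vectors)
      ≈⟨ evaluate-cong {n} (λ j → e (toℕ j)) {Elimination.combine g vectors} {λ j → []} eq ⟩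
    evaluate {n} (λ j → e (toℕ j)) (λ j → [])
      ≈⟨ evaluate-0 {n} (λ j → e (toℕ j)) ⟩
    0ᴹ ∎
    where open SetoidReasoning ≈ᴹ-setoid

  -- A factor independent of s commutes with partial sums in s, hence with the whole polynomial
  -- action. Both the denominators, depending on t, and the derivative factors, depending on i, are
  -- of this kind.
  rescale : (ℕ → Fin n → ℚ) → LinearMap MZτ MZτ
  rescale c = extendLinear (Polynomials.polynomialRing ℤring) τZ τZ
    (extendLinear ℤring Z Z (multiplication (λ (t , s , i) → c t i))
      (λ f → pointwise λ (t , s , i) → ≡.sym (negatedSum-* (c t i) (λ r → f (t , r , i)) s)))
    (λ f → pointwise λ (t , s , i) → ℚSolver.solve 3 (λ c t f → c ℚSolver.:* (t ℚSolver.:* f) ℚSolver.:= t ℚSolver.:* (c ℚSolver.:* f)) ≡.refl (c t i) (ℕtoℚ t) (f (t , s , i)))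

  rescale-sum : ∀ c {k} (G : Fin k → Poly2ℤ) (f : Fin k → Point → ℚ) →
    LinearMap.apply (rescale c) (sumᴹ (λ l → Zτ-action.act (G l) (f l))) ≈ᴹ sumᴹ (λ l → Zτ-action.act (G l) (LinearMap.apply (rescale c) (f l)))
  rescale-sum c {zero}  G f = LinearMap.apply-0 (rescale c)
  rescale-sum c {suc k} G f = ≈ᴹ-trans (LinearMap.apply-+ (rescale c) (Zτ-action.act (G zero) (f zero)) (sumᴹ (λ l → Zτ-action.act (G (suc l)) (f (suc l)))))
    (+ᴹ-cong (LinearMap.apply-*ₗ (rescale c) (G zero) (f zero)) (rescale-sum c (λ l → G (suc l)) (λ l → f (suc l))))

  denominator : ℕ → ℕ
  denominator t = factorials (scaleAll (t + n) ps)

  legendre : Fin (suc n) → ℕ → Fin n → Poly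
  legendre l t i = Tpow (toℕ i) (multiLegendre (scaleAll (t + toℕ l) ps))

  legendre-normalized : ∀ l → LinearMap.apply (rescale (λ t i → ℕtoℚ (denominator t))) (values (legendre l))
                            ≈ᴹ LinearMap.apply (rescale (λ t i → derivativeFactor (toℕ i) 0)) (normalized l)
  legendre-normalized l = pointwise λ (t , s , i) → begin
    ℕtoℚ (denominator t) ℚ.* valueAt (legendre l t i) s
      ≡⟨ cong (ℕtoℚ (denominator t) ℚ.*_) (valueAt-Tpow (toℕ i) (multiLegendre (scaleAll (t + toℕ l) ps)) s) ⟩
    ℕtoℚ (denominator t) ℚ.* (derivativeFactor (toℕ i) 0 ℚ.* coeff (H t s) (toℕ i))
      ≡⟨ solve 3 (λ a b c → a :* (b :* c) := b :* (a :* c)) ≡.refl (ℕtoℚ (denominator t)) (derivativeFactor (toℕ i) 0) (coeff (H t s) (toℕ i)) ⟩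
    derivativeFactor (toℕ i) 0 ℚ.* (ℕtoℚ (denominator t) ℚ.* coeff (H t s) (toℕ i))
      ≡⟨ cong (derivativeFactor (toℕ i) 0 ℚ.*_) (≡.trans (at (const-⊗ (ℕtoℚ (denominator t)) (H t s)) (toℕ i)) (coeff-scale (ℕtoℚ (denominator t)) (H t s) (toℕ i))) ⟨
    derivativeFactor (toℕ i) 0 ℚ.* normalized l (t , s , i) ∎
    where
    open ≡-Reasoning
    open ℚSolver
    H : ℕ → ℕ → Poly
    H t s = Jet.transform s (multiLegendre (scaleAll (t + toℕ l) ps))

  factorials≢0 : ∀ qs → ℕ.NonZero (factorials qs)
  factorials≢0 []             = _
  factorials≢0 ((p , q) ∷ qs) = ℕₚ.m*n≢0 ((p + q) !) (factorials qs) {{ℕₚ._!≢0 (p + q)}} {{factorials≢0 qs}}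

  cancel : ∀ k .{{_ : ℕ.NonZero k}} {a} → ℕtoℚ k ℚ.* a ≡ 0ℚ → a ≡ 0ℚ
  cancel (suc k) eq = nat-cancel k (≡.trans eq (≡.sym (ℚₚ.*-zeroʳ (ℕtoℚ (suc k)))))

  -- The relation is known for `normalized`. Multiplying it by the derivative factors and the
  -- Legendre sum by the denominator makes the two agree; only the denominator, a nonzero integer,
  -- has to be cancelled.
  recurrence : ∀ (g : Vec (List (List ℤ)) (suc n)) → (∀ j → Elimination.combine g vectors j ℤ[t][z].≋ []) →
    ∀ i t → IsZeroP (sumP (tabulate λ l → evalT (swap (Vec.lookup g l)) t *P legendre l t i))
  recurrence g eq i t = valueAt-injective _ λ s →
    ≡.trans (sum-values G legendre t s i) (cancel (denominator t) {{factorials≢0 (scaleAll (t + n) ps)}} (on vanishes (t , s , i)))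
    where
    open SetoidReasoning ≈ᴹ-setoid
    G : Fin (suc n) → Poly2ℤ
    G l = swap (Vec.lookup g l)
    N κ : ℕ → Fin n → ℚ
    N t i = ℕtoℚ (denominator t)
    κ t i = derivativeFactor (toℕ i) 0
    vanishes : LinearMap.apply (rescale N) (sumᴹ (λ l → Zτ-action.act (G l) (values (legendre l)))) ≈ᴹ 0ᴹ
    vanishes = begin
      LinearMap.apply (rescale N) (sumᴹ (λ l → Zτ-action.act (G l) (values (legendre l))))
        ≈⟨ rescale-sum N G (λ l → values (legendre l)) ⟩
      sumᴹ (λ l → Zτ-action.act (G l) (LinearMap.apply (rescale N) (values (legendre l))))
        ≈⟨ sumᴹ-cong {suc n} (λ l → Zτ-action.act-congʳ (G l) (legendre-normalized l)) ⟩
      sumᴹ (λ l → Zτ-action.act (G l) (LinearMap.apply (rescale κ) (normalized l)))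
        ≈⟨ rescale-sum κ G normalized ⟨
      LinearMap.apply (rescale κ) (sumᴹ (λ l → Zτ-action.act (G l) (normalized l)))
        ≈⟨ LinearMap.apply-cong (rescale κ) (relation-normalized g eq) ⟩
      LinearMap.apply (rescale κ) 0ᴹ
        ≈⟨ LinearMap.apply-0 (rescale κ) ⟩
      0ᴹ ∎

-- One coefficient family for all powers of T

Recurrence : ∀ n → List (ℕ × ℕ) → Set₁
Recurrence n ps = Σ (Fin (suc n) → Poly2ℤ) λ G →
    ((K : CommutativeRing 0ℓ 0ℓ) → CharZero K → (ζ : CommutativeRing.Carrier K) →
      ¬ (∀ l → All (λ row → CommutativeRing._≈_ K (evalℤK K row ζ) (CommutativeRing.0# K)) (G l)))
    × (∀ (i : Fin n) t → IsZeroP (sumP (tabulate λ l → evalT (G l) t *P Tpow (toℕ i) (multiLegendre (scaleAll (t + toℕ l) ps)))))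

legendre-recurrence : ∀ n (ps : List (ℕ × ℕ)) → length ps ≡ n → Recurrence n ps
legendre-recurrence _ ps ≡.refl = fromRelation (Elimination.unimodular-relation (length ps) (Values.vectors ps))
  where
  fromRelation : (Σ (Vec (List (List ℤ)) (suc (length ps))) λ g → Σ (Vec (List (List ℤ)) (suc (length ps))) λ w → Σ (List ℤ) λ δ →
    (∀ j → Elimination.combine g (Values.vectors ps) j ℤ[t][z].≋ []) × (¬ δ ℤ[t].≋ []) × (Elimination.dot w g ℤ[t][z].≋ ℤ[t][z].const δ)) →
    Recurrence (length ps) ps
  fromRelation (g , w , δ , relation≈0 , δ≉0 , dot≈δ) =
    (λ l → swap (Vec.lookup g l))
    , (λ K charZero ζ → Specialisation.nonvanishing K charZero ζ w g δ δ≉0 dot≈δ)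
    , Values.recurrence ps g relation≈0

theorem4p1 :
    (n : ℕ) → 1 ≤ n →
    (p q : Fin n → ℕ) → (∀ i → 1 ≤ p i) →
    Σ (Fin (suc n) → Poly2ℤ) λ G →
    ((K : CommutativeRing 0ℓ 0ℓ) → CharZero K →
    (ζ : CommutativeRing.Carrier K) →
    ¬ (∀ l → All (λ row → CommutativeRing._≈_ K (evalℤK K row ζ) (CommutativeRing.0# K)) (G l)))
    ×
    ((t : ℕ) →
    IsZeroP (sumP (tabulate {n = suc n} λ l →
    evalT (G l) t *P
    multiLegendre (tabulate {n = n} λ i → (p i * (t + toℕ l) , q i * (t + toℕ l))))))
    ×
    ((m : ℕ) → 2 ≤ n → 1 ≤ m → m < n →
    (∀ (i j : Fin n) → toℕ i ≤ toℕ j → toℕ j ≤ m → p i ≤ p j) →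
    (∀ (i j : Fin n) → toℕ i ≤ toℕ j → toℕ j ≤ m → q i ≤ q j) →
    (t : ℕ) →
    IsZeroP (sumP (tabulate {n = suc n} λ l →
    evalT (G l) t *P
    Tpow m (multiLegendre (tabulate {n = n} λ i → (p i * (t + toℕ l) , q i * (t + toℕ l)))))))
theorem4p1 n 1≤n p q _ = fromRecurrence (legendre-recurrence n (tabulate pq) (Listₚ.length-tabulate pq))
  where
  pq : Fin n → ℕ × ℕ
  pq i = p i , q i
  scaled : (m : ℕ) (m<n : m < n) (t : ℕ) (G : Fin (suc n) → Poly2ℤ) →
    sumP (tabulate λ l → evalT (G l) t *P Tpow (toℕ (fromℕ< m<n)) (multiLegendre (scaleAll (t + toℕ l) (tabulate pq))))
    ≡ sumP (tabulate λ l → evalT (G l) t *P Tpow m (multiLegendre (tabulate λ i → (p i * (t + toℕ l) , q i * (t + toℕ l)))))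
  scaled m m<n t G = cong sumP (Listₚ.tabulate-cong λ l → cong₂ (λ m qs → evalT (G l) t *P Tpow m (multiLegendre qs))
    (Finₚ.toℕ-fromℕ< m<n) (Listₚ.map-tabulate pq (λ (a , b) → a * (t + toℕ l) , b * (t + toℕ l))))
  fromRecurrence : Recurrence n (tabulate pq) → _
  fromRecurrence (G , nonvanishing , recurrence) = G , nonvanishing
    -- The recurrence without `T` is the case of exponent 0, as `Tpow 0` is the identity by
    -- definition; `1≤n` provides the index.
    , (λ t → ≡.subst IsZeroP (scaled 0 1≤n t G) (recurrence (fromℕ< 1≤n) t))
    , (λ m _ _ m<n _ _ t → ≡.subst IsZeroP (scaled m m<n t G) (recurrence (fromℕ< m<n) t))
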